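{- Let $\kappa$ be an infinite cardinal (viewed as an initial ordinal), let $n\geq 1$, and let $q_1,\dots,q_n$ be ordinals. Suppose that an ordering $\leq$ on a set $X$ of cardinality $\kappa$ is the intersection of $n$ orderings $\leq_1,\dots,\leq_n$ on $X$ such that each $(X,\leq_i)$ is a WPO of length at most $\kappa\cdot q_i$. Then the length of $(X,\leq)$ is at most $\kappa\cdot\bigotimes_{1\leq i\leq n}q_i$. Moreover, when the $q_i$ are non-zero and of cardinality at most $\kappa$, this bound is attained for a family of $n$ linear orderings of types $\kappa\cdot q_1,\dots,\kappa\cdot q_n$: there are well orderings $\leq_1,\dots,\leq_n$ of respective types $\kappa\cdot q_1,\dots,\kappa\cdot q_n$ on a set of cardinality $\kappa$ whose intersection has length exactly $\kappa\cdot\bigotimes_{1\leq i\leq n}q_i$.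
   Context: Orderings are partial orders, seen as sets of ordered pairs; the intersection of orderings on the same set is their set-theoretic intersection. A poset is well partially ordered (WPO) if it is well founded and has no infinite antichain; equivalently all its linear extensions are well orders. The length $\ell(\mathbf p)$ of a WPO $\mathbf p$ is the largest ordinal type of a linear extension of $\mathbf p$ (the maximum exists by de Jongh–Parikh). $\otimes$ denotes the Hessenberg (natural) product of ordinals; $\kappa\cdot q$ is the usual ordinal product, the type of $q$ successive copies of $\kappa$. -}

module Defs where

open import Axiom.ExcludedMiddle using (ExcludedMiddle)
open import Data.Empty using (⊥-elim)
open import Data.Empty.Polymorphic using (⊥)
open import Data.Fin.Base using (Fin)
open import Data.List.Base using (List; []; _∷_; foldr; map; cartesianProductWith)
open import Data.List.Relation.Unary.Linked using (Linked; []; [-]; _∷_)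
open import Data.Nat.Base using (ℕ; zero; suc)
open import Data.Product.Base using (Σ; Σ-syntax; ∃; _×_; _,_; proj₁; proj₂)
open import Data.Sum.Base using (_⊎_; inj₁; inj₂; [_,_])
open import Data.Unit.Polymorphic using (⊤; tt)
import Data.Vec.Functional as Vector
open import Function.Bundles using (Injection; Inverse)
open import Induction.WellFounded using (Acc; acc; WellFounded)
open import Level using (Level) renaming (suc to lsuc)
open import Relation.Binary.Bundles using (Setoid)
open import Relation.Binary.Core using (Rel; _⇒_)
import Relation.Binary.Construct.NonStrictToStrict as ToStrict
import Relation.Binary.Construct.On as On
open import Relation.Binary.PropositionalEquality.Core using (_≡_; _≢_)
open import Relation.Binary.PropositionalEquality.Properties using (setoid)
open import Relation.Binary.Structures using (IsPartialOrder; IsTotalOrder)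
open import Relation.Nullary using (¬_; yes; no)

private
  variable
    ℓ : Level

------------------------------------------------------------------------
-- Ordinals

-- `lsub f` is the least ordinal strictly above every `f i`.  The `f i` need
-- not exhaust the ordinals below it, and distinct trees may denote the same
-- ordinal: equality of ordinals is _≈_, not _≡_.

data Ord (ℓ : Level) : Set (lsuc ℓ) where
  lsub : {I : Set ℓ} → (I → Ord ℓ) → Ord ℓ

infix 4 _≤_ _<_ _≥_ _≈_

_≤_ : Ord ℓ → Ord ℓ → Set ℓ
lsub f ≤ lsub g = ∀ i → ∃ λ j → f i ≤ g j

_<_ : Ord ℓ → Ord ℓ → Set ℓ
a < lsub g = ∃ λ j → a ≤ g j

_≥_ : Ord ℓ → Ord ℓ → Set ℓ
a ≥ b = b ≤ a

_≈_ : Ord ℓ → Ord ℓ → Set ℓ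
a ≈ b = a ≤ b × b ≤ a

≤-refl : (a : Ord ℓ) → a ≤ a
≤-refl (lsub f) i = i , ≤-refl (f i)

≤-trans : (a b c : Ord ℓ) → a ≤ b → b ≤ c → a ≤ c
≤-trans (lsub f) (lsub g) (lsub h) p q i with p i
... | j , fi≤gj with q j
...   | k , gj≤hk = k , ≤-trans (f i) (g j) (h k) fi≤gj gj≤hk

Ord-setoid : ∀ ℓ → Setoid (lsuc ℓ) ℓ
Ord-setoid ℓ = record
  { Carrier       = Ord ℓ
  ; _≈_           = _≈_
  ; isEquivalence = record
    { refl  = λ {a} → ≤-refl a , ≤-refl a
    ; sym   = λ (p , q) → q , p
    ; trans = λ {a} {b} {c} (p , q) (r , s) → ≤-trans a b c p r , ≤-trans c b a s q
    }
  }

-- The set of ordinals below a.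

↓_ : Ord ℓ → Setoid (lsuc ℓ) ℓ
↓_ {ℓ} a = On.setoid {B = Σ[ b ∈ Ord ℓ ] b < a} (Ord-setoid ℓ) proj₁

------------------------------------------------------------------------
-- Ordinal arithmetic

infixl 6 _+_ _♯_
infixl 7 _·_ _·ℕ_
infix  8 ω^_

𝟎 : Ord ℓ
𝟎 = lsub {I = ⊥} λ ()

osuc : Ord ℓ → Ord ℓ
osuc a = lsub {I = ⊤} λ _ → a

𝟏 : Ord ℓ
𝟏 = osuc 𝟎

_+_ : Ord ℓ → Ord ℓ → Ord ℓ
a@(lsub f) + lsub g = lsub [ f , (λ j → a + g j) ]

_·_ : Ord ℓ → Ord ℓ → Ord ℓ
a@(lsub {I} f) · lsub {J} g = lsub {I = J × I} λ (j , i) → a · g j + f i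

_·ℕ_ : Ord ℓ → ℕ → Ord ℓ
a ·ℕ zero  = 𝟎
a ·ℕ suc n = a + a ·ℕ n

-- 0 and the multiples ω^β·n with β < α and n finite are cofinal in ω^α.

ω^_ : Ord ℓ → Ord ℓ
ω^_ {ℓ} (lsub {I} f) = lsub {I = ⊤ {ℓ} ⊎ (I × ℕ)} [ (λ _ → 𝟎) , (λ (i , n) → ω^ f i ·ℕ n) ]

ω : Ord ℓ
ω = ω^ 𝟏

-- Hessenberg's natural sum: a ♯ b is the least ordinal strictly above all
-- a′ ♯ b (a′ < a) and all a ♯ b′ (b′ < b).

_♯_ : Ord ℓ → Ord ℓ → Ord ℓ
a@(lsub f) ♯ b@(lsub g) = lsub [ (λ i → f i ♯ b) , (λ j → a ♯ g j) ]

∑ω^ : List (Ord ℓ) → Ord ℓ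
∑ω^ es = foldr _+_ 𝟎 (map ω^_ es)

record CantorNormalForm (a : Ord ℓ) : Set (lsuc ℓ) where
  field
    exponents  : List (Ord ℓ)
    descending : Linked _≥_ exponents
    denotes    : ∑ω^ exponents ≈ a

------------------------------------------------------------------------
-- Existence of Cantor normal forms, and the Hessenberg product

private
  <-≤-trans : (a b c : Ord ℓ) → a < b → b ≤ c → a < c
  <-≤-trans a (lsub g) (lsub h) (j , a≤gj) q with q j
  ... | k , gj≤hk = k , ≤-trans a (g j) (h k) a≤gj gj≤hk

  <⇒≤ : (a b : Ord ℓ) → a < b → a ≤ b
  <⇒≤ (lsub f) (lsub g) (j , p) i =
    j , <⇒≤ (f i) (g j) (<-≤-trans (f i) (lsub f) (g j) (i , ≤-refl (f i)) p)

  <-irrefl : (a : Ord ℓ) → ¬ a < a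
  <-irrefl (lsub f) (i , p) =
    <-irrefl (f i) (<-≤-trans (f i) (lsub f) (f i) (i , ≤-refl (f i)) p)

  lsub-≤ : {I : Set ℓ} (f : I → Ord ℓ) (b : Ord ℓ) → (∀ i → f i < b) → lsub f ≤ b
  lsub-≤ f (lsub g) f<b = f<b

  𝟎≤ : (a : Ord ℓ) → 𝟎 ≤ a
  𝟎≤ (lsub f) ()

  x≤x+y : (a b : Ord ℓ) → a ≤ a + b
  x≤x+y (lsub f) (lsub g) i = inj₁ i , ≤-refl (f i)

  +-monoʳ-≤ : (a b c : Ord ℓ) → b ≤ c → a + b ≤ a + c
  +-monoʳ-≤ (lsub f) (lsub g) (lsub h) p (inj₁ i) = inj₁ i , ≤-refl (f i)
  +-monoʳ-≤ a@(lsub f) (lsub g) (lsub h) p (inj₂ j) with p j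
  ... | k , gj≤hk = inj₂ k , +-monoʳ-≤ a (g j) (h k) gj≤hk

  x≤ω^x : (a : Ord ℓ) → a ≤ ω^ a
  x≤ω^x (lsub f) i =
    inj₂ (i , 1) , ≤-trans (f i) (ω^ f i) (ω^ f i + 𝟎) (x≤ω^x (f i)) (x≤x+y (ω^ f i) 𝟎)

  BoundedCNF : Ord ℓ → Ord ℓ → Set (lsuc ℓ)
  BoundedCNF e a = Σ[ c ∈ CantorNormalForm a ] Linked _≥_ (e ∷ CantorNormalForm.exponents c)

  emptyCNF : (e a : Ord ℓ) → a ≤ 𝟎 → BoundedCNF e a
  emptyCNF e a a≤𝟎 = record { exponents = [] ; descending = [] ; denotes = 𝟎≤ a , a≤𝟎 } , [-]

  weakenCNF : (d e a : Ord ℓ) → d ≤ e → BoundedCNF d a → BoundedCNF e a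
  weakenCNF d e a d≤e (c@record { exponents = [] } , _) = c , [-]
  weakenCNF d e a d≤e (c@record { exponents = x ∷ _ } , x≤d ∷ xs) =
    c , ≤-trans x d e x≤d d≤e ∷ xs

  module _ (em : ExcludedMiddle ℓ) where

    ≰⇒> : (a b : Ord ℓ) → ¬ a ≤ b → b < a
    ≰⇒> (lsub {I} f) b a≰b with em {Σ[ i ∈ I ] b ≤ f i}
    ... | yes b<a = b<a
    ... | no  b≮a = ⊥-elim (a≰b (lsub-≤ f b λ i → ≰⇒> b (f i) λ b≤fi → b≮a (i , b≤fi)))

    subtract : (a b c : Ord ℓ) → a ≤ c → c ≤ a + b → Σ[ r ∈ Ord ℓ ] (r ≤ b × c ≈ a + r)
    subtract a b c a≤c c≤a+b with em {a + b ≤ c}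
    ... | yes a+b≤c = b , ≤-refl b , c≤a+b , a+b≤c
    subtract a@(lsub f) b@(lsub g) c a≤c c≤a+b | no a+b≰c with ≰⇒> (a + b) c a+b≰c
    ... | inj₁ i , c≤fi   = ⊥-elim (<-irrefl a (i , ≤-trans a c (f i) a≤c c≤fi))
    ... | inj₂ j , c≤a+gj with subtract a (g j) c a≤c c≤a+gj
    ...   | r , r≤gj , c≈a+r = r , <⇒≤ r b (j , r≤gj) , c≈a+r

    mutual
      cnf-below : (e a : Ord ℓ) → a < ω^ e → BoundedCNF e a
      cnf-below e@(lsub f) a (inj₁ _ , a≤𝟎) = emptyCNF e a a≤𝟎
      cnf-below e@(lsub f) a (inj₂ (i , n) , p) =
        weakenCNF (f i) e a (<⇒≤ (f i) e (i , ≤-refl (f i))) (cnf-multiple (f i) n a p)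

      cnf-multiple : (e : Ord ℓ) (n : ℕ) (a : Ord ℓ) → a ≤ ω^ e ·ℕ n → BoundedCNF e a
      cnf-multiple e zero    a p = emptyCNF e a p
      cnf-multiple e (suc n) a p with em {ω^ e ≤ a}
      ... | no  ω^e≰a = cnf-below e a (≰⇒> (ω^ e) a ω^e≰a)
      ... | yes ω^e≤a with subtract (ω^ e) (ω^ e ·ℕ n) a ω^e≤a p
      ...   | r , r≤ , a≤ω^e+r , ω^e+r≤a with cnf-multiple e n r r≤
      ...     | record { exponents = es ; denotes = s≤r , r≤s } , linked =
        record
          { exponents  = e ∷ es
          ; descending = linked
          ; denotes    =
              ≤-trans (ω^ e + ∑ω^ es) (ω^ e + r) a (+-monoʳ-≤ (ω^ e) (∑ω^ es) r s≤r) ω^e+r≤a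
            , ≤-trans a (ω^ e + r) (ω^ e + ∑ω^ es) a≤ω^e+r (+-monoʳ-≤ (ω^ e) r (∑ω^ es) r≤s)
          } , ≤-refl e ∷ linked

cantorNormalForm : ExcludedMiddle ℓ → (a : Ord ℓ) → CantorNormalForm a
cantorNormalForm em a = proj₁ (cnf-multiple em a 1 a
  (≤-trans a (ω^ a) (ω^ a ·ℕ 1) (x≤ω^x a) (x≤x+y (ω^ a) 𝟎)))

-- Hessenberg's natural product: Cantor normal forms are multiplied like
-- polynomials in ω, exponents and terms being added by the natural sum.
-- Excluded middle is used only to obtain the Cantor normal forms.

hessenberg : ExcludedMiddle ℓ → Ord ℓ → Ord ℓ → Ord ℓ
hessenberg em a b =
  foldr _♯_ 𝟎 (cartesianProductWith (λ d e → ω^ (d ♯ e)) (exponents a) (exponents b))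
  where exponents = λ c → CantorNormalForm.exponents (cantorNormalForm em c)

⨂ : ExcludedMiddle ℓ → {n : ℕ} → (Fin n → Ord ℓ) → Ord ℓ
⨂ em = Vector.foldr (hessenberg em) 𝟏

------------------------------------------------------------------------
-- Cardinality

HasCardinality : Set ℓ → Ord ℓ → Set (lsuc ℓ)
HasCardinality X k = Inverse (setoid X) (↓ k)

CardinalityAtMost : Ord ℓ → Ord ℓ → Set (lsuc ℓ)
CardinalityAtMost a k = Injection (↓ a) (↓ k)

record IsInfiniteCardinal (k : Ord ℓ) : Set (lsuc ℓ) where
  field
    infinite : ω ≤ k
    initial  : ∀ b → b < k → ¬ Inverse (↓ k) (↓ b)

------------------------------------------------------------------------
-- Order types, well partial orders and their lengths

module _ {X : Set ℓ} where

  Strict : Rel X ℓ → Rel X ℓ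
  Strict = ToStrict._<_ _≡_

  rank : (_⊏_ : Rel X ℓ) {x : X} → Acc _⊏_ x → Ord ℓ
  rank _⊏_ {x} (acc rs) = lsub {I = Σ[ y ∈ X ] y ⊏ x} λ (y , y⊏x) → rank _⊏_ (rs y⊏x)

  orderType : (_⊏_ : Rel X ℓ) → WellFounded _⊏_ → Ord ℓ
  orderType _⊏_ wf = lsub λ x → rank _⊏_ (wf x)

  record IsWellOrderOfType (L : Rel X ℓ) (a : Ord ℓ) : Set ℓ where
    field
      isTotalOrder : IsTotalOrder _≡_ L
      wellFounded  : WellFounded (Strict L)
      type         : orderType (Strict L) wellFounded ≈ a

  record IsWPO (R : Rel X ℓ) : Set ℓ where
    field
      isPartialOrder : IsPartialOrder _≡_ R
      wellFounded    : WellFounded (Strict R)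
      noAntichain    : ¬ (Σ[ s ∈ (ℕ → X) ] (∀ i j → i ≢ j → ¬ R (s i) (s j)))

  IsLinearExtension : Rel X ℓ → Rel X ℓ → Set ℓ
  IsLinearExtension R L = IsTotalOrder _≡_ L × (R ⇒ L)

  -- The length is the largest element of the set of ordinal types of linear
  -- extensions, so it is at most b when b bounds that set, and it equals b
  -- when moreover b belongs to that set.

  record IsWPOOfLengthAtMost (R : Rel X ℓ) (b : Ord ℓ) : Set (lsuc ℓ) where
    field
      isWPO : IsWPO R
      bound : ∀ L a → IsLinearExtension R L → IsWellOrderOfType L a → a ≤ b

  record IsWPOOfLength (R : Rel X ℓ) (b : Ord ℓ) : Set (lsuc ℓ) where
    field
      atMost   : IsWPOOfLengthAtMost R b
      attained : Σ[ L ∈ Rel X ℓ ] (IsLinearExtension R L × IsWellOrderOfType L b)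

  ⋂ : {n : ℕ} → (Fin n → Rel X ℓ) → Rel X ℓ
  ⋂ R x y = ∀ i → R i x y

{-# OPTIONS --safe #-}

-- For a well partial order S, let o(Y) (height below) be the rank of the tree of
-- bad sequences in Y, so that o(Y) is the least ordinal above all o({y ∈ Y ∣ x ≰ y}), x ∈ Y.
-- It is subadditive for the natural sum, superadditive along initial segments,
-- and by de Jongh and Parikh it is the length of Y.
--
-- An infinite cardinal is a power of ω, so κ · ω^e is additively indecomposable.
-- If o_i(Y) ≤ κ · ω^(e_i) for every i, then o_L(Y) ≤ κ · ω^(⨁ e_i) for each linear
-- extension L of the intersection, by induction on ⨁ e_i: for x ∈ Y the elements
-- y with x ≰ y are those with x ≰_i y for some i, and these split into finitely
-- many parts on which e_i is smaller and a part of cardinality less than κ.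
-- Cutting X along the Cantor normal forms of the q_i gives the general bound.
--
-- For the converse, give the elements of κ coordinates below the q_i so that all
-- fibres have cardinality κ, and order κ by the i-th coordinate first.  A product
-- of intervals of types ω^(e_i) then has o ≥ κ · ω^(⨁ e_i), and arranging these
-- products by descending ⨁ e_i makes superadditivity yield the natural sum.
module Submission where

open import Defs
open import Axiom.ExcludedMiddle using (ExcludedMiddle)
open import Axiom.Extensionality.Propositional using (Extensionality)
open import Axiom.UniquenessOfIdentityProofs.WithK using (uip)
open import Data.Bool.Base using (Bool; true)
open import Data.Empty using (⊥; ⊥-elim)
import Data.Empty.Polymorphic as Polymorphic
open import Data.Fin.Base using (Fin; zero; suc)
open import Data.Fin.Properties using (_≟_)
open import Data.List.Base using (List; []; _∷_; foldr; map; _++_; length; cartesianProductWith)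
open import Data.List.Properties using (map-id)
open import Data.List.Relation.Binary.Permutation.Propositional as ↭ using (_↭_)
open import Data.List.Relation.Binary.Permutation.Propositional.Properties using (All-resp-↭)
open import Data.List.Relation.Unary.All as All using (All; []; _∷_)
import Data.List.Relation.Unary.All.Properties as All
open import Data.List.Relation.Unary.AllPairs as AllPairs using (AllPairs; []; _∷_)
import Data.List.Relation.Unary.AllPairs.Properties as AllPairs
open import Data.List.Relation.Unary.Linked.Properties using (Linked⇒AllPairs)
open import Data.Maybe.Base using (Maybe; just; nothing)
open import Data.Maybe.Properties using (just-injective)
open import Data.Nat.Base as ℕ using (ℕ; zero; suc; NonZero)
import Data.Nat.Properties as ℕ
open import Data.Product.Base using (Σ-syntax; ∃; _×_; _,_; proj₁; proj₂)
open import Data.Sum.Base as Sum using (_⊎_; inj₁; inj₂; [_,_])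
open import Data.Unit.Polymorphic using (⊤; tt)
open import Data.Vec.Functional as Vector using (updateAt)
open import Data.Vec.Functional.Properties using (updateAt-updates; updateAt-minimal)
open import Function.Base using (_∘_; id; const)
open import Function.Bundles using (Inverse; Injection; mk⇔)
import Function.Construct.Composition as Composition
import Function.Construct.Symmetry as Symmetry
open import Induction.WellFounded using (Acc; acc; WellFounded)
open import Level using (Level) renaming (suc to lsuc)
open import Relation.Binary.Core using (Rel; _⇔_)
open import Relation.Binary.Definitions using (Transitive; tri<; tri≈; tri>)
open import Relation.Binary.PropositionalEquality.Core using (_≡_; _≢_; refl; subst; sym; trans; cong)
open import Relation.Binary.PropositionalEquality.Properties using (setoid; isEquivalence)
import Relation.Binary.Reasoning.Base.Triple as Triple
open import Relation.Binary.Structures using (IsPartialOrder; IsPreorder; IsTotalOrder)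
open import Relation.Nullary using (¬_; Dec; yes; no; does)
open import Relation.Nullary.Decidable using (does-⇔; dec-true)
open import Relation.Unary using (Pred; _⊆_; _∪_)

-- The length is a maximum over linear extensions and is hard to follow when passing to subsets.
-- Heights are defined for all subsets and obey one inequality for unions and one for initial
-- segments. The height of a linear order is its order type, so the upper bound treats each linear
-- extension `L` of the intersection separately. The theorem of de Jongh and Parikh serves to turn a
-- hypothesis on the linear extensions of each given order into one on its heights, and at the end
-- to attain the maximum.
--
-- The obstacle in the upper bound is a remainder: an ordinal below `κ · ω^ e` is at most
-- `κ · d + r` with `d ≺ ω^ e` and `r ≺ κ`, and on the part of height `r` no exponent decreases.
-- That part has fewer than `κ` elements, so that as `κ` is a cardinal its type is below `κ` in
-- every well order.
--
-- The Hessenberg product is an iteration that takes a new Cantor normal form of each partial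
-- product. It is first rewritten as one natural sum over all choices of an exponent from every
-- factor; the terms of this sum match the parts into which `X` is cut, and the boxes of the
-- extremal example.

private
  variable
    ℓ p : Level

-- Order and arithmetic of ordinals up to `_≋_`

infix 4 _≼_ _≺_ _≋_

-- _≤_ and _<_ compute on trees, so their arguments cannot be inferred;
-- wrapped in a record they can.
record _≼_ (a b : Ord ℓ) : Set ℓ where
  constructor wrap
  field unwrap : a ≤ b

record _≺_ (a b : Ord ℓ) : Set ℓ where
  constructor wrap
  field unwrap : a < b

open _≼_ public using () renaming (unwrap to unwrap≼)
open _≺_ public using () renaming (unwrap to unwrap≺)

_≋_ : Ord ℓ → Ord ℓ → Set ℓ
a ≋ b = a ≼ b × b ≼ a

≋⇒≈ : {a b : Ord ℓ} → a ≋ b → a ≈ b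
≋⇒≈ (wrap p , wrap q) = p , q

≈⇒≋ : {a b : Ord ℓ} → a ≈ b → a ≋ b
≈⇒≋ (p , q) = wrap p , wrap q

≼-refl : {a : Ord ℓ} → a ≼ a
≼-refl {a = a} = wrap (≤-refl a)

≼-trans : {a b c : Ord ℓ} → a ≼ b → b ≼ c → a ≼ c
≼-trans {a = a} {b} {c} (wrap p) (wrap q) = wrap (≤-trans a b c p q)

≼-≺-trans : {a b c : Ord ℓ} → a ≼ b → b ≺ c → a ≺ c
≼-≺-trans {a = a} {b} {lsub h} (wrap p) (wrap (k , q)) = wrap (k , ≤-trans a b (h k) p q)

≺-≼-trans : {a b c : Ord ℓ} → a ≺ b → b ≼ c → a ≺ c
≺-≼-trans {a = a} {lsub g} {lsub h} (wrap (j , p)) (wrap q) =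
  wrap (proj₁ (q j) , ≤-trans a (g j) (h (proj₁ (q j))) p (proj₂ (q j)))

≺lsub : {I : Set ℓ} {a : Ord ℓ} (f : I → Ord ℓ) (i : I) → a ≼ f i → a ≺ lsub f
≺lsub f i (wrap p) = wrap (i , p)

≺lsub⁻ : {I : Set ℓ} {a : Ord ℓ} {f : I → Ord ℓ} → a ≺ lsub f → Σ[ i ∈ I ] a ≼ f i
≺lsub⁻ (wrap (i , p)) = i , wrap p

lsub≼ : {I : Set ℓ} {f : I → Ord ℓ} {b : Ord ℓ} → (∀ i → f i ≺ b) → lsub f ≼ b
lsub≼ {b = lsub g} p = wrap λ i → unwrap≺ (p i)

lsub≼⁻ : {I : Set ℓ} {f : I → Ord ℓ} {b : Ord ℓ} → lsub f ≼ b → ∀ i → f i ≺ b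
lsub≼⁻ {f = f} p i = ≺-≼-trans (≺lsub f i ≼-refl) p

≺⇒≼ : {a b : Ord ℓ} → a ≺ b → a ≼ b
≺⇒≼ {a = lsub f} {lsub g} (wrap (j , p)) =
  lsub≼ λ i → ≺lsub g j (≺⇒≼ (lsub≼⁻ (wrap p) i))

≺-trans : {a b c : Ord ℓ} → a ≺ b → b ≺ c → a ≺ c
≺-trans p q = ≼-≺-trans (≺⇒≼ p) q

≺-irrefl : {a : Ord ℓ} → ¬ a ≺ a
≺-irrefl {a = lsub f} (wrap (i , p)) = ≺-irrefl (lsub≼⁻ {f = f} (wrap p) i)

≼⇒⊁ : {a b : Ord ℓ} → a ≼ b → ¬ b ≺ a
≼⇒⊁ p q = ≺-irrefl (≼-≺-trans p q)

≺-wellFounded : WellFounded (_≺_ {ℓ})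
≺-wellFounded a = acc (below a)
  where
  below : ∀ a {b} → b ≺ a → Acc _≺_ b
  below (lsub f) (wrap (i , p)) = acc λ q → below (f i) (≺-≼-trans q (wrap p))

≋-refl : {a : Ord ℓ} → a ≋ a
≋-refl = ≼-refl , ≼-refl

≋-sym : {a b : Ord ℓ} → a ≋ b → b ≋ a
≋-sym (p , q) = q , p

≋-trans : {a b c : Ord ℓ} → a ≋ b → b ≋ c → a ≋ c
≋-trans (p , q) (r , s) = ≼-trans p r , ≼-trans s q

≼-isPreorder : IsPreorder (_≋_ {ℓ}) _≼_
≼-isPreorder = record
  { isEquivalence = record { refl = ≋-refl ; sym = ≋-sym ; trans = ≋-trans }
  ; reflexive = proj₁
  ; trans = ≼-trans
  }

module ≼-Reasoning {ℓ} = Triple (≼-isPreorder {ℓ})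
  (λ p q → ≺-irrefl (≺-trans p q)) ≺-trans
  ((λ p q → ≺-≼-trans q (proj₁ p)) , (λ p q → ≼-≺-trans (proj₂ p) q))
  ≺⇒≼ ≺-≼-trans ≼-≺-trans

𝟎≼ : {a : Ord ℓ} → 𝟎 ≼ a
𝟎≼ {a = lsub f} = wrap λ ()

⊀𝟎 : {a : Ord ℓ} → ¬ a ≺ 𝟎
⊀𝟎 (wrap ())

≺osuc : {a b : Ord ℓ} → a ≼ b → a ≺ osuc b
≺osuc (wrap p) = wrap (_ , p)

≺osuc⁻ : {a b : Ord ℓ} → a ≺ osuc b → a ≼ b
≺osuc⁻ (wrap (_ , p)) = wrap p

osuc≼ : {a b : Ord ℓ} → a ≺ b → osuc a ≼ b
osuc≼ p = lsub≼ λ _ → p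

-- Addition

x≼x+y : (a b : Ord ℓ) → a ≼ a + b
x≼x+y a@(lsub f) b@(lsub g) = lsub≼ λ i → ≺lsub [ f , (λ j → a + g j) ] (inj₁ i) ≼-refl

+-monoʳ-≼ : (a : Ord ℓ) {b c : Ord ℓ} → b ≼ c → a + b ≼ a + c
+-monoʳ-≺ : (a : Ord ℓ) {b c : Ord ℓ} → b ≺ c → a + b ≺ a + c
+-monoʳ-≼ a@(lsub f) {lsub g} {lsub h} p = lsub≼ λ where
  (inj₁ i) → ≺lsub [ f , _ ] (inj₁ i) ≼-refl
  (inj₂ j) → +-monoʳ-≺ a (lsub≼⁻ p j)
+-monoʳ-≺ a@(lsub f) {b} {lsub h} (wrap (k , p)) =
  ≺lsub [ f , (λ k → a + h k) ] (inj₂ k) (+-monoʳ-≼ a (wrap p))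

+-monoˡ-≼ : {a b : Ord ℓ} (c : Ord ℓ) → a ≼ b → a + c ≼ b + c
+-monoˡ-≼ {a = lsub f} {b} (lsub h) p = lsub≼ λ where
  (inj₁ i) → ≺-≼-trans (lsub≼⁻ p i) (x≼x+y b (lsub h))
  (inj₂ k) → ≼-≺-trans (+-monoˡ-≼ (h k) p) (+-monoʳ-≺ b (≺lsub h k ≼-refl))

+-mono-≼ : {a b c d : Ord ℓ} → a ≼ b → c ≼ d → a + c ≼ b + d
+-mono-≼ {b = b} {c} p q = ≼-trans (+-monoˡ-≼ c p) (+-monoʳ-≼ b q)

+-cong : {a b c d : Ord ℓ} → a ≋ b → c ≋ d → a + c ≋ b + d
+-cong (p , q) (r , s) = +-mono-≼ p r , +-mono-≼ q s

-- Each operation has such a pair of rules, one bounding its value and one (here `≺+⁻`) decomposing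
-- the ordinals below it; with them most arguments need not follow the trees.
+-least : {a b d : Ord ℓ} → a ≼ d → (∀ c → c ≺ b → a + c ≺ d) → a + b ≼ d
+-least {a = lsub f} {lsub g} p q = lsub≼ λ where
  (inj₁ i) → lsub≼⁻ p i
  (inj₂ j) → q (g j) (≺lsub g j ≼-refl)

≺+⁻ : {a b c : Ord ℓ} → c ≺ a + b → c ≺ a ⊎ (Σ[ d ∈ Ord ℓ ] (d ≺ b × c ≼ a + d))
≺+⁻ {a = lsub f} {lsub g} (wrap (inj₁ i , p)) = inj₁ (wrap (i , p))
≺+⁻ {a = lsub f} {lsub g} (wrap (inj₂ j , p)) = inj₂ (g j , ≺lsub g j ≼-refl , wrap p)

x≼y+x : (a b : Ord ℓ) → b ≼ a + b
x≼y+x a (lsub g) = lsub≼ λ j → ≼-≺-trans (x≼y+x a (g j)) (+-monoʳ-≺ a (≺lsub g j ≼-refl))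

+-identityʳ : (a : Ord ℓ) → a + 𝟎 ≋ a
+-identityʳ a = +-least ≼-refl (λ _ p → ⊥-elim (⊀𝟎 p)) , x≼x+y a 𝟎

+-identityˡ : (a : Ord ℓ) → 𝟎 + a ≋ a
+-identityˡ a = below a , x≼y+x 𝟎 a
  where
  below : ∀ a → 𝟎 + a ≼ a
  below (lsub f) = lsub≼ λ where
    (inj₂ i) → ≼-≺-trans (below (f i)) (≺lsub f i ≼-refl)

+-assoc : (a b c : Ord ℓ) → (a + b) + c ≋ a + (b + c)
+-assoc a b c = to a b c , from a b c
  where
  to : ∀ a b c → (a + b) + c ≼ a + (b + c)
  to a b (lsub h) = +-least (+-monoʳ-≼ a (x≼x+y b _)) λ where
    d p@(wrap (k , q)) → ≼-≺-trans
      (≼-trans (+-monoʳ-≼ (a + b) (wrap q)) (to a b (h k)))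
      (+-monoʳ-≺ a (+-monoʳ-≺ b (≺lsub h k ≼-refl)))
  from : ∀ a b c → a + (b + c) ≼ (a + b) + c
  from a b c@(lsub h) = +-least (≼-trans (x≼x+y a b) (x≼x+y (a + b) c)) λ d p → case d (≺+⁻ p)
    where
    case : ∀ d → d ≺ b ⊎ (Σ[ e ∈ _ ] (e ≺ c × d ≼ b + e)) → a + d ≺ (a + b) + c
    case d (inj₁ p) = ≺-≼-trans (+-monoʳ-≺ a p) (x≼x+y (a + b) c)
    case d (inj₂ (e , wrap (k , p) , q)) = ≼-≺-trans
      (≼-trans (+-monoʳ-≼ a (≼-trans q (+-monoʳ-≼ b (wrap p)))) (from a b (h k)))
      (+-monoʳ-≺ (a + b) (≺lsub h k ≼-refl))

-- Natural sum

♯-monoˡ-≼ : {a b : Ord ℓ} (c : Ord ℓ) → a ≼ b → a ♯ c ≼ b ♯ c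
♯-monoˡ-≺ : {a b : Ord ℓ} (c : Ord ℓ) → a ≺ b → a ♯ c ≺ b ♯ c
♯-monoʳ-≼ : (a : Ord ℓ) {b c : Ord ℓ} → b ≼ c → a ♯ b ≼ a ♯ c
♯-monoʳ-≺ : (a : Ord ℓ) {b c : Ord ℓ} → b ≺ c → a ♯ b ≺ a ♯ c
♯-monoˡ-≼ {a = lsub f} {b@(lsub g)} c@(lsub h) p = lsub≼
  [ (λ i → ♯-monoˡ-≺ c (lsub≼⁻ p i))
  , (λ k → ≺lsub [ _ , (λ k → b ♯ h k) ] (inj₂ k) (♯-monoˡ-≼ (h k) p)) ]
♯-monoˡ-≺ {a = a} {lsub g} c@(lsub h) (wrap (j , p)) =
  ≺lsub [ (λ j → g j ♯ c) , _ ] (inj₁ j) (♯-monoˡ-≼ c (wrap p))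
♯-monoʳ-≼ a@(lsub f) {lsub g} {c@(lsub h)} p = lsub≼
  [ (λ i → ≺lsub [ (λ i → f i ♯ c) , _ ] (inj₁ i) (♯-monoʳ-≼ (f i) p))
  , (λ j → ♯-monoʳ-≺ a (lsub≼⁻ p j)) ]
♯-monoʳ-≺ a@(lsub f) {b} {lsub h} (wrap (k , p)) =
  ≺lsub [ _ , (λ k → a ♯ h k) ] (inj₂ k) (♯-monoʳ-≼ a (wrap p))

♯-mono-≼ : {a b c d : Ord ℓ} → a ≼ b → c ≼ d → a ♯ c ≼ b ♯ d
♯-mono-≼ {b = b} {c} p q = ≼-trans (♯-monoˡ-≼ c p) (♯-monoʳ-≼ b q)

♯-cong : {a b c d : Ord ℓ} → a ≋ b → c ≋ d → a ♯ c ≋ b ♯ d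
♯-cong (p , q) (r , s) = ♯-mono-≼ p r , ♯-mono-≼ q s

♯-least : {a b d : Ord ℓ} → (∀ c → c ≺ a → c ♯ b ≺ d) → (∀ c → c ≺ b → a ♯ c ≺ d) → a ♯ b ≼ d
♯-least {a = lsub f} {lsub g} p q = lsub≼ λ where
  (inj₁ i) → p (f i) (≺lsub f i ≼-refl)
  (inj₂ j) → q (g j) (≺lsub g j ≼-refl)

≺♯⁻ : {a b c : Ord ℓ} → c ≺ a ♯ b →
      (Σ[ d ∈ Ord ℓ ] (d ≺ a × c ≼ d ♯ b)) ⊎ (Σ[ d ∈ Ord ℓ ] (d ≺ b × c ≼ a ♯ d))
≺♯⁻ {a = lsub f} {lsub g} (wrap (inj₁ i , p)) = inj₁ (f i , ≺lsub f i ≼-refl , wrap p)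
≺♯⁻ {a = lsub f} {lsub g} (wrap (inj₂ j , p)) = inj₂ (g j , ≺lsub g j ≼-refl , wrap p)

♯-comm : (a b : Ord ℓ) → a ♯ b ≋ b ♯ a
♯-comm a b = swap a b , swap b a
  where
  swap : ∀ a b → a ♯ b ≼ b ♯ a
  swap a@(lsub f) b@(lsub g) = lsub≼
    [ (λ i → ≼-≺-trans (swap (f i) b) (♯-monoʳ-≺ b (≺lsub f i ≼-refl)))
    , (λ j → ≼-≺-trans (swap a (g j)) (♯-monoˡ-≺ a (≺lsub g j ≼-refl))) ]

♯-assoc : (a b c : Ord ℓ) → (a ♯ b) ♯ c ≋ a ♯ (b ♯ c)
-- The converse is `to c b a` with both sides reversed by commutativity.
♯-assoc a b c = to a b c ,
  ≼-trans (proj₁ (♯-comm a (b ♯ c))) (≼-trans (♯-monoˡ-≼ a (proj₁ (♯-comm b c)))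
  (≼-trans (to c b a) (≼-trans (♯-monoʳ-≼ c (proj₁ (♯-comm b a))) (proj₁ (♯-comm c (a ♯ b))))))
  where
  to : ∀ a b c → (a ♯ b) ♯ c ≼ a ♯ (b ♯ c)
  to a@(lsub f) b@(lsub g) c@(lsub h) = lsub≼
    [ [ (λ i → ≼-≺-trans (to (f i) b c) (♯-monoˡ-≺ (b ♯ c) (≺lsub f i ≼-refl)))
      , (λ j → ≼-≺-trans (to a (g j) c) (♯-monoʳ-≺ a (♯-monoˡ-≺ c (≺lsub g j ≼-refl)))) ]
    , (λ k → ≼-≺-trans (to a b (h k)) (♯-monoʳ-≺ a (♯-monoʳ-≺ b (≺lsub h k ≼-refl)))) ]

x≼x♯y : (a b : Ord ℓ) → a ≼ a ♯ b
x≼x♯y (lsub f) b = lsub≼ λ i → ≼-≺-trans (x≼x♯y (f i) b) (♯-monoˡ-≺ b (≺lsub f i ≼-refl))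

x≼y♯x : (a b : Ord ℓ) → b ≼ a ♯ b
x≼y♯x a b = ≼-trans (x≼x♯y b a) (proj₁ (♯-comm b a))

♯-identityʳ : (a : Ord ℓ) → a ♯ 𝟎 ≋ a
♯-identityʳ a = below a , x≼x♯y a 𝟎
  where
  below : ∀ a → a ♯ 𝟎 ≼ a
  below (lsub f) = lsub≼ λ where
    (inj₁ i) → ≼-≺-trans (below (f i)) (≺lsub f i ≼-refl)

♯-identityˡ : (a : Ord ℓ) → 𝟎 ♯ a ≋ a
♯-identityˡ a = ≋-trans (♯-comm 𝟎 a) (♯-identityʳ a)

+≼♯ : (a b : Ord ℓ) → a + b ≼ a ♯ b
+≼♯ a (lsub g) = +-least (x≼x♯y a (lsub g)) λ where
  c (wrap (j , p)) → ≼-≺-trans (≼-trans (+-monoʳ-≼ a (wrap p)) (+≼♯ a (g j)))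
                               (♯-monoʳ-≺ a (≺lsub g j ≼-refl))

-- Multiplication

·-monoʳ-≼ : (a : Ord ℓ) {b c : Ord ℓ} → b ≼ c → a · b ≼ a · c
·-monoʳ-≼ a@(lsub f) {lsub g} {lsub h} (wrap p) = lsub≼ λ (j , i) →
  ≺lsub (λ (k , i) → a · h k + f i) (proj₁ (p j) , i)
        (+-monoˡ-≼ (f i) (·-monoʳ-≼ a (wrap (proj₂ (p j)))))

-- `a · d + c` is the place of point `c` in copy number `d` of `a`, so products are handled as
-- lexicographic pairs.
·-position-≺ : {a b c d : Ord ℓ} → c ≺ a → d ≺ b → a · d + c ≺ a · b
·-position-≺ {a = a@(lsub f)} {lsub g} {c} {d} (wrap (i , p)) (wrap (j , q)) =
  ≺lsub (λ (j , i) → a · g j + f i) (j , i) (+-mono-≼ (·-monoʳ-≼ a (wrap q)) (wrap p))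

≺·⁻ : {a b c : Ord ℓ} → c ≺ a · b → Σ[ d ∈ Ord ℓ ] Σ[ r ∈ Ord ℓ ] (d ≺ b × r ≺ a × c ≼ a · d + r)
≺·⁻ {a = lsub f} {lsub g} (wrap ((j , i) , p)) =
  g j , f i , ≺lsub g j ≼-refl , ≺lsub f i ≼-refl , wrap p

·-least : {a b c : Ord ℓ} → (∀ d r → d ≺ b → r ≺ a → a · d + r ≺ c) → a · b ≼ c
·-least {a = lsub f} {lsub g} p =
  lsub≼ λ (j , i) → p (g j) (f i) (≺lsub g j ≼-refl) (≺lsub f i ≼-refl)

·-monoˡ-≼ : {a b : Ord ℓ} (c : Ord ℓ) → a ≼ b → a · c ≼ b · c
·-monoˡ-≼ {b = b} (lsub h) p = ·-least λ where
  d r (wrap (k , q)) r≺a → ≼-≺-trans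
    (+-monoˡ-≼ r (≼-trans (·-monoʳ-≼ _ (wrap q)) (·-monoˡ-≼ (h k) p)))
    (·-position-≺ (≺-≼-trans r≺a p) (≺lsub h k ≼-refl))

·-cong : (a : Ord ℓ) {b c : Ord ℓ} → b ≋ c → a · b ≋ a · c
·-cong a (p , q) = ·-monoʳ-≼ a p , ·-monoʳ-≼ a q

·-zeroʳ : (a : Ord ℓ) → a · 𝟎 ≋ 𝟎
·-zeroʳ a = ·-least (λ _ _ p _ → ⊥-elim (⊀𝟎 p)) , 𝟎≼

·-osuc : (a b : Ord ℓ) → a · osuc b ≋ a · b + a
·-osuc a b =
    ·-least (λ d r p q → ≺-≼-trans (+-monoʳ-≺ (a · d) q) (+-monoˡ-≼ a (·-monoʳ-≼ a (≺osuc⁻ p))))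
  , +-least (·-monoʳ-≼ a (≺⇒≼ (≺osuc ≼-refl))) (λ c p → ·-position-≺ p (≺osuc ≼-refl))

·-monoʳ-≺ : (a : Ord ℓ) {b c : Ord ℓ} → 𝟎 ≺ a → b ≺ c → a · b ≺ a · c
·-monoʳ-≺ a {b} p q = ≼-≺-trans (x≼x+y (a · b) 𝟎) (·-position-≺ p q)

·-position-≺-≼ : (a : Ord ℓ) {c d b e : Ord ℓ} → c ≺ a → d ≺ b → a · d + c ≺ a · b + e
·-position-≺-≼ a {b = b} {e} p q = ≺-≼-trans (·-position-≺ p q) (x≼x+y (a · b) e)

·-distribˡ-+ : (a b c : Ord ℓ) → a · (b + c) ≋ a · b + a · c
·-distribˡ-+ a b c = to c , from c
  where
  to : ∀ c → a · (b + c) ≼ a · b + a · c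
  to c@(lsub h) = ·-least λ d r p q → case d r q (≺+⁻ p)
    where
    case : ∀ d r → r ≺ a → d ≺ b ⊎ (Σ[ e ∈ _ ] (e ≺ c × d ≼ b + e)) → a · d + r ≺ a · b + a · c
    case d r q (inj₁ p) = ·-position-≺-≼ a q p
    case d r q (inj₂ (e , wrap (k , p) , s)) = begin-strict
      a · d + r               ≤⟨ +-monoˡ-≼ r (·-monoʳ-≼ a (≼-trans s (+-monoʳ-≼ b (wrap p)))) ⟩
      a · (b + h k) + r       ≤⟨ +-monoˡ-≼ r (to (h k)) ⟩
      (a · b + a · h k) + r   ≈⟨ +-assoc (a · b) (a · h k) r ⟩
      a · b + (a · h k + r)   <⟨ +-monoʳ-≺ (a · b) (·-position-≺ q (≺lsub h k ≼-refl)) ⟩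
      a · b + a · c           ∎
      where open ≼-Reasoning
  from : ∀ c → a · b + a · c ≼ a · (b + c)
  from c@(lsub h) = +-least (·-monoʳ-≼ a (x≼x+y b c)) λ d p → case d (≺·⁻ p)
    where
    case : ∀ d → Σ[ e ∈ _ ] Σ[ r ∈ _ ] (e ≺ c × r ≺ a × d ≼ a · e + r) → a · b + d ≺ a · (b + c)
    case d (e , r , wrap (k , p) , q , s) = begin-strict
      a · b + d               ≤⟨ +-monoʳ-≼ (a · b) (≼-trans s (+-monoˡ-≼ r (·-monoʳ-≼ a (wrap p)))) ⟩
      a · b + (a · h k + r)   ≈⟨ ≋-sym (+-assoc (a · b) (a · h k) r) ⟩
      (a · b + a · h k) + r   ≤⟨ +-monoˡ-≼ r (from (h k)) ⟩
      a · (b + h k) + r       <⟨ ·-position-≺ q (+-monoʳ-≺ b (≺lsub h k ≼-refl)) ⟩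
      a · (b + c)             ∎
      where open ≼-Reasoning

·-distribˡ-·ℕ : (a b : Ord ℓ) (n : ℕ) → a · (b ·ℕ n) ≋ (a · b) ·ℕ n
·-distribˡ-·ℕ a b zero    = ·-zeroʳ a
·-distribˡ-·ℕ a b (suc n) =
  ≋-trans (·-distribˡ-+ a b (b ·ℕ n)) (+-cong ≋-refl (·-distribˡ-·ℕ a b n))

·ℕ-mono-≼ : {a b : Ord ℓ} (n : ℕ) → a ≼ b → a ·ℕ n ≼ b ·ℕ n
·ℕ-mono-≼ zero    p = ≼-refl
·ℕ-mono-≼ (suc n) p = +-mono-≼ p (·ℕ-mono-≼ n p)

·ℕ-one : (a : Ord ℓ) → a ·ℕ 1 ≋ a
·ℕ-one = +-identityʳ

·ℕ-suc : (a : Ord ℓ) (n : ℕ) → a ·ℕ n + a ≋ a + a ·ℕ n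
·ℕ-suc a zero    = ≋-trans (+-identityˡ a) (≋-sym (+-identityʳ a))
·ℕ-suc a (suc n) = ≋-trans (+-assoc a (a ·ℕ n) a) (+-cong ≋-refl (·ℕ-suc a n))

-- Powers of ω

𝟎≺ω^ : {a : Ord ℓ} → 𝟎 ≺ ω^ a
𝟎≺ω^ {a = lsub f} = wrap (inj₁ tt , ≤-refl 𝟎)

ω^-multiple-≺ : {a b : Ord ℓ} (n : ℕ) → a ≺ b → ω^ a ·ℕ n ≺ ω^ b
ω^-mono-≼ : {a b : Ord ℓ} → a ≼ b → ω^ a ≼ ω^ b
ω^-mono-≼ {a = lsub f} {lsub g} p = lsub≼ λ where
  (inj₁ _)       → 𝟎≺ω^ {a = lsub g}
  (inj₂ (i , n)) → ω^-multiple-≺ n (lsub≼⁻ p i)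
ω^-multiple-≺ {a = a} {lsub g} n (wrap (j , p)) =
  ≺lsub [ (λ _ → 𝟎) , (λ (j , n) → ω^ g j ·ℕ n) ] (inj₂ (j , n)) (·ℕ-mono-≼ n (ω^-mono-≼ (wrap p)))

ω^-mono-≺ : {a b : Ord ℓ} → a ≺ b → ω^ a ≺ ω^ b
ω^-mono-≺ {a = a} p = ≼-≺-trans (proj₂ (·ℕ-one (ω^ a))) (ω^-multiple-≺ 1 p)

x≼ω^x : (a : Ord ℓ) → a ≼ ω^ a
x≼ω^x (lsub f) = lsub≼ λ i → ≼-≺-trans (x≼ω^x (f i)) (ω^-mono-≺ (≺lsub f i ≼-refl))

≺ω^⁻ : {a b : Ord ℓ} → b ≺ ω^ a → b ≼ 𝟎 ⊎ (Σ[ c ∈ Ord ℓ ] (c ≺ a × Σ[ n ∈ ℕ ] b ≼ ω^ c ·ℕ n))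
≺ω^⁻ {a = lsub f} (wrap (inj₁ _ , p))       = inj₁ (wrap p)
≺ω^⁻ {a = lsub f} (wrap (inj₂ (i , n) , p)) = inj₂ (f i , ≺lsub f i ≼-refl , n , wrap p)

ω^-least : {a c : Ord ℓ} → 𝟎 ≺ c → (∀ d → d ≺ a → ∀ n → ω^ d ·ℕ n ≺ c) → ω^ a ≼ c
ω^-least {a = lsub f} p q = lsub≼ λ where
  (inj₁ _)       → p
  (inj₂ (i , n)) → q (f i) (≺lsub f i ≼-refl) n

·-𝟏 : (a : Ord ℓ) → a · 𝟏 ≋ a
·-𝟏 a = ≋-trans (·-osuc a 𝟎) (≋-trans (+-cong (·-zeroʳ a) ≋-refl) (+-identityˡ a))

ω^-distrib-+ : (a b : Ord ℓ) → ω^ (a + b) ≋ ω^ a · ω^ b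
ω^-distrib-+ a b = to b , from b
  where
  open ≼-Reasoning
  to : ∀ b → ω^ (a + b) ≼ ω^ a · ω^ b
  to b@(lsub g) = ω^-least (≼-≺-trans 𝟎≼ (·-monoʳ-≺ (ω^ a) (𝟎≺ω^ {a = a}) (𝟎≺ω^ {a = b})))
    λ d p n → case d n (≺+⁻ p)
    where
    case : ∀ d n → d ≺ a ⊎ (Σ[ e ∈ _ ] (e ≺ b × d ≼ a + e)) → ω^ d ·ℕ n ≺ ω^ a · ω^ b
    case d n (inj₁ p) = begin-strict
      ω^ d ·ℕ n        <⟨ ω^-multiple-≺ n p ⟩
      ω^ a             ≈⟨ ≋-sym (·-𝟏 (ω^ a)) ⟩
      ω^ a · 𝟏         ≤⟨ ·-monoʳ-≼ (ω^ a) (osuc≼ (𝟎≺ω^ {a = b})) ⟩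
      ω^ a · ω^ b      ∎
    case d n (inj₂ (e , wrap (k , p) , q)) = begin-strict
      ω^ d ·ℕ n              ≤⟨ ·ℕ-mono-≼ n (ω^-mono-≼ (≼-trans q (+-monoʳ-≼ a (wrap p)))) ⟩
      ω^ (a + g k) ·ℕ n      ≤⟨ ·ℕ-mono-≼ n (to (g k)) ⟩
      (ω^ a · ω^ g k) ·ℕ n   ≈⟨ ≋-sym (·-distribˡ-·ℕ (ω^ a) (ω^ g k) n) ⟩
      ω^ a · (ω^ g k ·ℕ n)   <⟨ ·-monoʳ-≺ (ω^ a) (𝟎≺ω^ {a = a}) (ω^-multiple-≺ n (≺lsub g k ≼-refl)) ⟩
      ω^ a · ω^ b            ∎
  from : ∀ b → ω^ a · ω^ b ≼ ω^ (a + b)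
  from b@(lsub g) = ·-least λ d r p q → case d r q (≺ω^⁻ p)
    where
    case : ∀ d r → r ≺ ω^ a → d ≼ 𝟎 ⊎ (Σ[ c ∈ _ ] (c ≺ b × Σ[ n ∈ ℕ ] d ≼ ω^ c ·ℕ n)) →
           ω^ a · d + r ≺ ω^ (a + b)
    case d r q (inj₁ p) = begin-strict
      ω^ a · d + r     ≤⟨ +-monoˡ-≼ r (≼-trans (·-monoʳ-≼ (ω^ a) p) (proj₁ (·-zeroʳ (ω^ a)))) ⟩
      𝟎 + r            ≈⟨ +-identityˡ r ⟩
      r                <⟨ q ⟩
      ω^ a             ≤⟨ ω^-mono-≼ (x≼x+y a b) ⟩
      ω^ (a + b)       ∎
    -- The remainder `r`, being below `ω^ a`, is absorbed by one more copy of `ω^ (a + g k)`, whence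
    -- `suc n`.
    case d r q (inj₂ (c , wrap (k , p) , n , s)) = begin-strict
      ω^ a · d + r                          <⟨ +-monoʳ-≺ (ω^ a · d) q ⟩
      ω^ a · d + ω^ a                       ≤⟨ +-mono-≼ (·-monoʳ-≼ (ω^ a) (≼-trans s (·ℕ-mono-≼ n (ω^-mono-≼ (wrap p)))))
                                                        (ω^-mono-≼ (x≼x+y a (g k))) ⟩
      ω^ a · (ω^ g k ·ℕ n) + ω^ (a + g k)   ≤⟨ +-monoˡ-≼ _ (≼-trans (proj₁ (·-distribˡ-·ℕ (ω^ a) (ω^ g k) n)) (·ℕ-mono-≼ n (from (g k)))) ⟩
      ω^ (a + g k) ·ℕ n + ω^ (a + g k)      ≈⟨ ·ℕ-suc (ω^ (a + g k)) n ⟩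
      ω^ (a + g k) ·ℕ suc n                 <⟨ ω^-multiple-≺ (suc n) (+-monoʳ-≺ a (≺lsub g k ≼-refl)) ⟩
      ω^ (a + b)                            ∎

-- Natural sums and products through Cantor normal forms

module NaturalSums (em : ∀ {a} → ExcludedMiddle a) where

  private
    variable
      A B C : Set p

  dec : (P : Set p) → Dec P
  dec P = em

  ⋠⇒≻ : {a b : Ord ℓ} → ¬ a ≼ b → b ≺ a
  ⋠⇒≻ {a = lsub {I} f} {b} a⋠b with dec (Σ[ i ∈ I ] b ≼ f i)
  ... | yes (i , p) = ≺lsub f i p
  ... | no  ¬p      = ⊥-elim (a⋠b (lsub≼ λ i → ⋠⇒≻ λ q → ¬p (i , q)))

  ⊀⇒≽ : {a b : Ord ℓ} → ¬ a ≺ b → b ≼ a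
  ⊀⇒≽ {a = a} {b} a⊀b with dec (b ≼ a)
  ... | yes p = p
  ... | no  p = ⊥-elim (a⊀b (⋠⇒≻ p))

  compare : (a b : Ord ℓ) → a ≼ b ⊎ b ≺ a
  compare a b with dec (a ≼ b)
  ... | yes p = inj₁ p
  ... | no  p = inj₂ (⋠⇒≻ p)

  upperBound : (P : Ord ℓ → Set p) {a b : Ord ℓ} → P a → P b →
               Σ[ c ∈ Ord ℓ ] (a ≼ c × b ≼ c × P c)
  upperBound P {a} {b} pa pb with compare a b
  ... | inj₁ a≼b = b , a≼b , ≼-refl , pb
  ... | inj₂ b≺a = a , ≼-refl , ≺⇒≼ b≺a , pa

  +-cancelˡ-≼ : {a b c : Ord ℓ} → a + b ≼ a + c → b ≼ c
  +-cancelˡ-≼ {a = a} p = ⊀⇒≽ λ q → ≼⇒⊁ p (+-monoʳ-≺ a q)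

  +-cancelˡ-≺ : {a b c : Ord ℓ} → a + b ≺ a + c → b ≺ c
  +-cancelˡ-≺ {a = a} p = ⋠⇒≻ λ q → ≼⇒⊁ (+-monoʳ-≼ a q) p

  ♯-cancelˡ-≺ : {a b c : Ord ℓ} → a ♯ b ≺ a ♯ c → b ≺ c
  ♯-cancelˡ-≺ {a = a} p = ⋠⇒≻ λ q → ≼⇒⊁ (♯-monoʳ-≼ a q) p

  -- Takes the least `r` with `c ≼ a + r`: for smaller `s` the sum `a + s` stays below `c`, which is
  -- the other inequality.
  difference : {a c : Ord ℓ} → a ≼ c → Σ[ r ∈ Ord ℓ ] c ≋ a + r
  difference {ℓ} {a} {c} a≼c = least c (x≼y+x a c) (≺-wellFounded c)
    where
    least : ∀ r → c ≼ a + r → Acc _≺_ r → Σ[ r ∈ Ord ℓ ] c ≋ a + r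
    least r c≼ (acc rs) with dec (Σ[ s ∈ Ord ℓ ] (s ≺ r × c ≼ a + s))
    ... | yes (s , s≺r , q) = least s q (rs s≺r)
    ... | no  ¬smaller      = r , c≼ , +-least a≼c λ s s≺r → ⋠⇒≻ λ q → ¬smaller (s , s≺r , q)

  -- Additive indecomposability of the powers of ω

  ♯-Closed : Ord ℓ → Set _
  ♯-Closed {ℓ} a = ∀ {b c : Ord ℓ} → b ≺ a → c ≺ a → b ♯ c ≺ a

  ♯-swap : (a b c : Ord ℓ) → a ♯ (b ♯ c) ≋ b ♯ (a ♯ c)
  ♯-swap a b c = ≋-trans (≋-sym (♯-assoc a b c)) (≋-trans (♯-cong (♯-comm a b) ≋-refl) (♯-assoc b a c))

  private
    -- Induction on `n` and `b`. If `b ≋ ω^ e + d`, then `c ♯ b` is at most `ω^ e ♯ (c ♯ d)`, and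
    -- `c ♯ d ≺ b` follows from the case of `d`, where `n` is smaller. Closure is an assumption
    -- because `ω^-♯-closed` is derived from this lemma at smaller exponents.
    ω^♯≼ : {e : Ord ℓ} → ♯-Closed (ω^ e) → (n : ℕ) (b : Ord ℓ) → Acc _≺_ b →
           b ≼ ω^ e ·ℕ n → ω^ e ♯ b ≼ ω^ e + b
    ω^♯≼ {ℓ} {e} closed n b (acc rs) b≼ = ♯-least left λ d d≺b → right (rs d≺b) d≺b
      where
      open ≼-Reasoning
      right : ∀ {d} → Acc _≺_ d → d ≺ b → ω^ e ♯ d ≺ ω^ e + b
      right {d} ac d≺b = ≼-≺-trans (ω^♯≼ closed n d ac (≼-trans (≺⇒≼ d≺b) b≼)) (+-monoʳ-≺ (ω^ e) d≺b)
      tail : ∀ n → b ≼ ω^ e ·ℕ n → ω^ e ≼ b →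
             Σ[ d ∈ Ord ℓ ] (b ≋ ω^ e + d × ω^ e ♯ d ≼ ω^ e + d)
      tail zero    b≼ e≼ = ⊥-elim (⊀𝟎 (≺-≼-trans (𝟎≺ω^ {a = e}) (≼-trans e≼ b≼)))
      tail (suc m) b≼ e≼ with difference e≼
      ... | d , b≋ = d , b≋ , ω^♯≼ closed m d (≺-wellFounded d) (+-cancelˡ-≼ (≼-trans (proj₂ b≋) b≼))
      left : ∀ c → c ≺ ω^ e → c ♯ b ≺ ω^ e + b
      left c c≺ with compare (ω^ e) b
      ... | inj₂ b≺ = ≺-≼-trans (closed c≺ b≺) (x≼x+y (ω^ e) b)
      ... | inj₁ e≼ with tail n b≼ e≼
      ...   | d , b≋ , K = begin-strict
        c ♯ b              ≤⟨ ♯-monoʳ-≼ c (≼-trans (proj₁ b≋) (+≼♯ (ω^ e) d)) ⟩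
        c ♯ (ω^ e ♯ d)     ≈⟨ ♯-swap c (ω^ e) d ⟩
        ω^ e ♯ (c ♯ d)     <⟨ right (rs c♯d≺b) c♯d≺b ⟩
        ω^ e + b           ∎
        where
        c♯d≺b : c ♯ d ≺ b
        c♯d≺b = ≺-≼-trans (♯-monoˡ-≺ d c≺) (≼-trans K (proj₂ b≋))

    ω^♯-multiples : {e : Ord ℓ} → ♯-Closed (ω^ e) → (m n : ℕ) →
                    ω^ e ·ℕ m ♯ ω^ e ·ℕ n ≼ ω^ e ·ℕ (m ℕ.+ n)
    ω^♯-multiples         closed zero    n = proj₁ (♯-identityˡ _)
    ω^♯-multiples {e = e} closed (suc m) n = begin
      (ω^ e + ω^ e ·ℕ m) ♯ ω^ e ·ℕ n    ≤⟨ ♯-monoˡ-≼ _ (+≼♯ (ω^ e) (ω^ e ·ℕ m)) ⟩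
      (ω^ e ♯ ω^ e ·ℕ m) ♯ ω^ e ·ℕ n    ≈⟨ ♯-assoc (ω^ e) (ω^ e ·ℕ m) (ω^ e ·ℕ n) ⟩
      ω^ e ♯ (ω^ e ·ℕ m ♯ ω^ e ·ℕ n)    ≤⟨ ♯-monoʳ-≼ (ω^ e) (ω^♯-multiples closed m n) ⟩
      ω^ e ♯ ω^ e ·ℕ (m ℕ.+ n)          ≤⟨ ω^♯≼ closed (m ℕ.+ n) _ (≺-wellFounded _) ≼-refl ⟩
      ω^ e + ω^ e ·ℕ (m ℕ.+ n)          ∎
      where open ≼-Reasoning

  -- Two non-zero ordinals below `ω^ e` lie below finite multiples of one `ω^ d` with `d ≺ e`; by
  -- induction the natural sum of these is again a finite multiple.
  ω^-♯-closed : (e : Ord ℓ) → ♯-Closed (ω^ e)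
  ω^-♯-closed e = closed e (≺-wellFounded e)
    where
    closed : ∀ e → Acc _≺_ e → ♯-Closed (ω^ e)
    closed e (acc rs) {b} {c} b≺ c≺ with ≺ω^⁻ b≺ | ≺ω^⁻ c≺
    ... | inj₁ b≼𝟎 | _ = ≼-≺-trans (≼-trans (♯-monoˡ-≼ c b≼𝟎) (proj₁ (♯-identityˡ c))) c≺
    ... | inj₂ _ | inj₁ c≼𝟎 = ≼-≺-trans (≼-trans (♯-monoʳ-≼ b c≼𝟎) (proj₁ (♯-identityʳ b))) b≺
    ... | inj₂ (d , d≺e , m , b≼) | inj₂ (d′ , d′≺e , n , c≼) with compare d d′
    ...   | inj₁ d≼d′ = ≼-≺-trans
      (≼-trans (♯-mono-≼ (≼-trans b≼ (·ℕ-mono-≼ m (ω^-mono-≼ d≼d′))) c≼)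
               (ω^♯-multiples (closed d′ (rs d′≺e)) m n))
      (ω^-multiple-≺ (m ℕ.+ n) d′≺e)
    ...   | inj₂ d′≺d = ≼-≺-trans
      (≼-trans (♯-mono-≼ b≼ (≼-trans c≼ (·ℕ-mono-≼ n (ω^-mono-≼ (≺⇒≼ d′≺d)))))
               (ω^♯-multiples (closed d (rs d≺e)) m n))
      (ω^-multiple-≺ (m ℕ.+ n) d≺e)

  ω^♯≋ω^+ : {e b : Ord ℓ} (n : ℕ) → b ≼ ω^ e ·ℕ n → ω^ e ♯ b ≋ ω^ e + b
  ω^♯≋ω^+ {e = e} {b} n p = ω^♯≼ (ω^-♯-closed e) n b (≺-wellFounded b) p , +≼♯ (ω^ e) b

  -- Finite sums

  ∑ ⨁ : (A → Ord ℓ) → List A → Ord ℓ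
  ∑ f []       = 𝟎
  ∑ f (x ∷ xs) = f x + ∑ f xs
  ⨁ f []       = 𝟎
  ⨁ f (x ∷ xs) = f x ♯ ⨁ f xs

  ∑ω^≋∑ : (es : List (Ord ℓ)) → ∑ω^ es ≋ ∑ ω^_ es
  ∑ω^≋∑ []       = ≋-refl
  ∑ω^≋∑ (e ∷ es) = +-cong ≋-refl (∑ω^≋∑ es)

  ⨁-cong : {f g : A → Ord ℓ} → (∀ x → f x ≋ g x) → ∀ xs → ⨁ f xs ≋ ⨁ g xs
  ⨁-cong p []       = ≋-refl
  ⨁-cong p (x ∷ xs) = ♯-cong (p x) (⨁-cong p xs)

  ∑-cong : {f g : A → Ord ℓ} → (∀ x → f x ≋ g x) → ∀ xs → ∑ f xs ≋ ∑ g xs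
  ∑-cong p []       = ≋-refl
  ∑-cong p (x ∷ xs) = +-cong (p x) (∑-cong p xs)

  ·-distribˡ-∑ : (a : Ord ℓ) (f : A → Ord ℓ) (xs : List A) → a · ∑ f xs ≋ ∑ (λ x → a · f x) xs
  ·-distribˡ-∑ a f []       = ·-zeroʳ a
  ·-distribˡ-∑ a f (x ∷ xs) = ≋-trans (·-distribˡ-+ a (f x) (∑ f xs)) (+-cong ≋-refl (·-distribˡ-∑ a f xs))

  ⨁-++ : (f : A → Ord ℓ) (xs ys : List A) → ⨁ f (xs ++ ys) ≋ ⨁ f xs ♯ ⨁ f ys
  ⨁-++ f []       ys = ≋-sym (♯-identityˡ (⨁ f ys))
  ⨁-++ f (x ∷ xs) ys = ≋-trans (♯-cong ≋-refl (⨁-++ f xs ys)) (≋-sym (♯-assoc (f x) (⨁ f xs) (⨁ f ys)))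

  ⨁-map : (f : B → Ord ℓ) (g : A → B) (xs : List A) → ⨁ f (map g xs) ≋ ⨁ (f ∘ g) xs
  ⨁-map f g []       = ≋-refl
  ⨁-map f g (x ∷ xs) = ♯-cong ≋-refl (⨁-map f g xs)

  ⨁-↭ : (f : A → Ord ℓ) {xs ys : List A} → xs ↭ ys → ⨁ f xs ≋ ⨁ f ys
  ⨁-↭ f ↭.refl         = ≋-refl
  ⨁-↭ f (↭.prep x p)   = ♯-cong ≋-refl (⨁-↭ f p)
  ⨁-↭ f (↭.swap x y p) = ≋-trans (♯-swap (f x) (f y) _) (♯-cong ≋-refl (♯-cong ≋-refl (⨁-↭ f p)))
  ⨁-↭ f (↭.trans p q)  = ≋-trans (⨁-↭ f p) (⨁-↭ f q)

  ⨁-cartesianProductWith : (f : C → Ord ℓ) (g : A → B → C) (xs : List A) (ys : List B) →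
    ⨁ f (cartesianProductWith g xs ys) ≋ ⨁ (λ x → ⨁ (λ y → f (g x y)) ys) xs
  ⨁-cartesianProductWith f g []       ys = ≋-refl
  ⨁-cartesianProductWith f g (x ∷ xs) ys =
    ≋-trans (⨁-++ f (map (g x) ys) (cartesianProductWith g xs ys))
            (♯-cong (⨁-map f (g x) ys) (⨁-cartesianProductWith f g xs ys))

  foldr-♯≋⨁ : (xs : List (Ord ℓ)) → foldr _♯_ 𝟎 xs ≋ ⨁ id xs
  foldr-♯≋⨁ []       = ≋-refl
  foldr-♯≋⨁ (x ∷ xs) = ♯-cong ≋-refl (foldr-♯≋⨁ xs)

  Descending : (A → Ord ℓ) → List A → Set _
  Descending f = AllPairs (λ x y → f y ≼ f x)

  ∑ω^-bound : (f : A → Ord ℓ) {e : Ord ℓ} {xs : List A} → All (λ x → f x ≼ e) xs →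
              ∑ (ω^_ ∘ f) xs ≼ ω^ e ·ℕ length xs
  ∑ω^-bound f []       = ≼-refl
  ∑ω^-bound f (p ∷ ps) = +-mono-≼ (ω^-mono-≼ p) (∑ω^-bound f ps)

  ⨁≋∑ : (f : A → Ord ℓ) {xs : List A} → Descending f xs → ⨁ (ω^_ ∘ f) xs ≋ ∑ (ω^_ ∘ f) xs
  ⨁≋∑ f []       = ≋-refl
  ⨁≋∑ f {_ ∷ xs} (p ∷ ps) = ≋-trans (♯-cong ≋-refl (⨁≋∑ f ps)) (ω^♯≋ω^+ (length xs) (∑ω^-bound f p))

  record StrictlyMonotone (h : Ord ℓ → Ord ℓ) : Set (Level.suc ℓ) where
    field
      mono-≼ : ∀ {a b} → a ≼ b → h a ≼ h b
      mono-≺ : ∀ {a b} → a ≺ b → h a ≺ h b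

  -- Descending sums of powers of `ω` are compared lexicographically by their exponents, and `h`
  -- respects every comparison of exponents.
  ∑ω^-transfer : {h : Ord ℓ → Ord ℓ} → StrictlyMonotone h → (f : A → Ord ℓ) (g : B → Ord ℓ)
    {xs : List A} {ys : List B} → Descending f xs → Descending g ys →
    ∑ (ω^_ ∘ f) xs ≼ ∑ (ω^_ ∘ g) ys → ∑ (ω^_ ∘ h ∘ f) xs ≼ ∑ (ω^_ ∘ h ∘ g) ys
  ∑ω^-transfer m f g [] _ _ = 𝟎≼
  ∑ω^-transfer m f g {x ∷ xs} (_ ∷ _) [] q =
    ⊥-elim (⊀𝟎 (≺-≼-trans (≺-≼-trans (𝟎≺ω^ {a = f x}) (x≼x+y _ _)) q))
  ∑ω^-transfer {h = h} m f g {x ∷ xs} {y ∷ ys} (p ∷ ps) (q ∷ qs) r with compare (f x) (g y)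
  ... | inj₂ gy≺fx = ⊥-elim (≼⇒⊁ (≼-trans (x≼x+y (ω^ f x) _) r)
          (≼-≺-trans (∑ω^-bound g (≼-refl ∷ q)) (ω^-multiple-≺ (length (y ∷ ys)) gy≺fx)))
  ... | inj₁ fx≼gy with compare (g y) (f x)
  ...   | inj₁ gy≼fx = +-mono-≼ (ω^-mono-≼ (mono-≼ fx≼gy))
          (∑ω^-transfer m f g ps qs (+-cancelˡ-≼ (≼-trans r (+-monoˡ-≼ _ (ω^-mono-≼ gy≼fx)))))
          where open StrictlyMonotone m
  ...   | inj₂ fx≺gy = ≼-trans
          (≺⇒≼ (≼-≺-trans (∑ω^-bound (h ∘ f) (≼-refl ∷ All.map mono-≼ p))
                          (ω^-multiple-≺ (length (x ∷ xs)) (mono-≺ fx≺gy))))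
          (x≼x+y _ _)
          where open StrictlyMonotone m

  -- Sorting by descending keys a list whose elements are related by _⊲_ in the
  -- given order, and in both orders where sorting may exchange them.
  module _ (key : A → Ord ℓ) (_⊲_ : A → A → Set p) where

    Sortable Sorted : A → A → Set _
    Sortable x y = x ⊲ y × (key x ≺ key y → y ⊲ x)
    Sorted   x y = key y ≼ key x × x ⊲ y

    private
      insert : ∀ x {xs} → All (Sortable x) xs → AllPairs Sorted xs →
               Σ[ ys ∈ List A ] (x ∷ xs ↭ ys × AllPairs Sorted ys)
      insert x {[]} [] [] = x ∷ [] , ↭.refl , [] ∷ []
      insert x {y ∷ ys} (s ∷ ss) (p ∷ ps) with compare (key y) (key x)
      ... | inj₁ y≼x = x ∷ y ∷ ys , ↭.refl ,
        ((y≼x , proj₁ s) ∷ All.zipWith (λ ((z≼y , _) , x⊲z , _) → ≼-trans z≼y y≼x , x⊲z) (p , ss))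
        ∷ p ∷ ps
      ... | inj₂ x≺y with insert x ss ps
      ...   | zs , x∷ys↭zs , sorted = y ∷ zs , ↭.trans (↭.swap x y ↭.refl) (↭.prep y x∷ys↭zs) ,
        All-resp-↭ x∷ys↭zs ((≺⇒≼ x≺y , proj₂ s x≺y) ∷ p) ∷ sorted

    sort : ∀ {xs} → AllPairs Sortable xs → Σ[ ys ∈ List A ] (xs ↭ ys × AllPairs Sorted ys)
    sort {[]}     []       = [] , ↭.refl , []
    sort {x ∷ xs} (p ∷ ps) with sort ps
    ... | ys , xs↭ys , sorted with insert x (All-resp-↭ xs↭ys p) sorted
    ...   | zs , x∷ys↭zs , sorted′ = zs , ↭.trans (↭.prep x xs↭ys) x∷ys↭zs , sorted′

  descend : (f : A → Ord ℓ) (xs : List A) → Σ[ ys ∈ List A ] (xs ↭ ys × Descending f ys)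
  descend f xs with sort f (λ _ _ → ⊤ {Level.zero}) (sortable xs)
    where
    sortable : ∀ xs → AllPairs (Sortable f (λ _ _ → ⊤)) xs
    sortable []       = []
    sortable (x ∷ xs) = All.universal (λ _ → tt , λ _ → tt) xs ∷ sortable xs
  ... | ys , p , s = ys , p , AllPairs.map proj₁ s

  ⨁ω^-transfer : {h : Ord ℓ → Ord ℓ} → StrictlyMonotone h → (f : A → Ord ℓ) (g : B → Ord ℓ)
    (xs : List A) (ys : List B) →
    ⨁ (ω^_ ∘ f) xs ≼ ⨁ (ω^_ ∘ g) ys → ⨁ (ω^_ ∘ h ∘ f) xs ≼ ⨁ (ω^_ ∘ h ∘ g) ys
  ⨁ω^-transfer {h = h} m f g xs ys p with descend f xs | descend g ys
  ... | xs′ , xs↭ , dx | ys′ , ys↭ , dy = begin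
    ⨁ (ω^_ ∘ h ∘ f) xs     ≈⟨ ⨁-↭ _ xs↭ ⟩
    ⨁ (ω^_ ∘ h ∘ f) xs′    ≈⟨ ⨁≋∑ (h ∘ f) (AllPairs.map mono-≼ dx) ⟩
    ∑ (ω^_ ∘ h ∘ f) xs′    ≤⟨ ∑ω^-transfer m f g dx dy sorted ⟩
    ∑ (ω^_ ∘ h ∘ g) ys′    ≈⟨ ≋-sym (⨁≋∑ (h ∘ g) (AllPairs.map mono-≼ dy)) ⟩
    ⨁ (ω^_ ∘ h ∘ g) ys′    ≈⟨ ≋-sym (⨁-↭ _ ys↭) ⟩
    ⨁ (ω^_ ∘ h ∘ g) ys     ∎
    where
    open ≼-Reasoning
    open StrictlyMonotone m
    sorted : ∑ (ω^_ ∘ f) xs′ ≼ ∑ (ω^_ ∘ g) ys′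
    sorted = begin
      ∑ (ω^_ ∘ f) xs′    ≈⟨ ≋-sym (⨁≋∑ f dx) ⟩
      ⨁ (ω^_ ∘ f) xs′    ≈⟨ ≋-sym (⨁-↭ _ xs↭) ⟩
      ⨁ (ω^_ ∘ f) xs     ≤⟨ p ⟩
      ⨁ (ω^_ ∘ g) ys     ≈⟨ ⨁-↭ _ ys↭ ⟩
      ⨁ (ω^_ ∘ g) ys′    ≈⟨ ⨁≋∑ g dy ⟩
      ∑ (ω^_ ∘ g) ys′    ∎

  -- Natural products

  abstract
    cnf : Ord ℓ → List (Ord ℓ)
    cnf a = CantorNormalForm.exponents (cantorNormalForm em a)

    cnf-descending : (a : Ord ℓ) → Descending id (cnf a)
    cnf-descending a = AllPairs.map wrap (Linked⇒AllPairs (λ {x} {y} {z} p q → ≤-trans z y x q p)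
      (CantorNormalForm.descending (cantorNormalForm em a)))

    cnf-denotes : (a : Ord ℓ) → ∑ ω^_ (cnf a) ≋ a
    cnf-denotes a = ≋-trans (≋-sym (∑ω^≋∑ (cnf a))) (≈⇒≋ (CantorNormalForm.denotes (cantorNormalForm em a)))

    hessenberg≋⨁ : (a b : Ord ℓ) → hessenberg em a b ≋ ⨁ (λ d → ⨁ (λ e → ω^ (d ♯ e)) (cnf b)) (cnf a)
    hessenberg≋⨁ a b = ≋-trans (foldr-♯≋⨁ (cartesianProductWith (λ d e → ω^ (d ♯ e)) (cnf a) (cnf b)))
                               (⨁-cartesianProductWith id (λ d e → ω^ (d ♯ e)) (cnf a) (cnf b))

  normalForm : (a : Ord ℓ) → Σ[ es ∈ List (Ord ℓ) ] (Descending id es × ∑ ω^_ es ≋ a)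
  normalForm a = cnf a , cnf-descending a , cnf-denotes a

  ♯-strictlyMonotone : (a : Ord ℓ) → StrictlyMonotone (a ♯_)
  ♯-strictlyMonotone a = record { mono-≼ = ♯-monoʳ-≼ a ; mono-≺ = ♯-monoʳ-≺ a }

  ♯[_] : {n : ℕ} → (Fin n → Ord ℓ) → Ord ℓ
  ♯[_] = Vector.foldr _♯_ 𝟎

  choices : {n : ℕ} → (Fin n → List A) → List (Fin n → A)
  choices {n = zero}  xs = (λ ()) ∷ []
  choices {n = suc n} xs = cartesianProductWith Vector._∷_ (xs zero) (choices (xs ∘ suc))

  ω^𝟎≋𝟏 : ω^ 𝟎 ≋ 𝟏 {ℓ}
  ω^𝟎≋𝟏 = ω^-least (≺osuc ≼-refl) (λ d p → ⊥-elim (⊀𝟎 p)) , osuc≼ (𝟎≺ω^ {a = 𝟎})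

  -- The exponents in the normal form of a partial product need not be the listed sums of exponents,
  -- but both lists have the same natural sum, and `⨁ω^-transfer` along `d ♯_` exchanges them. The
  -- type `A` lets the entries carry more than an exponent, such as the place of an interval.
  ⨂≋⨁-choices : {n : ℕ} (q : Fin n → Ord ℓ) (f : A → Ord ℓ) (xs : Fin n → List A) →
    (∀ i → map f (xs i) ≡ cnf (q i)) → ⨂ em q ≋ ⨁ (λ v → ω^ ♯[ f ∘ v ]) (choices xs)
  ⨂≋⨁-choices {n = zero}  q f xs eq = ≋-sym (≋-trans (♯-identityʳ _) ω^𝟎≋𝟏)
  ⨂≋⨁-choices {n = suc n} q f xs eq = begin-equality
    hessenberg em (q zero) (⨂ em (q ∘ suc))
      ≈⟨ hessenberg≋⨁ (q zero) (⨂ em (q ∘ suc)) ⟩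
    ⨁ (λ d → ⨁ (λ e → ω^ (d ♯ e)) b) (cnf (q zero))
      ≈⟨ ⨁-cong (λ d → transfer d) (cnf (q zero)) ⟩
    ⨁ (λ d → ⨁ (λ v → ω^ (d ♯ ♯[ f ∘ v ])) vs) (cnf (q zero))
      ≡⟨ subst (λ es → ⨁ F (cnf (q zero)) ≡ ⨁ F es) (sym (eq zero)) refl ⟩
    ⨁ (λ d → ⨁ (λ v → ω^ (d ♯ ♯[ f ∘ v ])) vs) (map f (xs zero))
      ≈⟨ ⨁-map _ f (xs zero) ⟩
    ⨁ (λ x → ⨁ (λ v → ω^ (f x ♯ ♯[ f ∘ v ])) vs) (xs zero)
      ≈⟨ ≋-sym (⨁-cartesianProductWith (λ v → ω^ ♯[ f ∘ v ]) Vector._∷_ (xs zero) vs) ⟩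
    ⨁ (λ v → ω^ ♯[ f ∘ v ]) (choices xs)
      ∎
    where
    open ≼-Reasoning
    b  = cnf (⨂ em (q ∘ suc))
    vs = choices (xs ∘ suc)
    F = λ d → ⨁ (λ v → ω^ (d ♯ ♯[ f ∘ v ])) vs
    same : ⨁ (ω^_ ∘ id) b ≋ ⨁ (λ v → ω^ ♯[ f ∘ v ]) vs
    same = ≋-trans (⨁≋∑ id (cnf-descending _))
          (≋-trans (cnf-denotes _) (⨂≋⨁-choices (q ∘ suc) f (xs ∘ suc) (eq ∘ suc)))
    transfer : ∀ d → ⨁ (λ e → ω^ (d ♯ e)) b ≋ ⨁ (λ v → ω^ (d ♯ ♯[ f ∘ v ])) vs
    transfer d = ⨁ω^-transfer (♯-strictlyMonotone d) id (♯[_] ∘ (f ∘_)) b vs (proj₁ same)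
               , ⨁ω^-transfer (♯-strictlyMonotone d) (♯[_] ∘ (f ∘_)) id vs b (proj₂ same)

-- Bad sequences and the heights of subsets

module Heights (em : ∀ {a} → ExcludedMiddle a) where

  open NaturalSums em

  private
    variable
      X : Set ℓ
      S T : Rel X ℓ
      M N D U Y Z : Pred X ℓ

  Full : Pred X ℓ
  Full _ = ⊤

  -- Residuals and heights

  residual : Rel X ℓ → Pred X ℓ → X → Pred X ℓ
  residual S Y x y = Y y × ¬ S x y

  -- Y has no infinite bad sequence, that is, no infinite sequence none of
  -- whose terms is above an earlier one.
  data Bar {X : Set ℓ} (S : Rel X ℓ) (Y : Pred X ℓ) : Set ℓ where
    bar : (∀ x → Y x → Bar S (residual S Y x)) → Bar S Y

  -- The length of Y, by de Jongh and Parikh (maximalLinearExtension below).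
  rankOfBar : {X : Set ℓ} {S : Rel X ℓ} {Y : Pred X ℓ} → Bar S Y → Ord ℓ
  rankOfBar {Y = Y} (bar h) = lsub {I = ∃ Y} λ (x , x∈Y) → rankOfBar (h x x∈Y)

  Bar-mono : Z ⊆ Y → (∀ {x y} → Z x → Z y → S x y → T x y) → Bar S Y → Bar T Z
  Bar-mono Z⊆Y S⇒T (bar h) = bar λ x x∈Z →
    Bar-mono (λ (y∈Z , ¬Txy) → Z⊆Y y∈Z , λ Sxy → ¬Txy (S⇒T x∈Z y∈Z Sxy))
             (λ (y∈Z , _) (z∈Z , _) → S⇒T y∈Z z∈Z) (h x (Z⊆Y x∈Z))

  rankOfBar-mono : Z ⊆ Y → (∀ {x y} → Z x → Z y → S x y → T x y) →
                   (b : Bar S Y) (c : Bar T Z) → rankOfBar c ≼ rankOfBar b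
  rankOfBar-mono Z⊆Y S⇒T (bar h) (bar k) = lsub≼ λ (x , x∈Z) →
    ≺lsub _ (x , Z⊆Y x∈Z)
      (rankOfBar-mono (λ (y∈Z , ¬Txy) → Z⊆Y y∈Z , λ Sxy → ¬Txy (S⇒T x∈Z y∈Z Sxy))
                      (λ (y∈Z , _) (z∈Z , _) → S⇒T y∈Z z∈Z) (h x (Z⊆Y x∈Z)) (k x x∈Z))

  -- A bar for every subset at once makes `height` a function of the subset alone.
  Wqo : {X : Set ℓ} → Rel X ℓ → Set (lsuc ℓ)
  Wqo S = ∀ Y → Bar S Y

  height : {X : Set ℓ} {S : Rel X ℓ} → Wqo S → Pred X ℓ → Ord ℓ
  height w Y = rankOfBar (w Y)

  -- The relations are compared on `Z` only, so that an order defined piecewise can be compared on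
  -- each piece with the order it came from.
  height-mono : (v : Wqo S) (w : Wqo T) → Z ⊆ Y → (∀ {x y} → Z x → Z y → S x y → T x y) →
                height w Z ≼ height v Y
  height-mono v w Z⊆Y S⇒T = rankOfBar-mono Z⊆Y S⇒T (v _) (w _)

  module _ {X : Set ℓ} {S : Rel X ℓ} (w : Wqo S) where

    height-⊆ : Z ⊆ Y → height w Z ≼ height w Y
    height-⊆ Z⊆Y = height-mono w w Z⊆Y (λ _ _ → id)

    height-residual : ∀ {x} → Y x → height w (residual S Y x) ≺ height w Y
    height-residual {Y = Y} {x} x∈Y with w Y
    ... | bar h = ≺lsub _ (x , x∈Y) (rankOfBar-mono id (λ _ _ → id) (h x x∈Y) (w _))

    height-least : ∀ {c} → (∀ x → Y x → height w (residual S Y x) ≺ c) → height w Y ≼ c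
    height-least {Y = Y} p with w Y
    ... | bar h = lsub≼ λ (x , x∈Y) →
      ≼-≺-trans (rankOfBar-mono id (λ _ _ → id) (w _) (h x x∈Y)) (p x x∈Y)

    ≺height⁻ : ∀ {c} → c ≺ height w Y → Σ[ x ∈ X ] (Y x × c ≼ height w (residual S Y x))
    ≺height⁻ {Y = Y} p with w Y
    ... | bar h with ≺lsub⁻ p
    ...   | (x , x∈Y) , q = x , x∈Y , ≼-trans q (rankOfBar-mono id (λ _ _ → id) (w _) (h x x∈Y))

    -- Passing to the residual at an `x` in `M` shrinks `M` to its own residual and leaves `N`, so
    -- exactly one summand of the bound drops.
    height-∪ : Y ⊆ M ∪ N → height w Y ≼ height w M ♯ height w N
    height-∪ {Y = Y} = go (w Y)
      where
      go : ∀ {Y M N} → Bar S Y → Y ⊆ M ∪ N → height w Y ≼ height w M ♯ height w N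
      go {Y = Y} {M} {N} (bar h) Y⊆ = height-least λ x x∈Y → case x x∈Y (Y⊆ x∈Y)
        where
        case : ∀ x → Y x → M x ⊎ N x → height w (residual S Y x) ≺ height w M ♯ height w N
        case x x∈Y (inj₁ x∈M) = ≼-≺-trans
          (go (h x x∈Y) λ (y∈Y , ¬Sxy) → Sum.map₁ (_, ¬Sxy) (Y⊆ y∈Y)) (♯-monoˡ-≺ _ (height-residual x∈M))
        case x x∈Y (inj₂ x∈N) = ≼-≺-trans
          (go (h x x∈Y) λ (y∈Y , ¬Sxy) → Sum.map₂ (_, ¬Sxy) (Y⊆ y∈Y)) (♯-monoʳ-≺ _ (height-residual x∈N))

    -- Choosing elements of `U` discards nothing of `D`, so every bad sequence in `U` can be
    -- continued by any bad sequence in `D`.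
    height-+ : D ⊆ Y → U ⊆ Y → (∀ {d u} → D d → U u → ¬ S u d) → height w D + height w U ≼ height w Y
    height-+ {D = D} {U = U} = go (w U)
      where
      go : ∀ {U Y} → Bar S U → D ⊆ Y → U ⊆ Y → (∀ {d u} → D d → U u → ¬ S u d) →
           height w D + height w U ≼ height w Y
      go (bar h) D⊆Y U⊆Y D≱U = +-least (height-⊆ D⊆Y) λ c c≺ →
        let x , x∈U , c≼ = ≺height⁻ c≺ in
        ≼-≺-trans
          (≼-trans (+-monoʳ-≼ _ c≼)
            (go (h x x∈U) (λ d∈D → D⊆Y d∈D , D≱U d∈D x∈U) (λ (u∈U , ¬Sxu) → U⊆Y u∈U , ¬Sxu)
                (λ d∈D (u∈U , _) → D≱U d∈D u∈U)))
          (height-residual (U⊆Y x∈U))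

    height-inhabited : ∀ {x} → Y x → 𝟎 ≺ height w Y
    height-inhabited x∈Y = ≼-≺-trans 𝟎≼ (height-residual x∈Y)

    module _ (S-trans : Transitive S) where

      height-antitone : ∀ {x y} → S x y → height w (residual S Y x) ≼ height w (residual S Y y)
      height-antitone Sxy = height-⊆ λ (z∈Y , ¬Sxz) → z∈Y , λ Syz → ¬Sxz (S-trans Sxy Syz)

      -- As long as the height exceeds `b`, some residual still has height at least `b`. Residuals
      -- are downward closed, and the descent ends since `Y` is barred.
      initialSegment : ∀ {b} → b ≼ height w Y →
        Σ[ D ∈ Pred X ℓ ] (D ⊆ Y × height w D ≋ b × (∀ {y d} → Y y → ¬ D y → D d → ¬ S y d))
      initialSegment {Y = Y} = go (w Y)
        where
        go : ∀ {Y b} → Bar S Y → b ≼ height w Y →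
             Σ[ D ∈ Pred X ℓ ] (D ⊆ Y × height w D ≋ b × (∀ {y d} → Y y → ¬ D y → D d → ¬ S y d))
        go {Y} {b} (bar h) p with compare (height w Y) b
        ... | inj₁ q = Y , id , (q , p) , λ y∈Y y∉Y _ _ → y∉Y y∈Y
        ... | inj₂ q with ≺height⁻ q
        ...   | x , x∈Y , r with go (h x x∈Y) r
        ...     | D , D⊆ , D≋b , D≱ = D , proj₁ ∘ D⊆ , D≋b , λ {y} {d} y∈Y y∉D d∈D Syd →
          case y y∈Y y∉D d d∈D Syd (dec (S x y))
          where
          case : ∀ y → Y y → ¬ D y → ∀ d → D d → S y d → ¬ Dec (S x y)
          case y y∈Y y∉D d d∈D Syd (yes Sxy) = proj₂ (D⊆ d∈D) (S-trans Sxy Syd)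
          case y y∈Y y∉D d d∈D Syd (no ¬Sxy) = D≱ (y∈Y , ¬Sxy) y∉D d∈D Syd

      -- `D` has height exactly `a`, so superadditivity bounds `a + height w U` by `a + b`, and `a`
      -- cancels on the left.
      split : ∀ {a b} → height w Y ≼ a + b →
              Σ[ D ∈ Pred X ℓ ] Σ[ U ∈ Pred X ℓ ]
                (Y ⊆ D ∪ U × D ⊆ Y × U ⊆ Y × height w D ≼ a × height w U ≼ b)
      split {Y = Y} {a} {b} p with compare (height w Y) a
      ... | inj₁ q = Y , (λ _ → Polymorphic.⊥) , inj₁ , id , (λ ()) , q , height-least λ _ ()
      ... | inj₂ q with initialSegment (≺⇒≼ q)
      ...   | D , D⊆Y , D≋a , D≱ = D , (λ y → Y y × ¬ D y) , cover , D⊆Y , proj₁ , proj₁ D≋a ,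
        +-cancelˡ-≼ (≼-trans (≼-trans (+-monoˡ-≼ _ (proj₂ D≋a))
          (height-+ D⊆Y proj₁ λ d∈D (u∈Y , u∉D) → D≱ u∈Y u∉D d∈D)) p)
        where
        cover : Y ⊆ D ∪ (λ y → Y y × ¬ D y)
        cover {y} y∈Y with dec (D y)
        ... | yes y∈D = inj₁ y∈D
        ... | no  y∉D = inj₂ (y∈Y , y∉D)

  -- Well partial orders

  ∪-Bar : Bar S M → Bar S N → Y ⊆ M ∪ N → Bar S Y
  ∪-Bar {S = S} {M} {N} {Y} (bar f) (bar g) Y⊆ = bar λ x x∈Y → case x (Y⊆ x∈Y)
    where
    case : ∀ x → M x ⊎ N x → Bar S (residual S Y x)
    case x (inj₁ x∈M) = ∪-Bar (f x x∈M) (bar g) λ (y∈Y , ¬Sxy) → Sum.map₁ (_, ¬Sxy) (Y⊆ y∈Y)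
    case x (inj₂ x∈N) = ∪-Bar (bar f) (g x x∈N) λ (y∈Y , ¬Sxy) → Sum.map₂ (_, ¬Sxy) (Y⊆ y∈Y)

  module _ {X : Set ℓ} {S : Rel X ℓ} where

    private
      -- Deciding a Σ-type yields a witness; excluded middle thus supplies the dependent choices
      -- that form the bad sequence.
      bad : ∀ {Y} → ¬ Bar S Y → Σ[ x ∈ X ] (Y x × ¬ Bar S (residual S Y x))
      bad {Y} ¬bar with dec (Σ[ x ∈ X ] (Y x × ¬ Bar S (residual S Y x)))
      ... | yes p = p
      ... | no ¬p = ⊥-elim (¬bar (bar λ x x∈Y → decidable x x∈Y (dec _)))
        where
        decidable : ∀ x → Y x → Dec (Bar S (residual S Y x)) → Bar S (residual S Y x)
        decidable x x∈Y (yes b) = b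
        decidable x x∈Y (no ¬b) = ⊥-elim (¬p (x , x∈Y , ¬b))

      stage : ∀ {Y} → ¬ Bar S Y → ℕ → Σ[ Z ∈ Pred X ℓ ] ¬ Bar S Z
      stage {Y} ¬b zero    = Y , ¬b
      stage     ¬b (suc n) = let Z , ¬bZ = stage ¬b n in _ , proj₂ (proj₂ (bad ¬bZ))

      badSequence : ∀ {Y} → ¬ Bar S Y → ℕ → X
      badSequence ¬b n = proj₁ (bad (proj₂ (stage ¬b n)))

      stage-later : ∀ {Y} (¬b : ¬ Bar S Y) {m n} → m ℕ.≤′ n →
                    proj₁ (stage ¬b n) ⊆ proj₁ (stage ¬b m)
      stage-later ¬b ℕ.≤′-refl       = id
      stage-later ¬b (ℕ.≤′-step m≤n) = stage-later ¬b m≤n ∘ proj₁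

      badSequence-bad : ∀ {Y} (¬b : ¬ Bar S Y) {m n} → m ℕ.< n →
                        ¬ S (badSequence ¬b m) (badSequence ¬b n)
      badSequence-bad ¬b {m} {n} m<n =
        proj₂ (stage-later ¬b (ℕ.≤⇒≤′ m<n) (proj₁ (proj₂ (bad (proj₂ (stage ¬b n))))))

    IsWPO⇒Wqo : IsWPO S → Wqo S
    IsWPO⇒Wqo wpo Y with dec (Bar S Y)
    ... | yes b = b
    ... | no ¬b = ⊥-elim (noAntichain (s ∘ t , antichain))
      where
      open IsWPO wpo
      open IsPartialOrder isPartialOrder using () renaming (refl to S-refl)
      s = badSequence ¬b
      -- In a bad sequence the terms with no later term below them form an antichain.
      Terminal : ℕ → Set _
      Terminal m = ∀ n → m ℕ.< n → ¬ S (s n) (s m)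
      -- Going to a later term below `s m` is a strict descent, as a repeated term would contradict
      -- badness; hence it ends.
      terminal : ∀ m → Acc (Strict S) (s m) → Σ[ n ∈ ℕ ] (m ℕ.≤ n × Terminal n)
      terminal m (acc rs) with dec (Σ[ n ∈ ℕ ] (m ℕ.< n × S (s n) (s m)))
      ... | no ¬p = m , ℕ.≤-refl , λ n m<n Snm → ¬p (n , m<n , Snm)
      ... | yes (n , m<n , Snm) =
        let k , n≤k , tk = terminal n (rs (Snm , λ eq → badSequence-bad ¬b m<n (subst (S (s m)) (sym eq) S-refl)))
        in k , ℕ.≤-trans (ℕ.<⇒≤ m<n) n≤k , tk
      from : ∀ m → Σ[ n ∈ ℕ ] (m ℕ.≤ n × Terminal n)
      from m = terminal m (wellFounded (s m))
      t : ℕ → ℕ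
      t zero    = proj₁ (from 0)
      t (suc n) = proj₁ (from (suc (t n)))
      t-terminal : ∀ n → Terminal (t n)
      t-terminal zero    = proj₂ (proj₂ (from 0))
      t-terminal (suc n) = proj₂ (proj₂ (from (suc (t n))))
      t-mono : ∀ {m n} → m ℕ.<′ n → t m ℕ.< t n
      t-mono {n = suc n} ℕ.≤′-refl       = proj₁ (proj₂ (from (suc (t n))))
      t-mono {n = suc n} (ℕ.≤′-step m<n) =
        ℕ.<-trans (t-mono m<n) (proj₁ (proj₂ (from (suc (t n)))))
      antichain : ∀ i j → i ≢ j → ¬ S (s (t i)) (s (t j))
      antichain i j i≢j with ℕ.<-cmp i j
      ... | tri< i<j _ _ = badSequence-bad ¬b (t-mono (ℕ.≤⇒≤′ i<j))
      ... | tri≈ _ i≡j _ = ⊥-elim (i≢j i≡j)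
      ... | tri> _ _ j<i = t-terminal j (t i) (t-mono (ℕ.≤⇒≤′ j<i))

    Wqo⇒IsWPO : IsPartialOrder _≡_ S → Wqo S → IsWPO S
    Wqo⇒IsWPO po w = record
      { isPartialOrder = po
      ; wellFounded    = λ x → strict (w Full) _
      ; noAntichain    = λ (s , p) → noBad (w Full) s (λ i<j → p _ _ (ℕ.<⇒≢ i<j)) _
      }
      where
      open IsPartialOrder po using (antisym) renaming (trans to S-trans)
      -- By antisymmetry an element strictly below `y` is not above `y`, so descending sequences are
      -- bad and the bar bounds them.
      strict : ∀ {Y x} → Bar S Y → (∀ {y} → Strict S y x → Y y) → Acc (Strict S) x
      strict (bar h) below = acc λ {y} (y≤x , y≢x) →
        strict (h y (below (y≤x , y≢x))) λ (z≤y , z≢y) →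
          below (S-trans z≤y y≤x , λ { refl → y≢x (antisym y≤x z≤y) }) ,
          λ y≤z → z≢y (antisym z≤y y≤z)
      noBad : ∀ {Y} → Bar S Y → (s : ℕ → X) → (∀ {i j} → i ℕ.< j → ¬ S (s i) (s j)) → ¬ (∀ i → Y (s i))
      noBad (bar h) s s-bad Y⊇s = noBad (h (s 0) (Y⊇s 0)) (s ∘ suc) (s-bad ∘ ℕ.s≤s)
                                    λ i → Y⊇s (suc i) , s-bad (ℕ.s≤s ℕ.z≤n)

-- Linear extensions of maximal type

module LinearExtensions (em : ∀ {a} → ExcludedMiddle a) where

  open NaturalSums em
  open Heights em

  private
    variable
      X : Set ℓ

  -- Orders given by labelling with ordinals

  Below : {X : Set ℓ} → (X → Ord ℓ) → Rel X ℓ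
  Below φ x y = φ x ≼ φ y

  InjectiveOn : {X : Set ℓ} → Pred X ℓ → (X → Ord ℓ) → Set ℓ
  InjectiveOn Y φ = ∀ {x y} → Y x → Y y → φ x ≋ φ y → x ≡ y

  sup : {X : Set ℓ} → (X → Ord ℓ) → Ord ℓ
  sup φ = lsub φ

  ≺sup : {X : Set ℓ} (φ : X → Ord ℓ) (x : X) → φ x ≺ sup φ
  ≺sup φ x = ≺lsub φ x ≼-refl

  label-Wqo : {X : Set ℓ} (φ : X → Ord ℓ) → Wqo (Below φ)
  label-Wqo {ℓ} {X} φ Y = bounded (≺-wellFounded (sup φ)) λ {x} _ → ≺sup φ x
    where
    bounded : ∀ {a Y} → Acc _≺_ a → (∀ {x} → Y x → φ x ≺ a) → Bar (Below φ) Y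
    bounded (acc rs) Y≺a = bar λ x x∈Y → bounded (rs (Y≺a x∈Y)) λ (_ , x⋠y) → ⋠⇒≻ x⋠y

  labelHeight : {X : Set ℓ} → (X → Ord ℓ) → Pred X ℓ → Ord ℓ
  labelHeight φ = height (label-Wqo φ)

  -- An inequality only, since the labels may skip ordinals.
  labelHeight-residual : (φ : X → Ord ℓ) {Y : Pred X ℓ} (x : X) → labelHeight φ (residual (Below φ) Y x) ≼ φ x
  labelHeight-residual {X = X} φ x = go x (≺-wellFounded (φ x))
    where
    go : ∀ {Y} x → Acc _≺_ (φ x) → labelHeight φ (residual (Below φ) Y x) ≼ φ x
    go x (acc rs) = height-least (label-Wqo φ) λ y (_ , x⋠y) →
      ≼-≺-trans (go y (rs (⋠⇒≻ x⋠y))) (⋠⇒≻ x⋠y)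

  labelHeight-bound : (φ : X → Ord ℓ) {Y : Pred X ℓ} {a : Ord ℓ} → (∀ {x} → Y x → φ x ≺ a) → labelHeight φ Y ≼ a
  labelHeight-bound φ p = height-least (label-Wqo φ) λ x x∈Y → ≼-≺-trans (labelHeight-residual φ x) (p x∈Y)

  labelHeight-mono : (φ ψ : X → Ord ℓ) {Y Z : Pred X ℓ} → Z ⊆ Y →
    (∀ {x y} → Z x → Z y → φ x ≼ φ y → ψ x ≼ ψ y) → labelHeight ψ Z ≼ labelHeight φ Y
  labelHeight-mono φ ψ = height-mono (label-Wqo φ) (label-Wqo ψ)

  lex⁻ : (t : Ord ℓ) {a b c d : Ord ℓ} → d ≺ t → t · a + c ≼ t · b + d → a ≼ b
  lex⁻ t d≺t p = ⊀⇒≽ λ b≺a → ≼⇒⊁ p (·-position-≺-≼ t d≺t b≺a)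

  lex-injective : (t : Ord ℓ) {a b c d : Ord ℓ} → c ≺ t → d ≺ t → t · a + c ≋ t · b + d → a ≋ b × c ≋ d
  lex-injective t {a} {b} {c} {d} c≺t d≺t (p , q) = (a≼b , b≼a) ,
    +-cancelˡ-≼ (≼-trans p (+-monoˡ-≼ d (·-monoʳ-≼ t b≼a))) ,
    +-cancelˡ-≼ (≼-trans q (+-monoˡ-≼ c (·-monoʳ-≼ t a≼b)))
    where
    a≼b = lex⁻ t d≺t p
    b≼a = lex⁻ t c≺t q

  -- Maximal linear extensions

  module MaximalLinearExtension {X : Set ℓ} {S : Rel X ℓ} (po : IsPartialOrder _≡_ S) (w : Wqo S)
           (k : X → Ord ℓ) (k-injective : ∀ {x y} → k x ≋ k y → x ≡ y) where

    open IsPartialOrder po using (antisym) renaming (refl to S-refl; trans to S-trans)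

    -- Extensions are given by labels, so that placing one above another amounts to adding a
    -- constant to its labels.
    record LinearExtension (Y : Pred X ℓ) (a : Ord ℓ) : Set (lsuc ℓ) where
      field
        label     : X → Ord ℓ
        monotone  : ∀ {x y} → Y x → Y y → S x y → label x ≼ label y
        injective : InjectiveOn Y label
        long      : a ≼ labelHeight label Y

    open LinearExtension

    shorten : ∀ {Y a b} → b ≼ a → LinearExtension Y a → LinearExtension Y b
    shorten p L = record
      { label = label L ; monotone = monotone L ; injective = injective L ; long = ≼-trans p (long L) }

    private
      h : X → Ord ℓ
      h x = height w (residual S Full x)

      h-≺ : ∀ {x y} → S x y → x ≢ y → h x ≺ h y
      h-≺ {x} {y} Sxy x≢y = ≼-≺-trans
        (height-⊆ w λ (_ , ¬Sxz) → (_ , λ Syz → ¬Sxz (S-trans Sxy Syz)) , ¬Sxz)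
        (height-residual w (_ , λ Syx → x≢y (antisym Sxy Syx)))

    -- Elements of equal height are separated by the injection k.
    linearExtension : ∀ {Y} → LinearExtension Y 𝟎
    linearExtension = record
      { label     = λ x → sup k · h x + k x
      ; monotone  = λ {x} {y} _ _ → mono x y
      ; injective = λ {x} {y} _ _ p → k-injective (proj₂ (lex-injective (sup k) (≺sup k x) (≺sup k y) p))
      ; long      = 𝟎≼
      }
      where
      mono : ∀ x y → S x y → sup k · h x + k x ≼ sup k · h y + k y
      mono x y Sxy with dec (x ≡ y)
      ... | yes refl = ≼-refl
      ... | no x≢y   = ≺⇒≼ (·-position-≺-≼ (sup k) (≺sup k x) (h-≺ Sxy x≢y))

    module _ {Y D U : Pred X ℓ} (Y⊆ : Y ⊆ D ∪ U) (D⊆Y : D ⊆ Y) (U⊆Y : U ⊆ Y)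
             (D≱U : ∀ {d u} → D d → U u → ¬ S u d) where

      concatenate : ∀ {a b} → LinearExtension D a → LinearExtension U b → LinearExtension Y (a + b)
      concatenate {a} {b} L M = record
        { label     = φ
        ; monotone  = mono
        ; injective = inj
        ; long      = ≼-trans (+-mono-≼ (≼-trans (long L) (labelHeight-mono φ (label L) id reflectD))
                                        (≼-trans (long M) (labelHeight-mono φ (label M) id reflectU)))
                              (height-+ (label-Wqo φ) D⊆Y U⊆Y λ d∈D u∈U p → ≼⇒⊁ p (D≺U d∈D u∈U))
        }
        where
        shift : Ord ℓ → Ord ℓ
        shift c = sup (label L) + c
        φ : X → Ord ℓ
        φ x with dec (D x)
        ... | yes _ = label L x
        ... | no  _ = shift (label M x)
        φ-D : ∀ {x} → D x → φ x ≡ label L x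
        φ-D {x} x∈D with dec (D x)
        ... | yes _ = refl
        ... | no x∉D = ⊥-elim (x∉D x∈D)
        φ-U : ∀ {x} → U x → φ x ≡ shift (label M x)
        φ-U {x} x∈U with dec (D x)
        ... | yes x∈D = ⊥-elim (D≱U x∈D x∈U S-refl)
        ... | no _    = refl
        monoD : ∀ {x y} → D x → D y → label L x ≼ label L y → φ x ≼ φ y
        monoD x∈D y∈D p rewrite φ-D x∈D | φ-D y∈D = p
        monoU : ∀ {x y} → U x → U y → label M x ≼ label M y → φ x ≼ φ y
        monoU x∈U y∈U p rewrite φ-U x∈U | φ-U y∈U = +-monoʳ-≼ _ p
        reflectD : ∀ {x y} → D x → D y → φ x ≼ φ y → label L x ≼ label L y
        reflectD x∈D y∈D p rewrite φ-D x∈D | φ-D y∈D = p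
        reflectU : ∀ {x y} → U x → U y → φ x ≼ φ y → label M x ≼ label M y
        reflectU x∈U y∈U p rewrite φ-U x∈U | φ-U y∈U = +-cancelˡ-≼ p
        D≺U : ∀ {x y} → D x → U y → φ x ≺ φ y
        D≺U {x} x∈D y∈U rewrite φ-D x∈D | φ-U y∈U = ≺-≼-trans (≺sup (label L) x) (x≼x+y _ _)
        mono : ∀ {x y} → Y x → Y y → S x y → φ x ≼ φ y
        mono x∈Y y∈Y Sxy with Y⊆ x∈Y | Y⊆ y∈Y
        ... | inj₁ x∈D | inj₁ y∈D = monoD x∈D y∈D (monotone L x∈D y∈D Sxy)
        ... | inj₁ x∈D | inj₂ y∈U = ≺⇒≼ (D≺U x∈D y∈U)
        ... | inj₂ x∈U | inj₁ y∈D = ⊥-elim (D≱U y∈D x∈U Sxy)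
        ... | inj₂ x∈U | inj₂ y∈U = monoU x∈U y∈U (monotone M x∈U y∈U Sxy)
        inj : InjectiveOn Y φ
        inj x∈Y y∈Y p with Y⊆ x∈Y | Y⊆ y∈Y
        ... | inj₁ x∈D | inj₂ y∈U = ⊥-elim (≼⇒⊁ (proj₂ p) (D≺U x∈D y∈U))
        ... | inj₂ x∈U | inj₁ y∈D = ⊥-elim (≼⇒⊁ (proj₁ p) (D≺U y∈D x∈U))
        ... | inj₁ x∈D | inj₁ y∈D rewrite φ-D x∈D | φ-D y∈D = injective L x∈D y∈D p
        ... | inj₂ x∈U | inj₂ y∈U rewrite φ-U x∈U | φ-U y∈U =
          injective M x∈U y∈U (+-cancelˡ-≼ (proj₁ p) , +-cancelˡ-≼ (proj₂ p))

    Maximal : Ord ℓ → Set (lsuc ℓ)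
    Maximal a = ∀ {Y} → a ≼ height w Y → LinearExtension Y a

    private
      _∖_ : Pred X ℓ → Pred X ℓ → Pred X ℓ
      (Y ∖ D) y = Y y × ¬ D y

      cover : ∀ Y D → Y ⊆ D ∪ (Y ∖ D)
      cover Y D {y} y∈Y with dec (D y)
      ... | yes y∈D = inj₁ y∈D
      ... | no  y∉D = inj₂ (y∈Y , y∉D)

    -- Cuts off an initial segment of height `ω^ e`. Were the rest of height less than the remaining
    -- sum, subadditivity would make `Y` too low: against `ω^ e` the natural and the ordinary sum
    -- agree.
    maximal-∑ : ∀ {es} → Descending id es → All (Maximal ∘ ω^_) es → Maximal (∑ ω^_ es)
    maximal-∑ {[]} [] [] _ = linearExtension
    maximal-∑ {e ∷ es} (p ∷ ps) (m ∷ ms) {Y} q with initialSegment w S-trans (≼-trans (x≼x+y (ω^ e) _) q)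
    ... | D , D⊆Y , D≋ , D≱ = concatenate (cover Y D) D⊆Y proj₁ (λ d∈D (u∈Y , u∉D) → D≱ u∈Y u∉D d∈D)
          (m (proj₂ D≋)) (maximal-∑ ps ms (⊀⇒≽ λ U≺ → ≼⇒⊁ q (short U≺)))
      where
      open ≼-Reasoning
      short : height w (Y ∖ D) ≺ ∑ ω^_ es → height w Y ≺ ω^ e + ∑ ω^_ es
      short U≺ = begin-strict
        height w Y                        ≤⟨ height-∪ w {Y} {D} {Y ∖ D} (cover Y D) ⟩
        height w D ♯ height w (Y ∖ D)     ≤⟨ ♯-monoˡ-≼ _ (proj₁ D≋) ⟩
        ω^ e ♯ height w (Y ∖ D)           ≈⟨ ω^♯≋ω^+ (length es) (≼-trans (≺⇒≼ U≺) (∑ω^-bound id p)) ⟩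
        ω^ e + height w (Y ∖ D)           <⟨ +-monoʳ-≺ (ω^ e) U≺ ⟩
        ω^ e + ∑ ω^_ es                   ∎

    ∑-exponents-≺ : {es : List (Ord ℓ)} {e : Ord ℓ} → Descending id es → ∑ ω^_ es ≺ ω^ e → All (_≺ e) es
    ∑-exponents-≺             []      _ = []
    ∑-exponents-≺ {d ∷ es} {e} (p ∷ _) q = d≺e ∷ All.map (λ r → ≼-≺-trans r d≺e) p
      where
      d≺e : d ≺ e
      d≺e = ⋠⇒≻ λ e≼d → ≼⇒⊁ (≼-trans (ω^-mono-≼ e≼d) (x≼x+y (ω^ d) (∑ ω^_ es))) q

    maximal-≺ : ∀ {e a} → (∀ {d} → d ≺ e → Maximal (ω^ d)) → a ≺ ω^ e → Maximal a
    maximal-≺ {a = a} ih a≺ a≼ with normalForm a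
    ... | es , descending , es≋a = shorten (proj₂ es≋a) (maximal-∑ descending
            (All.map ih (∑-exponents-≺ descending (≼-≺-trans (proj₁ es≋a) a≺))) (≼-trans (proj₁ es≋a) a≼))

    -- The indecomposable case.  On P, of height ω^ e, the function f below is
    -- cofinal in ω^ e.  A subset Y minimal among those on which f is cofinal
    -- contains a chain C on which f is still cofinal.  The initial segments
    -- {y ∈ P ∣ c ≰ y} for c ∈ C then cut P into blocks of lower height.
    module Indecomposable {e : Ord ℓ} (𝟎≺e : 𝟎 ≺ e) (ih : ∀ {d} → d ≺ e → Maximal (ω^ d))
             {P : Pred X ℓ} (P≋ : height w P ≋ ω^ e) where

      f : X → Ord ℓ
      f x = height w (residual S P x)

      f-≺ : ∀ {x} → P x → f x ≺ ω^ e
      f-≺ x∈P = ≺-≼-trans (height-residual w x∈P) (proj₁ P≋)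

      Cofinal : Pred X ℓ → Set (lsuc ℓ)
      Cofinal Y = ∀ {a} → a ≺ ω^ e → Σ[ x ∈ X ] (Y x × a ≼ f x)

      ¬Cofinal⇒bounded : ∀ {Y} → ¬ Cofinal Y → Σ[ a ∈ Ord ℓ ] (a ≺ ω^ e × (∀ {x} → Y x → f x ≺ a))
      ¬Cofinal⇒bounded {Y} ¬c with dec (Σ[ a ∈ Ord ℓ ] (a ≺ ω^ e × (∀ {x} → Y x → f x ≺ a)))
      ... | yes p = p
      ... | no ¬p = ⊥-elim (¬c λ a≺ → cofinal a≺ (dec _))
        where
        cofinal : ∀ {a} → a ≺ ω^ e → Dec (Σ[ x ∈ X ] (Y x × a ≼ f x)) → Σ[ x ∈ X ] (Y x × a ≼ f x)
        cofinal a≺ (yes q) = q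
        cofinal a≺ (no ¬q) = ⊥-elim (¬p (_ , a≺ , λ x∈Y → ⋠⇒≻ λ r → ¬q (_ , x∈Y , r)))

      -- Minimality concerns residuals: replacing the set by a residual that is still cofinal must
      -- stop, as the set is barred.
      minimalCofinal : ∀ {Y} → Bar S Y → Cofinal Y →
        Σ[ Z ∈ Pred X ℓ ] (Z ⊆ Y × Cofinal Z × (∀ {y} → Z y → ¬ Cofinal (residual S Z y)))
      minimalCofinal {Y} (bar r) c with dec (Σ[ y ∈ X ] (Y y × Cofinal (residual S Y y)))
      ... | no ¬p = Y , id , c , λ y∈Y q → ¬p (_ , y∈Y , q)
      ... | yes (y , y∈Y , q) with minimalCofinal (r y y∈Y) q
      ...   | Z , Z⊆ , cZ , min = Z , proj₁ ∘ Z⊆ , cZ , min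

      private
        minimal = minimalCofinal (w P) λ a≺ → ≺height⁻ w (≺-≼-trans a≺ (proj₂ P≋))

        Y : Pred X ℓ
        Y = proj₁ minimal

        Y⊆P : Y ⊆ P
        Y⊆P = proj₁ (proj₂ minimal)

        Y-cofinal : Cofinal Y
        Y-cofinal = proj₁ (proj₂ (proj₂ minimal))

        -- By minimality of `Y`, `f` is bounded below `ω^ e` on the elements of `Y` not above `y`.
        -- The value `𝟎` is the default outside `Y`.
        bound : ∀ y → Σ[ a ∈ Ord ℓ ] (Y y → a ≺ ω^ e × (∀ {z} → residual S Y y z → f z ≺ a))
        bound y with dec (Y y)
        ... | no y∉Y = 𝟎 , λ y∈Y → ⊥-elim (y∉Y y∈Y)
        ... | yes y∈Y with ¬Cofinal⇒bounded (proj₂ (proj₂ (proj₂ minimal)) y∈Y)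
        ...   | a , p = a , λ _ → p

        -- Elements of Y above which f exceeds g y are above y, and f grows
        -- enough along C to make the blocks long.
        g : X → Ord ℓ
        g y = proj₁ (bound y) ♯ (f y ♯ f y)

        g-≺ : ∀ {y} → Y y → g y ≺ ω^ e
        g-≺ {y} y∈Y = ω^-♯-closed e (proj₁ (proj₂ (bound y) y∈Y))
          (ω^-♯-closed e (f-≺ (Y⊆P y∈Y)) (f-≺ (Y⊆P y∈Y)))

        f♯f≼g : ∀ y → f y ♯ f y ≼ g y
        f♯f≼g y = x≼y♯x (proj₁ (bound y)) (f y ♯ f y)

        f≼g : ∀ y → f y ≼ g y
        f≼g y = ≼-trans (x≼x♯y (f y) (f y)) (f♯f≼g y)

        -- Greedy selection along `k`: an element of `Y` joins the chain when `f` there exceeds `g`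
        -- at all members chosen before it.
        C-acc : ∀ x → Acc _≺_ (k x) → Set ℓ
        C-acc x (acc rs) = Y x × (∀ c → (p : k c ≺ k x) → C-acc c (rs p) → g c ≺ f x)

        C-irr : ∀ x (a b : Acc _≺_ (k x)) → C-acc x a → C-acc x b
        C-irr x (acc rs) (acc ss) (x∈Y , p) =
          x∈Y , λ c c≺x c∈C → p c c≺x (C-irr c (ss c≺x) (rs c≺x) c∈C)

        wf : ∀ x → Acc _≺_ (k x)
        wf x = acc {x = k x} λ {a} _ → ≺-wellFounded a

        C : Pred X ℓ
        C x = C-acc x (wf x)

        C⁺ : ∀ {x} → Y x → (∀ c → k c ≺ k x → C c → g c ≺ f x) → C x
        C⁺ x∈Y p = x∈Y , λ c c≺x c∈C → p c c≺x (C-irr c (≺-wellFounded (k c)) (wf c) c∈C)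

        C⊆Y : C ⊆ Y
        C⊆Y = proj₁

        C-≺ : ∀ {c x} → k c ≺ k x → C c → C x → g c ≺ f x
        C-≺ {c} c≺x c∈C (_ , p) = p c c≺x (C-irr c (wf c) (≺-wellFounded (k c)) c∈C)

        C-chain : ∀ {c x} → k c ≺ k x → C c → C x → S c x
        C-chain {c} {x} c≺x c∈C x∈C with dec (S c x)
        ... | yes p = p
        ... | no ¬p = ⊥-elim (≺-irrefl (≺-trans (proj₂ (proj₂ (bound c) (C⊆Y c∈C)) (C⊆Y x∈C , ¬p))
                        (≼-≺-trans (x≼x♯y _ (f c ♯ f c)) (C-≺ c≺x c∈C x∈C))))

        trichotomy : ∀ c d → c ≡ d ⊎ (k c ≺ k d ⊎ k d ≺ k c)
        trichotomy c d with compare (k c) (k d) | compare (k d) (k c)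
        ... | inj₂ p | _      = inj₂ (inj₂ p)
        ... | inj₁ _ | inj₂ q = inj₂ (inj₁ q)
        ... | inj₁ p | inj₁ q = inj₁ (k-injective (p , q))

        𝟏≺ω^e : 𝟏 ≺ ω^ e
        𝟏≺ω^e = ≼-≺-trans (proj₂ ω^𝟎≋𝟏) (ω^-mono-≺ 𝟎≺e)

        osuc-≺ : ∀ {a} → a ≺ ω^ e → osuc a ≺ ω^ e
        osuc-≺ {a} p = ≼-≺-trans (osuc≼ (≼-≺-trans (proj₂ (♯-identityʳ a)) (♯-monoʳ-≺ a (≺osuc ≼-refl))))
                         (ω^-♯-closed e p 𝟏≺ω^e)

        -- If `f` stayed below `a` on `C`, some `b ≺ ω^ e` with `a ≼ b` would bound `g` on `C`. An
        -- element of `Y` where `f` exceeds `b` would then be selected, although its `f` exceeds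
        -- `a`.
        C-cofinal : Cofinal C
        C-cofinal {a} a≺ with dec (Σ[ x ∈ X ] (C x × a ≼ f x))
        ... | yes p = p
        ... | no ¬p = ⊥-elim (contradiction (dec _))
          where
          f≺a : ∀ {c} → C c → f c ≺ a
          f≺a c∈C = ⋠⇒≻ λ q → ¬p (_ , c∈C , q)
          unbounded : ∀ {b} → a ≼ b → b ≺ ω^ e → (∀ {c} → C c → g c ≼ b) → ⊥
          unbounded {b} a≼b b≺ g≼b with Y-cofinal (osuc-≺ b≺)
          ... | x , x∈Y , b<fx = ≼⇒⊁ a≼b (≺-trans (lsub≼⁻ b<fx _)
                (f≺a (C⁺ x∈Y λ c _ c∈C → ≼-≺-trans (g≼b c∈C) (lsub≼⁻ b<fx _))))
          contradiction : ¬ Dec (Σ[ c ∈ X ] (C c × a ≼ g c))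
          contradiction (no ¬q) = unbounded ≼-refl a≺ λ c∈C → ≺⇒≼ (⋠⇒≻ λ r → ¬q (_ , c∈C , r))
          -- Such a c is the last element of C, so that g c bounds g on C.
          contradiction (yes (c , c∈C , a≼gc)) = unbounded a≼gc (g-≺ (C⊆Y c∈C)) λ {d} d∈C → g≼ d d∈C (trichotomy d c)
            where
            g≼ : ∀ d → C d → d ≡ c ⊎ (k d ≺ k c ⊎ k c ≺ k d) → g d ≼ g c
            g≼ d d∈C (inj₁ refl)       = ≼-refl
            g≼ d d∈C (inj₂ (inj₁ d≺c)) = ≼-trans (≺⇒≼ (C-≺ d≺c d∈C c∈C)) (f≼g c)
            g≼ d d∈C (inj₂ (inj₂ c≺d)) = ⊥-elim (≼⇒⊁ a≼gc (≺-trans (C-≺ c≺d c∈C d∈C) (f≺a d∈C)))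

        C-noLast : ∀ {c} → C c → Σ[ d ∈ X ] (C d × k c ≺ k d)
        C-noLast {c} c∈C with C-cofinal (osuc-≺ (f-≺ (Y⊆P (C⊆Y c∈C))))
        ... | d , d∈C , p = d , d∈C , case (trichotomy d c)
          where
          case : d ≡ c ⊎ (k d ≺ k c ⊎ k c ≺ k d) → k c ≺ k d
          case (inj₁ refl)       = ⊥-elim (≺-irrefl (lsub≼⁻ p _))
          case (inj₂ (inj₁ d≺c)) = ⊥-elim (≺-irrefl (≺-trans (≼-≺-trans (f≼g d) (C-≺ d≺c d∈C c∈C)) (lsub≼⁻ p _)))
          case (inj₂ (inj₂ c≺d)) = c≺d

        least : {Q : Pred X ℓ} → ∀ x → Q x → Σ[ c ∈ X ] (Q c × (∀ {d} → k d ≺ k c → ¬ Q d))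
        least {Q} x x∈Q = go x x∈Q (≺-wellFounded (k x))
          where
          go : ∀ x → Q x → Acc _≺_ (k x) → Σ[ c ∈ X ] (Q c × (∀ {d} → k d ≺ k c → ¬ Q d))
          go x x∈Q (acc rs) with dec (Σ[ d ∈ X ] (k d ≺ k x × Q d))
          ... | yes (d , d≺x , d∈Q) = go d d∈Q (rs d≺x)
          ... | no ¬p = x , x∈Q , λ d≺x d∈Q → ¬p (_ , d≺x , d∈Q)

        Block : X → Pred X ℓ
        Block c y = P y × C c × ¬ S c y × (∀ d → C d → k d ≺ k c → S d y)

        block : ∀ {y} → P y → Σ[ c ∈ X ] Block c y
        block {y} y∈P with C-cofinal (osuc-≺ (f-≺ y∈P))
        ... | c , c∈C , p with least {λ c → C c × ¬ S c y} c (c∈C , λ Scy →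
                ≼⇒⊁ (height-antitone w S-trans Scy) (lsub≼⁻ p _))
        ...   | d , (d∈C , ¬Sdy) , min = d , y∈P , d∈C , ¬Sdy , λ c c∈C c≺d → below c c∈C c≺d (dec (S c y))
          where
          below : ∀ c → C c → k c ≺ k d → Dec (S c y) → S c y
          below c c∈C c≺d (yes q) = q
          below c c∈C c≺d (no ¬q) = ⊥-elim (min c≺d (c∈C , ¬q))

        block-unique : ∀ {c d y} → Block c y → Block d y → c ≡ d
        block-unique {c} {d} (_ , c∈C , ¬Scy , p) (_ , d∈C , ¬Sdy , q) with trichotomy c d
        ... | inj₁ eq         = eq
        ... | inj₂ (inj₁ c≺d) = ⊥-elim (¬Scy (q c c∈C c≺d))
        ... | inj₂ (inj₂ d≺c) = ⊥-elim (¬Sdy (p d d∈C d≺c))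

        Block-height : ∀ c → height w (Block c) ≺ ω^ e
        Block-height c with dec (C c)
        ... | yes c∈C = ≼-≺-trans (height-⊆ w λ (y∈P , _ , ¬Scy , _) → y∈P , ¬Scy) (f-≺ (Y⊆P (C⊆Y c∈C)))
        ... | no  c∉C = ≼-≺-trans (height-least w λ y (_ , c∈C , _) → ⊥-elim (c∉C c∈C)) (𝟎≺ω^ {a = e})

        abstract
          extension : ∀ c → LinearExtension (Block c) (height w (Block c))
          extension c = maximal-≺ ih (Block-height c) ≼-refl

        ψ : X → X → Ord ℓ
        ψ c = label (extension c)

        Θ : Ord ℓ
        Θ = lsub {I = X × X} λ (c , y) → ψ c y

        ψ≺Θ : ∀ {c y} → ψ c y ≺ Θ
        ψ≺Θ {c} {y} = ≺lsub _ (c , y) ≼-refl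

        φ : X → Ord ℓ
        φ y with dec (Σ[ c ∈ X ] Block c y)
        ... | yes (c , _) = Θ · k c + ψ c y
        ... | no _        = 𝟎

        φ-block : ∀ {c y} → Block c y → φ y ≡ Θ · k c + ψ c y
        φ-block {c} {y} p with dec (Σ[ c ∈ X ] Block c y)
        ... | no ¬p       = ⊥-elim (¬p (c , p))
        ... | yes (d , q) with block-unique q p
        ...   | refl = refl

        φ-mono : ∀ {y z} → P y → P z → S y z → φ y ≼ φ z
        φ-mono {y} {z} y∈P z∈P Syz with block y∈P | block z∈P
        ... | c , p | d , q with trichotomy c d
        ...   | inj₁ refl rewrite φ-block p | φ-block q = +-monoʳ-≼ _ (monotone (extension c) p q Syz)
        ...   | inj₂ (inj₁ c≺d) rewrite φ-block p | φ-block q = ≺⇒≼ (·-position-≺-≼ Θ (ψ≺Θ {c} {y}) c≺d)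
        -- The block of `z` cannot be the earlier one: `d` would be below `y`, hence below `z`.
        ...   | inj₂ (inj₂ d≺c) = let _ , d∈C , ¬Sdz , _ = q ; _ , _ , _ , S-below = p in
                  ⊥-elim (¬Sdz (S-trans (S-below d d∈C d≺c) Syz))

        φ-injective : InjectiveOn P φ
        φ-injective {y} {z} y∈P z∈P eq with block y∈P | block z∈P
        ... | c , p | d , q rewrite φ-block p | φ-block q with lex-injective Θ (ψ≺Θ {c} {y}) (ψ≺Θ {d} {z}) eq
        ...   | kc≋kd , ψ≋ with k-injective kc≋kd
        ...     | refl = injective (extension c) p q ψ≋

        -- If d is the successor of c in C, then residual S P d is the union of
        -- residual S P c and of the block of d, where f d exceeds f c ♯ f c.
        φ-long : ∀ {a} → a ≺ ω^ e → a ≺ labelHeight φ P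
        φ-long {a} a≺ with C-cofinal a≺
        ... | c , c∈C , a≼fc with C-noLast c∈C
        ...   | x , x∈C , c≺x with least {λ d → C d × k c ≺ k d} x (x∈C , c≺x)
        ...     | d , (d∈C , c≺d) , min = begin-strict
          a                                ≤⟨ a≼fc ⟩
          f c                              <⟨ ♯-cancelˡ-≺ (≼-≺-trans (f♯f≼g c) (≺-≼-trans (C-≺ c≺d c∈C d∈C) (height-∪ w cut))) ⟩
          height w (Block d)               ≤⟨ long (extension d) ⟩
          labelHeight (ψ d) (Block d)      ≤⟨ labelHeight-mono φ (ψ d) id reflect ⟩
          labelHeight φ (Block d)          ≤⟨ height-⊆ (label-Wqo φ) proj₁ ⟩
          labelHeight φ P                  ∎
          where
          open ≼-Reasoning
          reflect : ∀ {y z} → Block d y → Block d z → φ y ≼ φ z → ψ d y ≼ ψ d z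
          reflect p q r rewrite φ-block p | φ-block q = +-cancelˡ-≼ r
          S-below : ∀ {y} → S c y → ∀ x → C x → k x ≺ k d → x ≡ c ⊎ (k x ≺ k c ⊎ k c ≺ k x) → S x y
          S-below Scy x x∈C x≺d (inj₁ refl)       = Scy
          S-below Scy x x∈C x≺d (inj₂ (inj₁ x≺c)) = S-trans (C-chain x≺c x∈C c∈C) Scy
          S-below Scy x x∈C x≺d (inj₂ (inj₂ c≺x)) = ⊥-elim (min x≺d (x∈C , c≺x))
          cut : residual S P d ⊆ residual S P c ∪ Block d
          cut {y} (y∈P , ¬Sdy) with dec (S c y)
          ... | no ¬Scy = inj₁ (y∈P , ¬Scy)
          ... | yes Scy = inj₂ (y∈P , d∈C , ¬Sdy , λ x x∈C x≺d → S-below Scy x x∈C x≺d (trichotomy x c))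

      extension-P : LinearExtension P (ω^ e)
      extension-P = record
        { label = φ ; monotone = φ-mono ; injective = φ-injective
        ; long = ⊀⇒≽ λ p → ≺-irrefl (φ-long p) }

    maximal-ω^ : ∀ e → Maximal (ω^ e)
    maximal-ω^ e = go (≺-wellFounded e)
      where
      go : ∀ {e} → Acc _≺_ e → Maximal (ω^ e)
      go {e} (acc rs) {Y} p with compare e 𝟎
      -- `ω^ 𝟎` is one, so any extension of the inhabited `Y` is long enough.
      ... | inj₁ e≼𝟎 with ≺height⁻ w (≺-≼-trans (𝟎≺ω^ {a = e}) p)
      ...   | x , x∈Y , _ = record
        { label = label L ; monotone = monotone L ; injective = injective L
        ; long = ≼-trans (≼-trans (ω^-mono-≼ e≼𝟎) (proj₁ ω^𝟎≋𝟏)) (osuc≼ (height-inhabited (label-Wqo (label L)) x∈Y)) }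
        where L = linearExtension {Y}
      go {e} (acc rs) {Y} p | inj₂ 𝟎≺e with initialSegment w S-trans p
      ...   | D , D⊆Y , D≋ , D≱ = shorten (x≼x+y (ω^ e) 𝟎)
        (concatenate (cover Y D) D⊆Y proj₁ (λ d∈D (u∈Y , u∉D) → D≱ u∈Y u∉D d∈D)
          (Indecomposable.extension-P 𝟎≺e (λ d≺e → go (rs d≺e)) D≋) linearExtension)

    maximalLinearExtension : ∀ Y → LinearExtension Y (height w Y)
    maximalLinearExtension Y = maximal-≺ (λ {d} _ → maximal-ω^ d)
      (≼-≺-trans (x≼ω^x (height w Y)) (ω^-mono-≺ (≺osuc ≼-refl))) ≼-refl

-- Order types, ordinals as sets, and infinite cardinals

module Cardinals (em : ∀ {a} → ExcludedMiddle a) (ext : ∀ {a b} → Extensionality a b) where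

  open NaturalSums em
  open Heights em
  open LinearExtensions em

  private
    variable
      X : Set ℓ

  -- Positions in a well order

  module _ {X : Set ℓ} {L : Rel X ℓ} (isTotal : IsTotalOrder _≡_ L) (w : Wqo L) where

    open IsTotalOrder isTotal using (antisym; total) renaming (trans to L-trans)

    private
      flip : ∀ {x y} → ¬ L x y → L y x
      flip {x} {y} ¬Lxy = [ (λ Lxy → ⊥-elim (¬Lxy Lxy)) , id ] (total x y)

    module _ (Y : Pred X ℓ) where

      position : X → Ord ℓ
      position x = height w (residual L Y x)

      position-≺-height : ∀ {x} → Y x → position x ≺ height w Y
      position-≺-height = height-residual w

      position-mono-≺ : ∀ {x y} → Y y → ¬ L x y → position y ≺ position x
      position-mono-≺ {x} {y} y∈Y ¬Lxy = ≼-≺-trans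
        (height-⊆ w λ (z∈Y , ¬Lyz) → (z∈Y , λ Lxz → ¬Lxy (L-trans Lxz (flip ¬Lyz))) , ¬Lyz)
        (height-residual w (y∈Y , ¬Lxy))

      position-injective : InjectiveOn Y position
      position-injective {x} {y} x∈Y y∈Y (p , q) with dec (L x y) | dec (L y x)
      ... | no ¬Lxy | _       = ⊥-elim (≼⇒⊁ p (position-mono-≺ y∈Y ¬Lxy))
      ... | yes _   | no ¬Lyx = ⊥-elim (≼⇒⊁ q (position-mono-≺ x∈Y ¬Lyx))
      ... | yes Lxy | yes Lyx = antisym Lxy Lyx

      -- Descends through elements of position at least `a` until equality holds.
      position-surjective : ∀ {a} → a ≺ height w Y → Σ[ x ∈ X ] (Y x × position x ≋ a)
      position-surjective {a} a≺ with ≺height⁻ w a≺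
      ... | x , x∈Y , a≼ = descend-to x x∈Y a≼ (≺-wellFounded (position x))
        where
        descend-to : ∀ x → Y x → a ≼ position x → Acc _≺_ (position x) → Σ[ x ∈ X ] (Y x × position x ≋ a)
        descend-to x x∈Y a≼ (acc rs) with compare (position x) a
        ... | inj₁ ≼a = x , x∈Y , ≼a , a≼
        ... | inj₂ a≺ with ≺height⁻ w a≺
        ...   | y , (y∈Y , ¬Lxy) , a≼y = descend-to y y∈Y
          (≼-trans a≼y (height-⊆ w λ ((z∈Y , _) , ¬Lyz) → z∈Y , ¬Lyz)) (rs (position-mono-≺ y∈Y ¬Lxy))

    -- In a total order the residual at `x` is the set of elements strictly below `x`, so both ranks
    -- obey the same recursion.
    orderType≋height : (wf : WellFounded (Strict L)) → orderType (Strict L) wf ≋ height w Full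
    orderType≋height wf =
        lsub≼ (λ x → ≼-≺-trans (rank≼ (wf x) λ (y≤x , y≢x) → _ , λ x≤y → y≢x (antisym y≤x x≤y))
                               (height-residual w {x = x} _))
      , height-least w λ x _ → ≼-≺-trans
          (≼rank (wf x) λ {y} (_ , ¬Lxy) → flip ¬Lxy , λ { refl → ¬Lxy (flip ¬Lxy) })
          (≺lsub _ x ≼-refl)
      where
      rank≼ : ∀ {x Y} (a : Acc (Strict L) x) → (∀ {y} → Strict L y x → Y y) → rank (Strict L) a ≼ height w Y
      rank≼ {x} (acc rs) below = lsub≼ λ (y , y≤x , y≢x) → ≼-≺-trans
        (rank≼ (rs (y≤x , y≢x)) λ (z≤y , z≢y) →
          below (L-trans z≤y y≤x , λ { refl → y≢x (antisym y≤x z≤y) }) , λ y≤z → z≢y (antisym z≤y y≤z))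
        (height-residual w (below (y≤x , y≢x)))
      ≼rank : ∀ {x Y} (a : Acc (Strict L) x) → (∀ {y} → Y y → Strict L y x) → height w Y ≼ rank (Strict L) a
      ≼rank {x} {Y} (acc rs) above = height-least w λ y y∈Y → ≼-≺-trans
        (≼rank (rs (above y∈Y)) λ (_ , ¬Lyz) → flip ¬Lyz , λ { refl → ¬Lyz (flip ¬Lyz) })
        (≺lsub _ (y , above y∈Y) ≼-refl)

  Below-isTotalOrder : {X : Set ℓ} (φ : X → Ord ℓ) → (∀ {x y} → φ x ≋ φ y → x ≡ y) → IsTotalOrder _≡_ (Below φ)
  Below-isTotalOrder φ injective = record
    { isPartialOrder = record
      { isPreorder = record
        { isEquivalence = isEquivalence
        ; reflexive     = λ { refl → ≼-refl }
        ; trans         = ≼-trans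
        }
      ; antisym = λ p q → injective (p , q)
      }
    ; total = λ x y → Sum.map₂ ≺⇒≼ (compare (φ x) (φ y))
    }

  -- Ordinals as sets

  enumeration⇒Inverse : {X : Set ℓ} {a : Ord ℓ} (e : X → Ord ℓ) → (∀ x → e x ≺ a) →
    (∀ {x y} → e x ≋ e y → x ≡ y) → (∀ {b} → b ≺ a → Σ[ x ∈ X ] e x ≋ b) →
    Inverse (setoid X) (↓ a)
  enumeration⇒Inverse {ℓ} {X} {a} e e≺ injective surjective = record
    { to        = λ x → e x , unwrap≺ (e≺ x)
    ; from      = from
    ; to-cong   = λ { refl → ≤-refl _ , ≤-refl _ }
    ; from-cong = λ {b} {c} p → injective (≋-trans (e-from b) (≋-trans (≈⇒≋ p) (≋-sym (e-from c))))
    ; inverse   = (λ { {b} refl → ≋⇒≈ (e-from b) })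
                , λ {x} {b} p → injective (≋-trans (e-from b) (≈⇒≋ p))
    }
    where
    from : Σ[ b ∈ Ord ℓ ] b < a → X
    from (b , b<a) = proj₁ (surjective (wrap b<a))
    e-from : ∀ b → e (from b) ≋ proj₁ b
    e-from (b , b<a) = proj₂ (surjective (wrap b<a))

  -- The ordinals below `a` form a type one universe too high to carry an order at level `ℓ`. The
  -- nodes of the tree `a` represent them all at the right level, with repetitions.
  Node : Ord ℓ → Set ℓ
  Node (lsub {I} f) = Σ[ i ∈ I ] Maybe (Node (f i))

  subtree : (a : Ord ℓ) → Node a → Ord ℓ
  subtree (lsub f) (i , nothing) = f i
  subtree (lsub f) (i , just n)  = subtree (f i) n

  subtree-≺ : (a : Ord ℓ) (n : Node a) → subtree a n ≺ a
  subtree-≺ (lsub f) (i , nothing) = ≺lsub f i ≼-refl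
  subtree-≺ (lsub f) (i , just n)  = ≺-trans (subtree-≺ (f i) n) (≺lsub f i ≼-refl)

  subtree-surjective : (a : Ord ℓ) {b : Ord ℓ} → b ≺ a → Σ[ n ∈ Node a ] subtree a n ≋ b
  subtree-surjective (lsub f) {b} (wrap (i , p)) with compare (f i) b
  ... | inj₁ q = (i , nothing) , q , wrap p
  ... | inj₂ q with subtree-surjective (f i) q
  ...   | n , r = (i , just n) , r

  -- The representative of a class depends only on its characteristic function,
  -- which function extensionality makes the same for equal ordinals.
  module _ (a : Ord ℓ) where

    private
      class : Node a → Node a → Bool
      class n m = does (dec (subtree a n ≋ subtree a m))

      class-cong : ∀ {n m} → subtree a n ≋ subtree a m → class n ≡ class m
      class-cong p = ext λ k → does-⇔ (mk⇔ (≋-trans (≋-sym p)) (≋-trans p)) (dec _) (dec _)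

      representative : (Node a → Bool) → Maybe (Node a)
      representative P with dec (Σ[ n ∈ Node a ] P n ≡ true)
      ... | yes (n , _) = just n
      ... | no  _       = nothing

      representative-class : ∀ n → Σ[ m ∈ Node a ] (representative (class n) ≡ just m × subtree a n ≋ subtree a m)
      representative-class n with dec (Σ[ m ∈ Node a ] class n m ≡ true)
      ... | no ¬p       = ⊥-elim (¬p (n , dec-true (dec _) ≋-refl))
      ... | yes (m , p) with dec (subtree a n ≋ subtree a m)
      ...   | yes q = m , refl , q
      representative-class n | yes (m , ()) | no _

    Canonical : Set ℓ
    Canonical = Σ[ n ∈ Node a ] representative (class n) ≡ just n

    ⟦_⟧ : Canonical → Ord ℓ
    ⟦ n , _ ⟧ = subtree a n

    ⟦⟧-≺ : ∀ x → ⟦ x ⟧ ≺ a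
    ⟦⟧-≺ (n , _) = subtree-≺ a n

    ⟦⟧-injective : ∀ {x y} → ⟦ x ⟧ ≋ ⟦ y ⟧ → x ≡ y
    ⟦⟧-injective {n , p} {m , q} r with just-injective (trans (sym p) (trans (cong representative (class-cong r)) q))
    ... | refl = cong (n ,_) (uip p q)

    ⟦⟧-surjective : ∀ {b} → b ≺ a → Σ[ x ∈ Canonical ] ⟦ x ⟧ ≋ b
    ⟦⟧-surjective b≺a with subtree-surjective a b≺a
    ... | n , p with representative-class n
    ...   | m , q , r = (m , trans (cong representative (class-cong (≋-sym r))) q) , ≋-trans (≋-sym r) p

    Canonical-hasCardinality : HasCardinality Canonical a
    Canonical-hasCardinality = enumeration⇒Inverse ⟦_⟧ ⟦⟧-≺ ⟦⟧-injective ⟦⟧-surjective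

  -- Embeddings

  record Embedding (a b : Ord ℓ) : Set (lsuc ℓ) where
    field
      image     : Ord ℓ → Ord ℓ
      image-≺   : ∀ {x} → x ≺ a → image x ≺ b
      injective : ∀ {x y} → x ≺ a → y ≺ a → image x ≋ image y → x ≋ y

  -- The ordinal `c` goes to the label `g` of the element at position `c`; `𝟎` is a default for
  -- other arguments.
  height-Embedding : {X : Set ℓ} {L : Rel X ℓ} (isTotal : IsTotalOrder _≡_ L) (w : Wqo L)
    {Y : Pred X ℓ} {g : X → Ord ℓ} {a b : Ord ℓ} → a ≼ height w Y →
    (∀ {x} → Y x → g x ≺ b) → InjectiveOn Y g → Embedding a b
  height-Embedding {ℓ} {X} isTotal w {Y} {g} {a} {b} a≼ g≺b g-injective = record
    { image     = f
    ; image-≺   = λ c≺a → let x , (x∈Y , _) , eq = spec c≺a in subst (_≺ b) (sym eq) (g≺b x∈Y)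
    ; injective = λ c≺a d≺a → inj (spec c≺a) (spec d≺a)
    }
    where
    At : Ord ℓ → X → Set ℓ
    At c x = Y x × position isTotal w Y x ≋ c
    f : Ord ℓ → Ord ℓ
    f c with dec (Σ[ x ∈ X ] At c x)
    ... | yes (x , _) = g x
    ... | no _        = 𝟎
    spec : ∀ {c} → c ≺ a → Σ[ x ∈ X ] (At c x × f c ≡ g x)
    spec {c} c≺a with dec (Σ[ x ∈ X ] At c x)
    ... | yes (x , p) = x , p , refl
    ... | no ¬p       = ⊥-elim (¬p (position-surjective isTotal w Y (≺-≼-trans c≺a a≼)))
    inj : ∀ {c d} → Σ[ x ∈ X ] (At c x × f c ≡ g x) → Σ[ x ∈ X ] (At d x × f d ≡ g x) → f c ≋ f d → c ≋ d
    inj (x , (x∈Y , p) , fc) (y , (y∈Y , q) , fd) r rewrite fc | fd with g-injective x∈Y y∈Y r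
    ... | refl = ≋-trans (≋-sym p) q

  -- The image of an embedding of a in b is well ordered of type at most b.
  initial⇒¬Embedding : {a b : Ord ℓ} → (∀ c → c < a → ¬ Inverse (↓ a) (↓ c)) → b ≺ a → ¬ Embedding a b
  initial⇒¬Embedding {a = a} {b} initial b≺a embedding = initial c (unwrap≺ (≼-≺-trans c≼b b≺a))
    (Composition.inverse (Symmetry.inverse (Canonical-hasCardinality a))
      (enumeration⇒Inverse pos
        (λ x → position-≺-height isTotal w Full {x} _)
        (position-injective isTotal w Full _ _)
        (λ p → let x , _ , q = position-surjective isTotal w Full p in x , q)))
    where
    open Embedding embedding
    φ : Canonical a → Ord _
    φ x = image (⟦ a ⟧ x)
    isTotal = Below-isTotalOrder φ λ {x} {y} p → ⟦⟧-injective a (injective (⟦⟧-≺ a x) (⟦⟧-≺ a y) p)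
    w = label-Wqo φ
    c = labelHeight φ Full
    pos = position isTotal w Full
    c≼b : c ≼ b
    c≼b = labelHeight-bound φ λ {x} _ → image-≺ (⟦⟧-≺ a x)

  module _ {κ : Ord ℓ} (isInfiniteCardinal : IsInfiniteCardinal κ) where

    open IsInfiniteCardinal isInfiniteCardinal

    ¬Embedding-below : ∀ {a} → a ≺ κ → ¬ Embedding κ a
    ¬Embedding-below = initial⇒¬Embedding initial

    small-height : {X : Set ℓ} {L : Rel X ℓ} (isTotal : IsTotalOrder _≡_ L) (w : Wqo L) {Y : Pred X ℓ}
      {g : X → Ord ℓ} {a : Ord ℓ} → a ≺ κ → (∀ {x} → Y x → g x ≺ a) → InjectiveOn Y g → height w Y ≺ κ
    small-height isTotal w a≺κ g≺a injective =
      ⋠⇒≻ λ κ≼ → ¬Embedding-below a≺κ (height-Embedding isTotal w κ≼ g≺a injective)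

  -- Pairing

  record Pairing (a : Ord ℓ) : Set (lsuc ℓ) where
    field
      pair      : Ord ℓ → Ord ℓ → Ord ℓ
      pair-≺    : ∀ {x y} → x ≺ a → y ≺ a → pair x y ≺ a
      injective : ∀ {x y x′ y′} → x ≺ a → y ≺ a → x′ ≺ a → y′ ≺ a →
                  pair x y ≋ pair x′ y′ → x ≋ x′ × y ≋ y′

  private
    nat : ℕ → Ord ℓ
    nat zero    = 𝟎
    nat (suc n) = osuc (nat n)

    nat-mono : ∀ {m n} → m ℕ.<′ n → nat {ℓ} m ≺ nat n
    nat-mono ℕ.≤′-refl       = ≺osuc ≼-refl
    nat-mono (ℕ.≤′-step m<n) = ≺-trans (nat-mono m<n) (≺osuc ≼-refl)

    nat-injective : ∀ {m n} → nat {ℓ} m ≋ nat n → m ≡ n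
    nat-injective {m = m} {n} (p , q) with ℕ.<-cmp m n
    ... | tri< m<n _ _ = ⊥-elim (≼⇒⊁ q (nat-mono (ℕ.≤⇒≤′ m<n)))
    ... | tri≈ _ eq _  = eq
    ... | tri> _ _ n<m = ⊥-elim (≼⇒⊁ p (nat-mono (ℕ.≤⇒≤′ n<m)))

    +𝟏≋osuc : (a : Ord ℓ) → a + 𝟏 ≋ osuc a
    +𝟏≋osuc a =
        +-least (≺⇒≼ (≺osuc ≼-refl)) (λ c p → ≺osuc (≼-trans (+-monoʳ-≼ a (≺osuc⁻ p)) (proj₁ (+-identityʳ a))))
      , osuc≼ (≼-≺-trans (x≼x+y a 𝟎) (+-monoʳ-≺ a (≺osuc ≼-refl)))

    𝟏·ℕ≋nat : ∀ n → 𝟏 {ℓ} ·ℕ n ≋ nat n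
    𝟏·ℕ≋nat zero    = ≋-refl
    𝟏·ℕ≋nat (suc n) = ≋-trans (≋-sym (·ℕ-suc 𝟏 n)) (≋-trans (+𝟏≋osuc (𝟏 ·ℕ n))
      (osuc≼ (≺osuc (proj₁ (𝟏·ℕ≋nat n))) , osuc≼ (≺osuc (proj₂ (𝟏·ℕ≋nat n)))))

    nat-≺-ω : ∀ n → nat {ℓ} n ≺ ω
    nat-≺-ω n = ≼-≺-trans (≼-trans (proj₂ (𝟏·ℕ≋nat n)) (·ℕ-mono-≼ n (proj₂ ω^𝟎≋𝟏)))
                          (ω^-multiple-≺ n (≺osuc ≼-refl))

    ≼nat⁻ : ∀ n {a : Ord ℓ} → a ≼ nat n → Σ[ m ∈ ℕ ] a ≋ nat m
    ≼nat⁻ zero    p = 0 , p , 𝟎≼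
    ≼nat⁻ (suc n) {a} p with compare (nat (suc n)) a
    ... | inj₁ q = suc n , p , q
    ... | inj₂ q = ≼nat⁻ n (≺osuc⁻ q)

    ≺ω⁻ : {a : Ord ℓ} → a ≺ ω → Σ[ n ∈ ℕ ] a ≋ nat n
    ≺ω⁻ p with ≺ω^⁻ p
    ... | inj₁ q = 0 , q , 𝟎≼
    ... | inj₂ (d , d≺𝟏 , n , q) = ≼nat⁻ n (≼-trans q (≼-trans
      (·ℕ-mono-≼ n (≼-trans (ω^-mono-≼ (≺osuc⁻ d≺𝟏)) (proj₁ ω^𝟎≋𝟏))) (proj₁ (𝟏·ℕ≋nat n))))

    code : ℕ → ℕ → ℕ
    code m n = (m ℕ.+ n) ℕ.* (m ℕ.+ n) ℕ.+ m

    -- code m n lies between s * s and (1 + s) * (1 + s), where s = m + n.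
    code-< : ∀ m n m′ n′ → m ℕ.+ n ℕ.< m′ ℕ.+ n′ → code m n ℕ.< code m′ n′
    code-< m n m′ n′ p = begin-strict
      s ℕ.* s ℕ.+ m          ≤⟨ ℕ.+-monoʳ-≤ (s ℕ.* s) (ℕ.m≤m+n m n) ⟩
      s ℕ.* s ℕ.+ s          ≡⟨ ℕ.+-comm (s ℕ.* s) s ⟩
      suc s ℕ.* s            <⟨ ℕ.*-monoʳ-< (suc s) (ℕ.n<1+n s) ⟩
      suc s ℕ.* suc s        ≤⟨ ℕ.*-mono-≤ p p ⟩
      s′ ℕ.* s′              ≤⟨ ℕ.m≤m+n (s′ ℕ.* s′) m′ ⟩
      s′ ℕ.* s′ ℕ.+ m′       ∎
      where
      open ℕ.≤-Reasoning
      s  = m ℕ.+ n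
      s′ = m′ ℕ.+ n′

    code-injective : ∀ m n m′ n′ → code m n ≡ code m′ n′ → m ≡ m′ × n ≡ n′
    code-injective m n m′ n′ p with ℕ.<-cmp (m ℕ.+ n) (m′ ℕ.+ n′)
    ... | tri< q _ _ = ⊥-elim (ℕ.<⇒≢ (code-< m n m′ n′ q) p)
    ... | tri> _ _ q = ⊥-elim (ℕ.<⇒≢ (code-< m′ n′ m n q) (sym p))
    ... | tri≈ _ q _ = m≡m′ , ℕ.+-cancelˡ-≡ m n n′ (trans q (cong (ℕ._+ n′) (sym m≡m′)))
      where
      m≡m′ : m ≡ m′
      m≡m′ = ℕ.+-cancelˡ-≡ ((m ℕ.+ n) ℕ.* (m ℕ.+ n)) m m′
        (trans p (cong (λ s → s ℕ.* s ℕ.+ m′) (sym q)))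

  ω-Pairing : {a : Ord ℓ} → ω ≋ a → Pairing a
  ω-Pairing {a = a} ω≋a = record
    { pair      = λ x y → nat (code (index x) (index y))
    ; pair-≺    = λ _ _ → ≺-≼-trans (nat-≺-ω _) (proj₁ ω≋a)
    ; injective = λ {x} {y} {x′} {y′} p q p′ q′ r →
        let s , t = code-injective (index x) (index y) (index x′) (index y′) (nat-injective r)
        in index-injective p p′ s , index-injective q q′ t
    }
    where
    index : Ord _ → ℕ
    index x with dec (Σ[ n ∈ ℕ ] x ≋ nat n)
    ... | yes (n , _) = n
    ... | no _        = 0
    index-≋ : ∀ {x} → x ≺ a → x ≋ nat (index x)
    index-≋ {x} p with dec (Σ[ n ∈ ℕ ] x ≋ nat n)
    ... | yes (_ , q) = q
    ... | no ¬q       = ⊥-elim (¬q (≺ω⁻ (≺-≼-trans p (proj₂ ω≋a))))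
    index-injective : ∀ {x y} → x ≺ a → y ≺ a → index x ≡ index y → x ≋ y
    index-injective p q r = ≋-trans (index-≋ p) (≋-sym (≋-trans (index-≋ q) (subst (λ n → nat n ≋ _) r ≋-refl)))

  𝟏≺ω : 𝟏 {ℓ} ≺ ω
  𝟏≺ω = ≼-≺-trans (proj₂ ω^𝟎≋𝟏) (ω^-mono-≺ (≺osuc ≼-refl))

  𝟏+≼ : {a : Ord ℓ} → ω ≼ a → 𝟏 + a ≼ a
  𝟏+≼ {a = a} p with difference p
  ... | r , a≋ = begin
    𝟏 + a            ≤⟨ +-monoʳ-≼ 𝟏 (proj₁ a≋) ⟩
    𝟏 + (ω + r)      ≈⟨ ≋-sym (+-assoc 𝟏 ω r) ⟩
    (𝟏 + ω) + r      ≤⟨ +-monoˡ-≼ r (+-least (≺⇒≼ 𝟏≺ω) λ c q → ≼-≺-trans (+≼♯ 𝟏 c) (ω^-♯-closed 𝟏 𝟏≺ω q)) ⟩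
    ω + r            ≤⟨ proj₂ a≋ ⟩
    a                ∎
    where open ≼-Reasoning

  -- The top element goes to `𝟎` and all others move up by `𝟏 +_`, which `a` absorbs since it is
  -- infinite.
  osuc-Embedding : {a : Ord ℓ} → ω ≼ a → Embedding (osuc a) a
  osuc-Embedding {ℓ} {a} ω≼a = record
    { image = s ; image-≺ = λ {x} p → s-≺ x p ; injective = λ {x} {y} p q → s-injective x y p q }
    where
    s : Ord ℓ → Ord ℓ
    s x with compare a x
    ... | inj₁ _ = 𝟎
    ... | inj₂ _ = 𝟏 + x
    s-≺ : ∀ x → x ≺ osuc a → s x ≺ a
    s-≺ x p with compare a x
    ... | inj₁ _   = ≺-≼-trans (≼-≺-trans 𝟎≼ 𝟏≺ω) ω≼a
    ... | inj₂ x≺a = ≺-≼-trans (+-monoʳ-≺ 𝟏 x≺a) (𝟏+≼ ω≼a)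
    𝟎≺𝟏+ : ∀ x → 𝟎 ≺ 𝟏 + x
    𝟎≺𝟏+ x = ≺-≼-trans (≺osuc ≼-refl) (x≼x+y 𝟏 x)
    s-injective : ∀ x y → x ≺ osuc a → y ≺ osuc a → s x ≋ s y → x ≋ y
    s-injective x y p q r with compare a x | compare a y
    ... | inj₁ a≼x | inj₁ a≼y = ≼-trans (≺osuc⁻ p) a≼y , ≼-trans (≺osuc⁻ q) a≼x
    ... | inj₁ _   | inj₂ _   = ⊥-elim (≼⇒⊁ (proj₂ r) (𝟎≺𝟏+ y))
    ... | inj₂ _   | inj₁ _   = ⊥-elim (≼⇒⊁ (proj₁ r) (𝟎≺𝟏+ x))
    ... | inj₂ _   | inj₂ _   = +-cancelˡ-≼ (proj₁ r) , +-cancelˡ-≼ (proj₂ r)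

  private
    -- Gödel's well-ordering of pairs by their maximum: its proper initial
    -- segments embed in ordinals below a, so its type is at most a.
    module Gödel {a : Ord ℓ} (ω≺a : ω ≺ a) (¬embedding : ∀ {b} → b ≺ a → ¬ Embedding a b)
                 (ih : ∀ {b} → b ≺ a → ω ≼ b → Pairing b) where

      K : Set ℓ
      K = Canonical a

      v : K → Ord ℓ
      v = ⟦ a ⟧

      _⊔_ : K → K → Ord ℓ
      x ⊔ y with compare (v x) (v y)
      ... | inj₁ _ = v y
      ... | inj₂ _ = v x

      ≼⊔ : ∀ x y → v x ≼ x ⊔ y × v y ≼ x ⊔ y
      ≼⊔ x y with compare (v x) (v y)
      ... | inj₁ p = p , ≼-refl
      ... | inj₂ p = ≼-refl , ≺⇒≼ p

      ⊔-≺ : ∀ x y → x ⊔ y ≺ a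
      ⊔-≺ x y with compare (v x) (v y)
      ... | inj₁ _ = ⟦⟧-≺ a y
      ... | inj₂ _ = ⟦⟧-≺ a x

      φ : K × K → Ord ℓ
      φ (x , y) = a · a · (x ⊔ y) + (a · v x + v y)

      inner-≺ : ∀ x y → a · v x + v y ≺ a · a
      inner-≺ x y = ·-position-≺ (⟦⟧-≺ a y) (⟦⟧-≺ a x)

      φ-injective : ∀ {z z′} → φ z ≋ φ z′ → z ≡ z′
      φ-injective {x , y} {x′ , y′} p
        with lex-injective a (⟦⟧-≺ a y) (⟦⟧-≺ a y′) (proj₂ (lex-injective (a · a) (inner-≺ x y) (inner-≺ x′ y′) p))
      ... | q , r with ⟦⟧-injective a {x} {x′} q | ⟦⟧-injective a {y} {y′} r
      ...   | refl | refl = refl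

      isTotal = Below-isTotalOrder φ φ-injective
      w = label-Wqo φ

      -- Let `b` be the larger of `ω` and the maximum of `z`. Both entries of a smaller pair are
      -- below `osuc b`, which embeds in `b`, and the pairing of `b` then embeds the segment in
      -- `b ≺ a`.
      segment : ∀ z → height w (residual (Below φ) Full z) ≺ a
      segment z@(x₀ , y₀) = ⋠⇒≻ λ a≼ → absurd a≼ (upperBound (_≺ a) ω≺a (⊔-≺ x₀ y₀))
        where
        absurd : a ≼ height w (residual (Below φ) Full z) →
                 ¬ (Σ[ b ∈ Ord ℓ ] (ω ≼ b × x₀ ⊔ y₀ ≼ b × b ≺ a))
        absurd a≼ (b , ω≼b , m≼b , b≺a) = ¬embedding b≺a
          (height-Embedding isTotal w a≼ (λ {z} p → pair-≺ (s-≺ (fst≺ {z} p)) (s-≺ (snd≺ {z} p)))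
            λ {z} {z′} p q r → inj {z} {z′} p q (pair-injective
              (s-≺ (fst≺ {z} p)) (s-≺ (snd≺ {z} p)) (s-≺ (fst≺ {z′} q)) (s-≺ (snd≺ {z′} q)) r))
          where
          open Pairing (ih b≺a ω≼b) using (pair; pair-≺) renaming (injective to pair-injective)
          open Embedding (osuc-Embedding ω≼b) renaming (image to s; image-≺ to s-≺; injective to s-injective)
          Segment : Pred (K × K) ℓ
          Segment = residual (Below φ) Full z
          max≼ : ∀ {z} → Segment z → proj₁ z ⊔ proj₂ z ≼ b
          max≼ {x , y} (_ , p) = ≼-trans (lex⁻ (a · a) (inner-≺ x₀ y₀) (≺⇒≼ (⋠⇒≻ p))) m≼b
          fst≺ : ∀ {z} → Segment z → v (proj₁ z) ≺ osuc b
          fst≺ {x , y} p = ≺osuc (≼-trans (proj₁ (≼⊔ x y)) (max≼ p))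
          snd≺ : ∀ {z} → Segment z → v (proj₂ z) ≺ osuc b
          snd≺ {x , y} p = ≺osuc (≼-trans (proj₂ (≼⊔ x y)) (max≼ p))
          inj : ∀ {z z′} → Segment z → Segment z′ →
                s (v (proj₁ z)) ≋ s (v (proj₁ z′)) × s (v (proj₂ z)) ≋ s (v (proj₂ z′)) → z ≡ z′
          inj {x , y} {x′ , y′} p q (r , t)
            with ⟦⟧-injective a {x} {x′} (s-injective (fst≺ p) (fst≺ q) r)
               | ⟦⟧-injective a {y} {y′} (s-injective (snd≺ p) (snd≺ q) t)
          ... | refl | refl = refl

      pairing : Pairing a
      pairing = record
        { pair      = pair
        ; pair-≺    = λ {x} {y} → pair-≺ x y
        ; injective = λ {x} {y} {x′} {y′} → injective x y x′ y′
        }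
        where
        pos : K × K → Ord ℓ
        pos = position isTotal w Full
        canonical : ∀ {x} → x ≺ a → K
        canonical p = proj₁ (⟦⟧-surjective a p)
        pair : Ord ℓ → Ord ℓ → Ord ℓ
        pair x y with dec (x ≺ a × y ≺ a)
        ... | yes (p , q) = pos (canonical p , canonical q)
        ... | no _        = 𝟎
        pair-≺ : ∀ x y → x ≺ a → y ≺ a → pair x y ≺ a
        pair-≺ x y p q with dec (x ≺ a × y ≺ a)
        ... | yes _ = ≺-≼-trans (position-≺-height isTotal w Full _) (height-least w λ z _ → segment z)
        ... | no ¬p = ⊥-elim (¬p (p , q))
        canonical-injective : ∀ {x y} (p : x ≺ a) (q : y ≺ a) → canonical p ≡ canonical q → x ≋ y
        canonical-injective p q eq = ≋-trans (≋-sym (proj₂ (⟦⟧-surjective a p)))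
          (≋-trans (subst (λ k → ⟦ a ⟧ (canonical p) ≋ ⟦ a ⟧ k) eq ≋-refl) (proj₂ (⟦⟧-surjective a q)))
        injective : ∀ x y x′ y′ → x ≺ a → y ≺ a → x′ ≺ a → y′ ≺ a → pair x y ≋ pair x′ y′ → x ≋ x′ × y ≋ y′
        injective x y x′ y′ p q p′ q′ r with dec (x ≺ a × y ≺ a) | dec (x′ ≺ a × y′ ≺ a)
        ... | no ¬p | _ = ⊥-elim (¬p (p , q))
        ... | yes _ | no ¬p′ = ⊥-elim (¬p′ (p′ , q′))
        ... | yes (p , q) | yes (p′ , q′) = canonical-injective p p′ (cong proj₁ eq) , canonical-injective q q′ (cong proj₂ eq)
          where eq = position-injective isTotal w Full _ _ r

  -- Gödel's ordering serves when `a` embeds in no smaller ordinal; otherwise the pairing is pulled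
  -- back from an infinite ordinal below `a`.
  infinite⇒Pairing : {a : Ord ℓ} → ω ≼ a → Pairing a
  infinite⇒Pairing {ℓ} = go (≺-wellFounded _)
    where
    go : ∀ {a : Ord ℓ} → Acc _≺_ a → ω ≼ a → Pairing a
    go {a} (acc rs) ω≼a with compare a ω
    ... | inj₁ a≼ω = ω-Pairing (ω≼a , a≼ω)
    ... | inj₂ ω≺a with dec (Σ[ b ∈ Ord ℓ ] (b ≺ a × Embedding a b))
    ...   | no ¬p = Gödel.pairing ω≺a (λ b≺a f → ¬p (_ , b≺a , f)) (λ b≺a → go (rs b≺a))
    ...   | yes (b , b≺a , f) with upperBound (_≺ a) ω≺a b≺a
    ...     | c , ω≼c , b≼c , c≺a = record
      { pair      = λ x y → pair (image x) (image y)
      ; pair-≺    = λ p q → ≺-trans (pair-≺ (into p) (into q)) c≺a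
      ; injective = λ p q p′ q′ r →
          let s , t = pair-injective (into p) (into q) (into p′) (into q′) r in injective p p′ s , injective q q′ t
      }
      where
      open Pairing (go (rs c≺a) ω≼c) using (pair; pair-≺) renaming (injective to pair-injective)
      open Embedding f
      into : ∀ {x} → x ≺ a → image x ≺ c
      into p = ≺-≼-trans (image-≺ p) b≼c

  module _ {κ : Ord ℓ} (isInfiniteCardinal : IsInfiniteCardinal κ) where

    ω≼κ : ω ≼ κ
    ω≼κ = wrap (IsInfiniteCardinal.infinite isInfiniteCardinal)

    private
      +-Embedding : {c : Ord ℓ} → ω ≼ c → Embedding (c + c) c
      +-Embedding {c} ω≼c = record { image = f ; image-≺ = f-≺ ; injective = f-injective }
        where
        open Pairing (infinite⇒Pairing ω≼c)
        𝟎≺c : 𝟎 ≺ c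
        𝟎≺c = ≺-≼-trans (𝟎≺ω^ {a = 𝟏}) ω≼c
        𝟏≺c : 𝟏 ≺ c
        𝟏≺c = ≺-≼-trans 𝟏≺ω ω≼c
        f : Ord ℓ → Ord ℓ
        f x with compare c x
        ... | inj₁ c≼x = pair 𝟏 (proj₁ (difference c≼x))
        ... | inj₂ _   = pair 𝟎 x
        rest≺ : ∀ {x} → x ≺ c + c → (c≼x : c ≼ x) → proj₁ (difference c≼x) ≺ c
        rest≺ p c≼x = +-cancelˡ-≺ (≼-≺-trans (proj₂ (proj₂ (difference c≼x))) p)
        f-≺ : ∀ {x} → x ≺ c + c → f x ≺ c
        f-≺ {x} p with compare c x
        ... | inj₁ c≼x = pair-≺ 𝟏≺c (rest≺ p c≼x)
        ... | inj₂ x≺c = pair-≺ 𝟎≺c x≺c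
        f-injective : ∀ {x y} → x ≺ c + c → y ≺ c + c → f x ≋ f y → x ≋ y
        f-injective {x} {y} p q r with compare c x | compare c y
        ... | inj₁ c≼x | inj₁ c≼y = ≋-trans (proj₂ (difference c≼x))
          (≋-trans (+-cong ≋-refl (proj₂ (injective 𝟏≺c (rest≺ p c≼x) 𝟏≺c (rest≺ q c≼y) r)))
                   (≋-sym (proj₂ (difference c≼y))))
        ... | inj₁ c≼x | inj₂ y≺c = ⊥-elim (≼⇒⊁ (proj₁ (proj₁ (injective 𝟏≺c (rest≺ p c≼x) 𝟎≺c y≺c r))) (≺osuc ≼-refl))
        ... | inj₂ x≺c | inj₁ c≼y = ⊥-elim (≼⇒⊁ (proj₂ (proj₁ (injective 𝟎≺c x≺c 𝟏≺c (rest≺ q c≼y) r))) (≺osuc ≼-refl))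
        ... | inj₂ x≺c | inj₂ y≺c = proj₂ (injective 𝟎≺c x≺c 𝟎≺c y≺c r)

      +-closed : ω ≺ κ → ∀ {a b} → a ≺ κ → b ≺ κ → a + b ≺ κ
      +-closed ω≺κ {a} {b} a≺κ b≺κ with upperBound (_≺ κ) a≺κ b≺κ
      ... | c , a≼c , b≼c , c≺κ with upperBound (_≺ κ) ω≺κ c≺κ
      ...   | d , ω≼d , c≼d , d≺κ = ⋠⇒≻ λ κ≼a+b → ¬Embedding-below isInfiniteCardinal d≺κ
        let open Embedding (+-Embedding ω≼d)
            into : ∀ {x} → x ≺ κ → x ≺ d + d
            into = λ p → ≺-≼-trans p (≼-trans κ≼a+b (+-mono-≼ (≼-trans a≼c c≼d) (≼-trans b≼c c≼d)))
        in record { image = image ; image-≺ = λ p → image-≺ (into p) ; injective = λ p q → injective (into p) (into q) }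

    -- Otherwise `κ` exceeds its leading power `ω^ e` but not every finite multiple of it, against
    -- its closure under sums. Closure rests on embedding `d + d` in an infinite `d ≺ κ`, so `ω` is
    -- treated apart.
    infiniteCardinal≋ω^ : Σ[ k ∈ Ord ℓ ] κ ≋ ω^ k
    infiniteCardinal≋ω^ with compare κ ω
    ... | inj₁ κ≼ω = 𝟏 , κ≼ω , ω≼κ
    ... | inj₂ ω≺κ with normalForm κ
    ...   | [] , _ , κ≋ = ⊥-elim (⊀𝟎 (≺-≼-trans ω≺κ (proj₂ κ≋)))
    ...   | e ∷ es , (p ∷ _) , κ≋ with compare κ (ω^ e)
    ...     | inj₁ κ≼ω^e = e , κ≼ω^e , ≼-trans (x≼x+y (ω^ e) (∑ ω^_ es)) (proj₁ κ≋)
    ...     | inj₂ ω^e≺κ = ⊥-elim (≼⇒⊁ (≼-trans (proj₂ κ≋) (∑ω^-bound id (≼-refl ∷ p))) (multiple (length (e ∷ es))))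
      where
      multiple : ∀ n → ω^ e ·ℕ n ≺ κ
      multiple zero    = ≼-≺-trans 𝟎≼ ω≺κ
      multiple (suc n) = +-closed ω≺κ ω^e≺κ (multiple n)

-- The upper bound for intersections

module UpperBounds (em : ∀ {a} → ExcludedMiddle a) (ext : ∀ {a b} → Extensionality a b) where

  open NaturalSums em
  open Heights em
  open LinearExtensions em
  open Cardinals em ext

  private
    variable
      X : Set ℓ
      n : ℕ

  -- Lengths

  module _ {X : Set ℓ} (enum : X → Ord ℓ) (enum-injective : ∀ {x y} → enum x ≋ enum y → x ≡ y)
           {S : Rel X ℓ} (w : Wqo S) where

    abstract
      maximalWellOrder : IsPartialOrder _≡_ S →
        Σ[ L ∈ Rel X ℓ ] Σ[ a ∈ Ord ℓ ] (IsLinearExtension S L × IsWellOrderOfType L a × height w Full ≼ a)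
      maximalWellOrder po = Below label , orderType _ wf , (isTotal , λ {x} {y} → monotone {x} {y} _ _) ,
        record { isTotalOrder = isTotal ; wellFounded = wf ; type = ≤-refl _ , ≤-refl _ } ,
        ≼-trans long (proj₂ (orderType≋height isTotal (label-Wqo label) wf))
        where
        open MaximalLinearExtension po w enum enum-injective
        open LinearExtension (maximalLinearExtension Full)
        isTotal : IsTotalOrder _≡_ (Below label)
        isTotal = Below-isTotalOrder label (injective _ _)
        wf : WellFounded (Strict (Below label))
        wf = IsWPO.wellFounded (Wqo⇒IsWPO (IsTotalOrder.isPartialOrder isTotal) (label-Wqo label))

    -- The hypothesis concerns types of linear extensions; by de Jongh and Parikh one of these types
    -- reaches the height.
    height-bound : {a : Ord ℓ} → IsWPOOfLengthAtMost S a → height w Full ≼ a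
    height-bound l with maximalWellOrder (IsWPO.isPartialOrder (IsWPOOfLengthAtMost.isWPO l))
    ... | L , b , extension , ordered , ≼b = ≼-trans ≼b (wrap (IsWPOOfLengthAtMost.bound l L b extension ordered))

    attainedLength : {a : Ord ℓ} → IsWPOOfLengthAtMost S a → a ≼ height w Full → IsWPOOfLength S a
    attainedLength l a≼ with maximalWellOrder (IsWPO.isPartialOrder (IsWPOOfLengthAtMost.isWPO l))
    ... | L , b , extension , ordered , ≼b = record
      { atMost   = l
      ; attained = L , extension , record
        { isTotalOrder = isTotalOrder
        ; wellFounded  = wellFounded
        ; type         = ≋⇒≈ (≋-trans (≈⇒≋ type)
            (wrap (IsWPOOfLengthAtMost.bound l L b extension ordered) , ≼-trans a≼ ≼b))
        }
      }
      where open IsWellOrderOfType ordered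

  -- Finite families

  ♯[]-mono-≼ : {n : ℕ} {u v : Fin n → Ord ℓ} → (∀ i → u i ≼ v i) → ♯[ u ] ≼ ♯[ v ]
  ♯[]-mono-≼ {n = zero}  p = ≼-refl
  ♯[]-mono-≼ {n = suc n} p = ♯-mono-≼ (p zero) (♯[]-mono-≼ (p ∘ suc))

  ♯[]-mono-≺ : {n : ℕ} {u v : Fin n → Ord ℓ} (i : Fin n) → (∀ j → u j ≼ v j) → u i ≺ v i → ♯[ u ] ≺ ♯[ v ]
  ♯[]-mono-≺ {n = suc n} zero    p q = ≼-≺-trans (♯-monoʳ-≼ _ (♯[]-mono-≼ (p ∘ suc))) (♯-monoˡ-≺ _ q)
  ♯[]-mono-≺ {n = suc n} (suc i) p q = ≼-≺-trans (♯-monoˡ-≼ _ (p zero)) (♯-monoʳ-≺ _ (♯[]-mono-≺ i (p ∘ suc) q))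

  _[_↦_] : {A : Set p} → (Fin n → A) → Fin n → A → Fin n → A
  u [ i ↦ c ] = updateAt u i (const c)

  updated : {A : Set p} (P : Fin n → A → Set ℓ) {u : Fin n → A} (i : Fin n) {c : A} →
            P i c → (∀ j → j ≢ i → P j (u j)) → ∀ j → P j ((u [ i ↦ c ]) j)
  updated P {u} i pc pu j with j ≟ i
  ... | yes refl = subst (P j) (sym (updateAt-updates j u)) pc
  ... | no j≢i   = subst (P j) (sym (updateAt-minimal j i u j≢i)) (pu j j≢i)

  updated-≺ : {u : Fin n → Ord ℓ} (i : Fin n) {c : Ord ℓ} → c ≺ u i → ♯[ u [ i ↦ c ] ] ≺ ♯[ u ]
  updated-≺ {u = u} i {c} c≺ = ♯[]-mono-≺ i
    (updated (λ j d → d ≼ u j) i (≺⇒≼ c≺) (λ _ _ → ≼-refl))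
    (subst (_≺ u i) (sym (updateAt-updates i u)) c≺)

  finite-∪ : {X : Set ℓ} (Q : Pred X ℓ → Set p) →
    (∀ {Y} → (∀ {x} → ¬ Y x) → Q Y) → (∀ {Y A B} → Y ⊆ A ∪ B → Q A → Q B → Q Y) →
    {n : ℕ} (A : Fin n → Pred X ℓ) → (∀ i → Q (A i)) → ∀ {Y} → (∀ {x} → Y x → Σ[ i ∈ Fin n ] A i x) → Q Y
  finite-∪ Q empty union {zero}  A q Y⊆ = empty λ x∈Y → case (Y⊆ x∈Y)
    where
    case : ∀ {x} → ¬ (Σ[ i ∈ Fin 0 ] A i x)
    case (() , _)
  finite-∪ Q empty union {suc n} A q Y⊆ = union
    (λ x∈Y → case (Y⊆ x∈Y)) (q zero) (finite-∪ Q empty union (A ∘ suc) (q ∘ suc) id)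
    where
    case : ∀ {x} → Σ[ i ∈ Fin (suc n) ] A i x → A zero x ⊎ (Σ[ i ∈ Fin n ] A (suc i) x)
    case (zero , x∈A)  = inj₁ x∈A
    case (suc i , x∈A) = inj₂ (i , x∈A)

  ≺♯[]⁻ : {n : ℕ} {u : Fin n → Ord ℓ} {a : Ord ℓ} → a ≺ ♯[ u ] →
          Σ[ i ∈ Fin n ] Σ[ c ∈ Ord ℓ ] (c ≺ u i × a ≼ ♯[ u [ i ↦ c ] ])
  ≺♯[]⁻ {n = zero}  p = ⊥-elim (⊀𝟎 p)
  ≺♯[]⁻ {n = suc n} p with ≺♯⁻ p
  ... | inj₁ (c , c≺ , q) = zero , c , c≺ , q
  ... | inj₂ (d , d≺ , q) with ≺♯[]⁻ {n = n} d≺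
  ...   | i , c , c≺ , r = suc i , c , c≺ , ≼-trans q (♯-monoʳ-≼ _ r)

  ¬∀⇒∃¬ : {n : ℕ} {P : Fin n → Set ℓ} → ¬ (∀ i → P i) → Σ[ i ∈ Fin n ] ¬ P i
  ¬∀⇒∃¬ {n = n} {P} ¬p with dec (Σ[ i ∈ Fin n ] ¬ P i)
  ... | yes q = q
  ... | no ¬q = ⊥-elim (¬p λ i → stable i (dec (P i)))
    where
    stable : ∀ i → Dec (P i) → P i
    stable i (yes p) = p
    stable i (no ¬p) = ⊥-elim (¬q (i , ¬p))

  -- Induction on the natural sum of the heights: what is not above `x` in the intersection lies in
  -- the residual of some `S i`, where the `i`-th height has dropped.
  ⋂-Wqo : {X : Set ℓ} {S : Fin n → Rel X ℓ} → (∀ i → Wqo (S i)) → Wqo (⋂ S)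
  ⋂-Wqo {n = n} {S = S} w Y = go Y (≺-wellFounded _)
    where
    go : ∀ Y → Acc _≺_ ♯[ (λ i → height (w i) Y) ] → Bar (⋂ S) Y
    go Y (acc rs) = bar λ x x∈Y → finite-∪ (Bar (⋂ S))
      (λ empty → bar λ y y∈ → ⊥-elim (empty y∈)) (λ Y⊆ a b → ∪-Bar a b Y⊆)
      (λ i → residual (S i) Y x)
      (λ i → go _ (rs (♯[]-mono-≺ i (λ j → height-⊆ (w j) proj₁) (height-residual (w i) x∈Y))))
      λ (y∈Y , ¬Sxy) → let i , ¬Sᵢxy = ¬∀⇒∃¬ ¬Sxy in i , y∈Y , ¬Sᵢxy

  -- Multiples of an infinite cardinal

  module _ {κ : Ord ℓ} (isInfiniteCardinal : IsInfiniteCardinal κ) where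

    private
      k : Ord ℓ
      k = proj₁ (infiniteCardinal≋ω^ isInfiniteCardinal)

      κ≋ : κ ≋ ω^ k
      κ≋ = proj₂ (infiniteCardinal≋ω^ isInfiniteCardinal)

    κ·ω^≋ω^ : ∀ e → κ · ω^ e ≋ ω^ (k + e)
    κ·ω^≋ω^ e = ≋-trans (·-monoˡ-≼ (ω^ e) (proj₁ κ≋) , ·-monoˡ-≼ (ω^ e) (proj₂ κ≋)) (≋-sym (ω^-distrib-+ k e))

    κ·ω^-♯-closed : ∀ e → ♯-Closed (κ · ω^ e)
    κ·ω^-♯-closed e p q = ≺-≼-trans
      (ω^-♯-closed (k + e) (≺-≼-trans p (proj₁ (κ·ω^≋ω^ e))) (≺-≼-trans q (proj₁ (κ·ω^≋ω^ e))))
      (proj₂ (κ·ω^≋ω^ e))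

    ⨁κω^≋∑κω^ : {A : Set p} (f : A → Ord ℓ) {xs : List A} → Descending f xs →
                ⨁ (λ x → κ · ω^ f x) xs ≋ ∑ (λ x → κ · ω^ f x) xs
    ⨁κω^≋∑κω^ f {xs} desc = begin-equality
      ⨁ (λ x → κ · ω^ f x) xs     ≈⟨ ⨁-cong (κ·ω^≋ω^ ∘ f) xs ⟩
      ⨁ (λ x → ω^ (k + f x)) xs   ≈⟨ ⨁≋∑ (λ x → k + f x) (AllPairs.map (+-monoʳ-≼ k) desc) ⟩
      ∑ (λ x → ω^ (k + f x)) xs   ≈⟨ ∑-cong (≋-sym ∘ κ·ω^≋ω^ ∘ f) xs ⟩
      ∑ (λ x → κ · ω^ f x) xs     ∎
      where open ≼-Reasoning

    -- `κ ·_` distributes over ordinary sums, so the terms are sorted first; afterwards the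
    -- exponents `k + f x` descend as well, and the natural sum returns.
    κ·⨁ω^ : {A : Set p} (f : A → Ord ℓ) (xs : List A) → κ · ⨁ (ω^_ ∘ f) xs ≋ ⨁ (λ x → κ · ω^ f x) xs
    κ·⨁ω^ f xs with descend f xs
    ... | ys , xs↭ys , desc = begin-equality
      κ · ⨁ (ω^_ ∘ f) xs          ≈⟨ ·-cong κ (≋-trans (⨁-↭ _ xs↭ys) (⨁≋∑ f desc)) ⟩
      κ · ∑ (ω^_ ∘ f) ys          ≈⟨ ·-distribˡ-∑ κ (ω^_ ∘ f) ys ⟩
      ∑ (λ x → κ · ω^ f x) ys     ≈⟨ ≋-sym (⨁κω^≋∑κω^ f desc) ⟩
      ⨁ (λ x → κ · ω^ f x) ys     ≈⟨ ≋-sym (⨁-↭ _ xs↭ys) ⟩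
      ⨁ (λ x → κ · ω^ f x) xs     ∎
      where open ≼-Reasoning

    κ·⨂ : {A : Set p} {n : ℕ} (q : Fin n → Ord ℓ) (f : A → Ord ℓ) (xs : Fin n → List A) →
          (∀ i → map f (xs i) ≡ cnf (q i)) → κ · ⨂ em q ≋ ⨁ (λ v → κ · ω^ ♯[ f ∘ v ]) (choices xs)
    κ·⨂ q f xs eq = ≋-trans (·-cong κ (⨂≋⨁-choices q f xs eq)) (κ·⨁ω^ (λ v → ♯[ f ∘ v ]) (choices xs))

    𝟎≺κ : 𝟎 ≺ κ
    𝟎≺κ = ≺-≼-trans (𝟎≺ω^ {a = 𝟏}) (ω≼κ isInfiniteCardinal)

    κ≼κ·ω^ : ∀ e → κ ≼ κ · ω^ e
    κ≼κ·ω^ e = ≼-trans (proj₂ (·-𝟏 κ)) (·-monoʳ-≼ κ (osuc≼ (𝟎≺ω^ {a = e})))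

    module UpperBound {X : Set ℓ} (enum : X → Ord ℓ) (enum-injective : ∀ {x y} → enum x ≋ enum y → x ≡ y)
      {L : Rel X ℓ} (L-isTotal : IsTotalOrder _≡_ L) (wL : Wqo L) where

      module _ {S : Rel X ℓ} (po : IsPartialOrder _≡_ S) (w : Wqo S) where

        -- Positions in a linear extension of `S` inject `Z` into an ordinal below `κ`. Only
        -- cardinality passes from there to `L`, which is why `κ` must be a cardinal.
        small⇒small : ∀ {Z} → height w Z ≺ κ → height wL Z ≺ κ
        small⇒small {Z} Z≺κ = small-height isInfiniteCardinal L-isTotal wL Z≺κ
          (λ x∈Z → ≺-≼-trans (position-≺-height isTotal wφ Z x∈Z)
                              (height-mono w wφ id λ x∈Z y∈Z → monotone x∈Z y∈Z))
          (position-injective isTotal wφ Z)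
          where
          E = MaximalLinearExtension.linearExtension po w enum enum-injective {Full}
          φ = MaximalLinearExtension.LinearExtension.label E
          monotone : ∀ {x y} → Z x → Z y → S x y → φ x ≼ φ y
          monotone _ _ = MaximalLinearExtension.LinearExtension.monotone E _ _
          isTotal = Below-isTotalOrder φ (MaximalLinearExtension.LinearExtension.injective E _ _)
          wφ = label-Wqo φ

      module _ {n : ℕ} {S : Fin n → Rel X ℓ} (po : ∀ i → IsPartialOrder _≡_ (S i)) (w : ∀ i → Wqo (S i))
               (extends : ∀ {x y} → (∀ i → S i x y) → L x y) where

        indecomposableBound : (e : Fin n → Ord ℓ) {Y : Pred X ℓ} → Acc _≺_ ♯[ e ] →
          (∀ i → height (w i) Y ≼ κ · ω^ e i) → height wL Y ≼ κ · ω^ ♯[ e ]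
        indecomposableBound e {Y} (acc rs) Y≼ = height-least wL λ x x∈Y → finite-∪ Q
          (λ empty → ≼-≺-trans (height-least wL λ y y∈ → ⊥-elim (empty y∈)) 𝟎≺)
          Q-∪
          (λ i → residual (S i) Y x)
          (λ i → residual-Q i (≺-≼-trans (height-residual (w i) x∈Y) (Y≼ i)))
          λ (y∈Y , ¬Lxy) → let i , ¬Sxy = ¬∀⇒∃¬ (λ Sxy → ¬Lxy (extends Sxy)) in i , y∈Y , ¬Sxy
          where
          Q : Pred X ℓ → Set ℓ
          Q Z = height wL Z ≺ κ · ω^ ♯[ e ]
          Q-∪ : ∀ {Z A B} → Z ⊆ A ∪ B → Q A → Q B → Q Z
          Q-∪ Z⊆ a b = ≼-≺-trans (height-∪ wL Z⊆) (κ·ω^-♯-closed ♯[ e ] a b)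
          𝟎≺ : 𝟎 ≺ κ · ω^ ♯[ e ]
          𝟎≺ = ≺-≼-trans 𝟎≺κ (κ≼κ·ω^ ♯[ e ])
          small-Q : ∀ i {Z} → height (w i) Z ≺ κ → Q Z
          small-Q i Z≺κ = ≺-≼-trans (small⇒small (po i) (w i) Z≺κ) (κ≼κ·ω^ ♯[ e ])
          multiple-Q : ∀ i {c} → c ≺ e i → ∀ m {Z} → Z ⊆ Y → height (w i) Z ≼ (κ · ω^ c) ·ℕ m → Q Z
          multiple-Q i c≺ zero    Z⊆Y Z≼ = small-Q i (≼-≺-trans Z≼ 𝟎≺κ)
          multiple-Q i {c} c≺ (suc m) Z⊆Y Z≼ with split (w i) (IsPartialOrder.trans (po i)) Z≼
          ... | D , U , Z⊆D∪U , D⊆Z , U⊆Z , D≼ , U≼ = Q-∪ Z⊆D∪U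
            (≼-≺-trans
              (indecomposableBound (e [ i ↦ c ]) (rs (updated-≺ i c≺))
                (updated (λ j d → height (w j) D ≼ κ · ω^ d) i D≼
                         λ j _ → ≼-trans (height-⊆ (w j) (Z⊆Y ∘ D⊆Z)) (Y≼ j)))
              (·-monoʳ-≺ κ 𝟎≺κ (ω^-mono-≺ (updated-≺ i c≺))))
            (multiple-Q i c≺ m (Z⊆Y ∘ U⊆Z) U≼)
          -- With height at most `κ · d + r`, the part of height `κ · d` is cut into pieces of
          -- smaller exponent; the part of height `r ≺ κ` is small.
          residual-Q : ∀ i {x} → height (w i) (residual (S i) Y x) ≺ κ · ω^ e i → Q (residual (S i) Y x)
          residual-Q i p with ≺·⁻ p
          ... | d , r , d≺ , r≺κ , q with split (w i) (IsPartialOrder.trans (po i)) q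
          ...   | D , U , ⊆D∪U , D⊆ , U⊆ , D≼ , U≼ = Q-∪ ⊆D∪U (initial-Q (≺ω^⁻ d≺)) (small-Q i (≼-≺-trans U≼ r≺κ))
            where
            initial-Q : d ≼ 𝟎 ⊎ (Σ[ c ∈ Ord ℓ ] (c ≺ e i × Σ[ m ∈ ℕ ] d ≼ ω^ c ·ℕ m)) → Q D
            initial-Q (inj₁ d≼𝟎) = small-Q i
              (≼-≺-trans (≼-trans D≼ (≼-trans (·-monoʳ-≼ κ d≼𝟎) (proj₁ (·-zeroʳ κ)))) 𝟎≺κ)
            initial-Q (inj₂ (c , c≺ , m , d≼)) = multiple-Q i c≺ m (proj₁ ∘ D⊆)
              (≼-trans D≼ (≼-trans (·-monoʳ-≼ κ d≼) (proj₁ (·-distribˡ-·ℕ κ (ω^ c) m))))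

      -- Cuts along the sum of the first coordinate and treats the others inside each part. `G` is a
      -- parameter so that it can absorb the exponents chosen already.
      choicesBound : {n : ℕ} {S : Fin n → Rel X ℓ} → (∀ i → Transitive (S i)) → (w : ∀ i → Wqo (S i)) →
        (G : (Fin n → Ord ℓ) → Ord ℓ) (xs : Fin n → List (Ord ℓ)) {Y : Pred X ℓ} →
        (∀ {Z} v → Z ⊆ Y → (∀ i → height (w i) Z ≼ κ · ω^ v i) → height wL Z ≼ G v) →
        (∀ i → height (w i) Y ≼ κ · ∑ ω^_ (xs i)) → height wL Y ≼ ⨁ G (choices xs)
      choicesBound {zero}      tr w G xs     bound Y≼ = ≼-trans (bound _ id λ ()) (x≼x♯y _ _)
      choicesBound {suc n} {S} tr w G xs {Y} bound Y≼ = go (xs zero) id (Y≼ zero)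
        where
        vs = choices (xs ∘ suc)
        go : ∀ es {Z} → Z ⊆ Y → height (w zero) Z ≼ κ · ∑ ω^_ es →
             height wL Z ≼ ⨁ G (cartesianProductWith Vector._∷_ es vs)
        go [] Z⊆Y Z≼ = height-least wL λ z z∈Z → ⊥-elim (⊀𝟎
          (≺-≼-trans (height-inhabited (w zero) z∈Z) (≼-trans Z≼ (proj₁ (·-zeroʳ κ)))))
        go (e ∷ es) Z⊆Y Z≼ with split (w zero) (tr zero) (≼-trans Z≼ (proj₁ (·-distribˡ-+ κ (ω^ e) (∑ ω^_ es))))
        ... | D , U , Z⊆ , D⊆Z , U⊆Z , D≼ , U≼ = begin
          height wL _                                    ≤⟨ height-∪ wL Z⊆ ⟩
          height wL D ♯ height wL U                      ≤⟨ ♯-mono-≼ first (go es (Z⊆Y ∘ U⊆Z) U≼) ⟩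
          ⨁ (G ∘ (e Vector.∷_)) vs ♯ ⨁ G rest            ≈⟨ ♯-cong (≋-sym (⨁-map G (e Vector.∷_) vs)) ≋-refl ⟩
          ⨁ G (map (e Vector.∷_) vs) ♯ ⨁ G rest          ≈⟨ ≋-sym (⨁-++ G (map (e Vector.∷_) vs) rest) ⟩
          ⨁ G (cartesianProductWith Vector._∷_ (e ∷ es) vs) ∎
          where
          open ≼-Reasoning
          rest = cartesianProductWith Vector._∷_ es vs
          first : height wL D ≼ ⨁ (G ∘ (e Vector.∷_)) vs
          first = choicesBound (tr ∘ suc) (w ∘ suc) (G ∘ (e Vector.∷_)) (xs ∘ suc)
            (λ v Z′⊆D Z′≼ → bound (e Vector.∷ v) (Z⊆Y ∘ D⊆Z ∘ Z′⊆D)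
              λ { zero → ≼-trans (height-⊆ (w zero) Z′⊆D) D≼ ; (suc i) → Z′≼ i })
            λ i → ≼-trans (height-⊆ (w (suc i)) (Z⊆Y ∘ D⊆Z)) (Y≼ (suc i))

      upperBound-⨂ : {n : ℕ} {S : Fin n → Rel X ℓ} (po : ∀ i → IsPartialOrder _≡_ (S i)) (w : ∀ i → Wqo (S i))
        (extends : ∀ {x y} → (∀ i → S i x y) → L x y) (q : Fin n → Ord ℓ) →
        (∀ i → height (w i) Full ≼ κ · q i) → height wL Full ≼ κ · ⨂ em q
      upperBound-⨂ po w extends q X≼ = ≼-trans
        (choicesBound (λ i → IsPartialOrder.trans (po i)) w (λ v → κ · ω^ ♯[ v ]) (cnf ∘ q)
          (λ v _ → indecomposableBound po w extends v (≺-wellFounded ♯[ v ]))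
          λ i → ≼-trans (X≼ i) (·-monoʳ-≼ κ (proj₂ (cnf-denotes (q i)))))
        (proj₂ (κ·⨂ q id (cnf ∘ q) λ i → map-id (cnf (q i))))

    module _ {X : Set ℓ} (enum : X → Ord ℓ) (enum-injective : ∀ {x y} → enum x ≋ enum y → x ≡ y) where

      intersection-length : {n : ℕ} (q : Fin n → Ord ℓ) {R : Rel X ℓ} → IsPartialOrder _≡_ R →
        {S : Fin n → Rel X ℓ} → R ⇔ ⋂ S → (∀ i → IsWPOOfLengthAtMost (S i) (κ · q i)) →
        IsWPOOfLengthAtMost R (κ · ⨂ em q)
      intersection-length q {R} R-po {S} (R⇒⋂S , ⋂S⇒R) l = record
        { isWPO = Wqo⇒IsWPO R-po wR
        ; bound = λ L a (isTotal , R⇒L) L-type →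
            let open IsWellOrderOfType L-type
                wL : Wqo L
                wL Y = Bar-mono id (λ _ _ → R⇒L) (wR Y)
            in unwrap≼ (≼-trans (wrap (proj₂ type)) (≼-trans (proj₁ (orderType≋height isTotal wL wellFounded))
                 (UpperBound.upperBound-⨂ enum enum-injective isTotal wL po w (R⇒L ∘ ⋂S⇒R) q
                   λ i → height-bound enum enum-injective (w i) (l i))))
        }
        where
        po : ∀ i → IsPartialOrder _≡_ (S i)
        po i = IsWPO.isPartialOrder (IsWPOOfLengthAtMost.isWPO (l i))
        w : ∀ i → Wqo (S i)
        w i = IsWPO⇒Wqo (IsWPOOfLengthAtMost.isWPO (l i))
        wR : Wqo R
        wR Y = Bar-mono id (λ _ _ → ⋂S⇒R) (⋂-Wqo w Y)

-- Well orders attaining the bound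

module ExtremalFamilies (em : ∀ {a} → ExcludedMiddle a) (ext : ∀ {a b} → Extensionality a b) where

  open NaturalSums em
  open Heights em
  open LinearExtensions em
  open Cardinals em ext
  open UpperBounds em ext

  private
    variable
      A B C : Set p

  -- Coordinates of the elements of a cardinal

  module _ {κ : Ord ℓ} (isInfiniteCardinal : IsInfiniteCardinal κ) where

    open Pairing (infinite⇒Pairing (ω≼κ isInfiniteCardinal)) using (pair; pair-≺)
      renaming (injective to pair-injective)

    private
      code : {n : ℕ} → (Fin n → Ord ℓ) → Ord ℓ
      code {zero}  v = 𝟎
      code {suc n} v = pair (v zero) (code (v ∘ suc))

      code-≺ : {n : ℕ} {v : Fin n → Ord ℓ} → (∀ i → v i ≺ κ) → code v ≺ κ
      code-≺ {zero}  v≺ = 𝟎≺κ isInfiniteCardinal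
      code-≺ {suc n} v≺ = pair-≺ (v≺ zero) (code-≺ (v≺ ∘ suc))

      code-injective : {n : ℕ} {u v : Fin n → Ord ℓ} → (∀ i → u i ≺ κ) → (∀ i → v i ≺ κ) →
                       code u ≋ code v → ∀ i → u i ≋ v i
      code-injective {suc n} u≺ v≺ p i
        with pair-injective (u≺ zero) (code-≺ (u≺ ∘ suc)) (v≺ zero) (code-≺ (v≺ ∘ suc)) p
      code-injective {suc n} u≺ v≺ p zero    | q , _ = q
      code-injective {suc n} u≺ v≺ p (suc i) | _ , r = code-injective (u≺ ∘ suc) (v≺ ∘ suc) r i

      atMost⇒Embedding : {a : Ord ℓ} → CardinalityAtMost a κ → Embedding a κ
      atMost⇒Embedding {a} inj = record
        { image     = f
        ; image-≺   = λ {x} → f-≺ x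
        ; injective = λ {x} {y} → f-injective x y
        }
        where
        open Injection inj
        f : Ord ℓ → Ord ℓ
        f x with dec (x ≺ a)
        ... | yes p = proj₁ (to (x , unwrap≺ p))
        ... | no  _ = 𝟎
        f-≺ : ∀ x → x ≺ a → f x ≺ κ
        f-≺ x p with dec (x ≺ a)
        ... | yes q = wrap (proj₂ (to (x , unwrap≺ q)))
        ... | no ¬q = ⊥-elim (¬q p)
        f-injective : ∀ x y → x ≺ a → y ≺ a → f x ≋ f y → x ≋ y
        f-injective x y p q r with dec (x ≺ a) | dec (y ≺ a)
        ... | yes _ | yes _ = ≈⇒≋ (injective (≋⇒≈ r))
        ... | yes _ | no ¬q = ⊥-elim (¬q q)
        ... | no ¬p | _     = ⊥-elim (¬p p)

    module Coordinates {n : ℕ} {q : Fin n → Ord ℓ} (𝟎≺q : ∀ i → 𝟎 ≺ q i)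
                       (q≤κ : ∀ i → CardinalityAtMost (q i) κ) where

      X : Set ℓ
      X = Canonical κ

      private
        index : (i : Fin n) → Embedding (q i) κ
        index i = atMost⇒Embedding (q≤κ i)

        Admissible : (Fin n → Ord ℓ) → Set ℓ
        Admissible c = ∀ i → c i ≺ q i

        indices : (Fin n → Ord ℓ) → Fin n → Ord ℓ
        indices c i = Embedding.image (index i) (c i)

        indices-≺ : ∀ {c} → Admissible c → ∀ i → indices c i ≺ κ
        indices-≺ c≺q i = Embedding.image-≺ (index i) (c≺q i)

        -- The free entry `t` ranges over all of `κ`, which gives each fibre `κ` elements.
        address : Ord ℓ → (Fin n → Ord ℓ) → Ord ℓ
        address t c = pair t (code (indices c))

        address-≺ : ∀ {t c} → t ≺ κ → Admissible c → address t c ≺ κ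
        address-≺ t≺κ c≺q = pair-≺ t≺κ (code-≺ (indices-≺ c≺q))

        address-injective : ∀ {s t c d} → s ≺ κ → t ≺ κ → Admissible c → Admissible d →
                            address s c ≋ address t d → s ≋ t × (∀ i → c i ≋ d i)
        address-injective s≺κ t≺κ c≺q d≺q p
          with pair-injective s≺κ (code-≺ (indices-≺ c≺q)) t≺κ (code-≺ (indices-≺ d≺q)) p
        ... | r , r′ = r , λ i → Embedding.injective (index i) (c≺q i) (d≺q i)
          (code-injective (indices-≺ c≺q) (indices-≺ d≺q) r′ i)

        HasAddress : X → Ord ℓ → (Fin n → Ord ℓ) → Set ℓ
        HasAddress x t c = t ≺ κ × Admissible c × ⟦ κ ⟧ x ≋ address t c

      coordinate : X → Fin n → Ord ℓ
      coordinate x with dec (Σ[ t ∈ Ord ℓ ] Σ[ c ∈ (Fin n → Ord ℓ) ] HasAddress x t c)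
      ... | yes (_ , c , _) = c
      -- Elements of `κ` that are no address get coordinates `𝟎`, admissible because the `q i` are
      -- non-zero.
      ... | no _            = λ _ → 𝟎

      coordinate-≺ : ∀ x i → coordinate x i ≺ q i
      coordinate-≺ x with dec (Σ[ t ∈ Ord ℓ ] Σ[ c ∈ (Fin n → Ord ℓ) ] HasAddress x t c)
      ... | yes (_ , _ , _ , c≺q , _) = c≺q
      ... | no _                      = 𝟎≺q

      private
        coordinate-address : ∀ {x t c} → HasAddress x t c → ∀ i → coordinate x i ≋ c i
        coordinate-address {x} {t} {c} (t≺κ , c≺q , eq)
          with dec (Σ[ t ∈ Ord ℓ ] Σ[ c ∈ (Fin n → Ord ℓ) ] HasAddress x t c)
        ... | no ¬p = ⊥-elim (¬p (t , c , t≺κ , c≺q , eq))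
        ... | yes (s , d , s≺κ , d≺q , eq′) =
          proj₂ (address-injective s≺κ t≺κ d≺q c≺q (≋-trans (≋-sym eq′) eq))

      Fibre : (Fin n → Ord ℓ) → Pred X ℓ
      Fibre c x = ∀ i → coordinate x i ≋ c i

      -- Sending `t` to the position of its address would embed `κ` in the height of the fibre, if
      -- that were below `κ`.
      κ≼Fibre : ∀ {c} → (∀ i → c i ≺ q i) → κ ≼ labelHeight ⟦ κ ⟧ (Fibre c)
      κ≼Fibre {c} c≺q = ⊀⇒≽ λ small → ¬Embedding-below isInfiniteCardinal small record
        { image     = f
        ; image-≺   = λ {t} → f-≺ t
        ; injective = λ {s} {t} → f-injective s t
        }
        where
        isTotal = Below-isTotalOrder ⟦ κ ⟧ λ {x} {y} → ⟦⟧-injective κ {x} {y}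
        w = label-Wqo ⟦ κ ⟧
        element : ∀ {t} → t ≺ κ → Σ[ x ∈ X ] ⟦ κ ⟧ x ≋ address t c
        element t≺κ = ⟦⟧-surjective κ (address-≺ t≺κ c≺q)
        element∈Fibre : ∀ {t} (t≺κ : t ≺ κ) → Fibre c (proj₁ (element t≺κ))
        element∈Fibre t≺κ = coordinate-address (t≺κ , c≺q , proj₂ (element t≺κ))
        f : Ord ℓ → Ord ℓ
        f t with dec (t ≺ κ)
        ... | yes t≺κ = position isTotal w (Fibre c) (proj₁ (element t≺κ))
        ... | no _    = 𝟎
        f-≺ : ∀ t → t ≺ κ → f t ≺ height w (Fibre c)
        f-≺ t p with dec (t ≺ κ)
        ... | yes t≺κ = position-≺-height isTotal w (Fibre c) (element∈Fibre t≺κ)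
        ... | no ¬p   = ⊥-elim (¬p p)
        f-injective : ∀ s t → s ≺ κ → t ≺ κ → f s ≋ f t → s ≋ t
        f-injective s t p q r with dec (s ≺ κ) | dec (t ≺ κ)
        ... | no ¬p   | _       = ⊥-elim (¬p p)
        ... | yes _   | no ¬q   = ⊥-elim (¬q q)
        ... | yes s≺κ | yes t≺κ = proj₁ (address-injective s≺κ t≺κ c≺q c≺q
          (≋-trans (≋-sym (proj₂ (element s≺κ))) (≋-trans
            (subst (λ x → ⟦ κ ⟧ (proj₁ (element s≺κ)) ≋ ⟦ κ ⟧ x) same ≋-refl) (proj₂ (element t≺κ)))))
          where
          same : proj₁ (element s≺κ) ≡ proj₁ (element t≺κ)
          same = position-injective isTotal w (Fibre c) (element∈Fibre s≺κ) (element∈Fibre t≺κ) r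

  -- Pieces of a Cantor normal form

  -- A piece (a , e) stands for the interval from a to a + ω^ e.
  pieces : Ord ℓ → List (Ord ℓ) → List (Ord ℓ × Ord ℓ)
  pieces a []       = []
  pieces a (e ∷ es) = (a , e) ∷ pieces (a + ω^ e) es

  pieces-exponents : (a : Ord ℓ) (es : List (Ord ℓ)) → map proj₂ (pieces a es) ≡ es
  pieces-exponents a []       = refl
  pieces-exponents a (e ∷ es) = cong (e ∷_) (pieces-exponents (a + ω^ e) es)

  pieces-bound : (a : Ord ℓ) (es : List (Ord ℓ)) {b : Ord ℓ} → a + ∑ ω^_ es ≼ b →
                 All (λ (c , e) → c + ω^ e ≼ b) (pieces a es)
  pieces-bound a []       p = []
  pieces-bound a (e ∷ es) p = ≼-trans (+-monoʳ-≼ a (x≼x+y (ω^ e) (∑ ω^_ es))) p ∷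
    pieces-bound (a + ω^ e) es (≼-trans (proj₁ (+-assoc a (ω^ e) (∑ ω^_ es))) p)

  Precedes : Ord ℓ × Ord ℓ → Ord ℓ × Ord ℓ → Set ℓ
  Precedes (a , e) (b , d) = a + ω^ e ≼ b × d ≼ e

  pieces-start : (a : Ord ℓ) {es : List (Ord ℓ)} {e : Ord ℓ} → All (_≼ e) es →
                 All (λ (b , d) → a ≼ b × d ≼ e) (pieces a es)
  pieces-start a []               = []
  pieces-start a (_∷_ {d} d≼e ds) = (≼-refl , d≼e) ∷
    All.map (λ (p , q) → ≼-trans (x≼x+y a (ω^ d)) p , q) (pieces-start (a + ω^ d) ds)

  pieces-sorted : (a : Ord ℓ) {es : List (Ord ℓ)} → Descending id es → AllPairs Precedes (pieces a es)
  pieces-sorted a []                 = []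
  pieces-sorted a (_∷_ {e} p ps) = pieces-start (a + ω^ e) p ∷ pieces-sorted (a + ω^ e) ps

  All-cartesianProductWith : {P : Pred C ℓ} (f : A → B → C) {xs : List A} {ys : List B} →
    All (λ x → All (λ y → P (f x y)) ys) xs → All P (cartesianProductWith f xs ys)
  All-cartesianProductWith f []       = []
  All-cartesianProductWith f (p ∷ ps) = All.++⁺ (All.map⁺ p) (All-cartesianProductWith f ps)

  All-choices : {n : ℕ} {P : Fin n → Pred A ℓ} {xs : Fin n → List A} → (∀ i → All (P i) (xs i)) →
                All (λ v → ∀ i → P i (v i)) (choices xs)
  All-choices {n = zero}          p = (λ ()) ∷ []
  All-choices {n = suc n} {P = P} p = All-cartesianProductWith Vector._∷_
    (All.map (λ px → All.map (λ { pv zero → px ; pv (suc i) → pv i }) (All-choices (p ∘ suc))) (p zero))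

  -- One separating coordinate suffices: in the intersection no point of the second box is then
  -- below a point of the first, as superadditivity requires.
  BoxBefore : {n : ℕ} → (Fin n → Ord ℓ × Ord ℓ) → (Fin n → Ord ℓ × Ord ℓ) → Set ℓ
  BoxBefore {n = n} u v = Σ[ i ∈ Fin n ] proj₁ (u i) + ω^ proj₂ (u i) ≼ proj₁ (v i)

  degree : {n : ℕ} → (Fin n → Ord ℓ × Ord ℓ) → Ord ℓ
  degree v = ♯[ proj₂ ∘ v ]

  private
    -- Whatever their positions in the list, of two boxes of different degrees
    -- the one of larger degree may come first.
    exchangeable : {key : A → Ord ℓ} {_⊲_ : A → A → Set p} {vs : List A} → AllPairs (Sortable key _⊲_) vs →
      All (λ v → All (λ u → key v ≺ key u → u ⊲ v) vs) vs
    exchangeable []       = []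
    exchangeable (p ∷ ps) =
      ((λ q → ⊥-elim (≺-irrefl q)) ∷ All.map proj₂ p) ∷
      All.zipWith (λ ((v⊲ , _) , q) → (λ _ → v⊲) ∷ q) (p , exchangeable ps)

  -- Exponents descend along each list, so a later box can have the larger degree only by a larger
  -- exponent in some coordinate, and there it comes earlier.
  choices-sortable : {n : ℕ} {xs : Fin n → List (Ord ℓ × Ord ℓ)} → (∀ i → AllPairs Precedes (xs i)) →
                     AllPairs (Sortable degree BoxBefore) (choices xs)
  choices-sortable {n = zero}       p = [] ∷ []
  choices-sortable {n = suc n} {xs} p = go (p zero)
    where
    vs = choices (xs ∘ suc)
    ih = choices-sortable (p ∘ suc)
    go : ∀ {ys} → AllPairs Precedes ys → AllPairs (Sortable degree BoxBefore) (cartesianProductWith Vector._∷_ ys vs)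
    go []                          = []
    go {y ∷ ys} (before ∷ ps) = AllPairs.++⁺
      (AllPairs.map⁺ (AllPairs.map (λ ((i , q) , r) → (suc i , q) , λ s → shift (r (♯-cancelˡ-≺ s))) ih))
      (go ps)
      (All.map⁺ (All.map (λ exchange → All-cartesianProductWith Vector._∷_
        (All.map (λ y-before → All.map (across y-before) exchange) before)) (exchangeable ih)))
      where
      shift : ∀ {y z u v} → BoxBefore u v → BoxBefore (y Vector.∷ u) (z Vector.∷ v)
      shift (i , p) = suc i , p
      across : ∀ {z u v} → Precedes y z → (degree v ≺ degree u → BoxBefore u v) →
               Sortable degree BoxBefore (y Vector.∷ v) (z Vector.∷ u)
      across (end≼ , d≼e) r =
        (zero , end≼) , λ s → shift (r (♯-cancelˡ-≺ (≺-≼-trans s (♯-monoˡ-≼ _ d≼e))))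

  module Extremal {κ : Ord ℓ} (isInfiniteCardinal : IsInfiniteCardinal κ) {m : ℕ} {q : Fin (suc m) → Ord ℓ}
    (𝟎≺q : ∀ i → 𝟎 ≺ q i) (q≤κ : ∀ i → CardinalityAtMost (q i) κ) where

    open Coordinates isInfiniteCardinal 𝟎≺q q≤κ

    -- Ties are broken by the order of `κ` for every `i` alike, so that the intersection is linear
    -- on each fibre.
    label : Fin (suc m) → X → Ord ℓ
    label i x = κ · coordinate x i + ⟦ κ ⟧ x

    label-injective : ∀ i {x y} → label i x ≋ label i y → x ≡ y
    label-injective i {x} {y} p = ⟦⟧-injective κ {x} {y} (proj₂ (lex-injective κ (⟦⟧-≺ κ x) (⟦⟧-≺ κ y) p))

    S : Fin (suc m) → Rel X ℓ
    S i = Below (label i)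

    S-isTotal : ∀ i → IsTotalOrder _≡_ (S i)
    S-isTotal i = Below-isTotalOrder (label i) (label-injective i)

    wS : ∀ i → Wqo (S i)
    wS i = label-Wqo (label i)

    S⇒coordinate-≼ : ∀ i {x y} → S i x y → coordinate x i ≼ coordinate y i
    S⇒coordinate-≼ i {x} {y} = lex⁻ κ (⟦⟧-≺ κ y)

    S⇒≼ : ∀ i {x y} → coordinate x i ≋ coordinate y i → S i x y → ⟦ κ ⟧ x ≼ ⟦ κ ⟧ y
    S⇒≼ i {x} {y} (_ , p) s = +-cancelˡ-≼ (≼-trans s (+-monoˡ-≼ (⟦ κ ⟧ y) (·-monoʳ-≼ κ p)))

    R : Rel X ℓ
    R = ⋂ S

    R-isPartialOrder : IsPartialOrder _≡_ R
    R-isPartialOrder = record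
      { isPreorder = record
        { isEquivalence = isEquivalence
        ; reflexive     = λ { refl i → ≼-refl }
        ; trans         = λ p q i → ≼-trans (p i) (q i)
        }
      -- This takes one coordinate, whence `suc m`.
      ; antisym = λ p q → label-injective zero (p zero , q zero)
      }

    wR : Wqo R
    wR = ⋂-Wqo wS

    κ≼Fibre-R : ∀ {c} → (∀ i → c i ≺ q i) → κ ≼ height wR (Fibre c)
    κ≼Fibre-R c≺q = ≼-trans (κ≼Fibre c≺q)
      (height-mono wR (label-Wqo ⟦ κ ⟧) id λ {x} {y} x∈F y∈F Rxy →
        S⇒≼ zero {x} {y} (≋-trans (x∈F zero) (≋-sym (y∈F zero))) (Rxy zero))

    S-height : ∀ i → height (wS i) Full ≋ κ · q i
    S-height i = labelHeight-bound (label i) (λ {x} _ → ·-position-≺ (⟦⟧-≺ κ x) (coordinate-≺ x i))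
               , ≼-trans (below (q i) ≼-refl) (height-⊆ (wS i) _)
      where
      Slice : Ord ℓ → Pred X ℓ
      Slice c x = coordinate x i ≋ c
      κ≼Slice : ∀ {c} → c ≺ q i → κ ≼ height (wS i) (Slice c)
      κ≼Slice {c} c≺ = ≼-trans (κ≼Fibre {(λ _ → 𝟎) [ i ↦ c ]} (updated (λ j d → d ≺ q j) i c≺ λ j _ → 𝟎≺q j))
        (height-mono (wS i) (label-Wqo ⟦ κ ⟧)
          (λ {x} x∈F → subst (coordinate x i ≋_) (updateAt-updates i (λ _ → 𝟎)) (x∈F i))
          λ {x} {y} x∈F y∈F → S⇒≼ i {x} {y} (≋-trans (x∈F i) (≋-sym (y∈F i))))
      -- Induction on `a`: the slice at `g j` lies after the points of smaller coordinate and adds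
      -- at least `κ`.
      below : ∀ a → a ≼ q i → κ · a ≼ height (wS i) (λ x → coordinate x i ≺ a)
      below a@(lsub g) a≼q = ·-least λ where
        d r (wrap (j , p)) r≺κ → ≺-≼-trans
          (≼-≺-trans (+-monoˡ-≼ r (·-monoʳ-≼ κ (wrap p))) (+-monoʳ-≺ (κ · g j) r≺κ))
          (≼-trans
            (+-mono-≼ (below (g j) (≼-trans (≺⇒≼ (≺lsub g j ≼-refl)) a≼q)) (κ≼Slice (lsub≼⁻ a≼q j)))
            (height-+ (wS i) (λ x≺ → ≺-trans x≺ (≺lsub g j ≼-refl)) (λ (x≼ , _) → ≺lsub g j x≼)
              λ {x} {y} x≺ (_ , ≼y) Syx → ≼⇒⊁ (≼-trans ≼y (S⇒coordinate-≼ i {y} {x} Syx)) x≺))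

    -- Intervals are given by their start and their width.
    InInterval : Ord ℓ × Ord ℓ → Ord ℓ → Set ℓ
    InInterval I c = proj₁ I ≼ c × c ≺ proj₁ I + proj₂ I

    Box : (Fin (suc m) → Ord ℓ × Ord ℓ) → Pred X ℓ
    Box I x = ∀ i → InInterval (I i) (coordinate x i)

    Box-⊆ : ∀ {J} i {I} → (∀ {c} → InInterval I c → InInterval (J i) c) → Box (J [ i ↦ I ]) ⊆ Box J
    Box-⊆ {J} i p x∈ j = updated (λ j I → ∀ {c} → InInterval I c → InInterval (J j) c) i p (λ _ _ → id) j (x∈ j)

    -- The multiples of the `κ · ω^ d` are cofinal once `e` is non-zero; `κ ≼ a` covers the places
    -- in the first copy of `κ`.
    κ·ω^≼ : ∀ e {a} → κ ≼ a → (∀ {d} → d ≺ e → ∀ k → (κ · ω^ d) ·ℕ k ≼ a) → κ · ω^ e ≼ a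
    κ·ω^≼ e {a} κ≼a p = ·-least λ d r d≺ r≺κ → case d r r≺κ (≺ω^⁻ d≺)
      where
      open ≼-Reasoning
      case : ∀ d r → r ≺ κ → d ≼ 𝟎 ⊎ (Σ[ c ∈ Ord ℓ ] (c ≺ e × Σ[ k ∈ ℕ ] d ≼ ω^ c ·ℕ k)) → κ · d + r ≺ a
      case d r r≺κ (inj₁ d≼𝟎) = begin-strict
        κ · d + r    ≤⟨ +-monoˡ-≼ r (≼-trans (·-monoʳ-≼ κ d≼𝟎) (proj₁ (·-zeroʳ κ))) ⟩
        𝟎 + r        ≈⟨ +-identityˡ r ⟩
        r            <⟨ r≺κ ⟩
        κ            ≤⟨ κ≼a ⟩
        a            ∎
      case d r r≺κ (inj₂ (c , c≺e , k , d≼)) = begin-strict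
        κ · d + r                          <⟨ +-monoʳ-≺ (κ · d) r≺κ ⟩
        κ · d + κ                          ≤⟨ +-mono-≼ (·-monoʳ-≼ κ d≼) (κ≼κ·ω^ isInfiniteCardinal c) ⟩
        κ · (ω^ c ·ℕ k) + κ · ω^ c         ≤⟨ +-monoˡ-≼ _ (proj₁ (·-distribˡ-·ℕ κ (ω^ c) k)) ⟩
        (κ · ω^ c) ·ℕ k + κ · ω^ c         ≈⟨ ·ℕ-suc (κ · ω^ c) k ⟩
        (κ · ω^ c) ·ℕ suc k                ≤⟨ p c≺e (suc k) ⟩
        a                                  ∎

    Bounded : (Fin (suc m) → Ord ℓ × Ord ℓ) → Set ℓ
    Bounded I = ∀ i → proj₁ (I i) + proj₂ (I i) ≼ q i

    -- An ordinal below the degree is at most a degree with one `e i` lowered to some `c`. Side `i`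
    -- has room for `k` consecutive intervals of width `ω^ c`, hence the box for `k` boxes of that
    -- degree. Widths are bounded from below only, since the other sides keep their full width.
    box-height : (e : Fin (suc m) → Ord ℓ) → Acc _≺_ ♯[ e ] → (I : Fin (suc m) → Ord ℓ × Ord ℓ) → Bounded I →
                 (∀ i → ω^ e i ≼ proj₂ (I i)) → κ · ω^ ♯[ e ] ≼ height wR (Box I)
    box-height e (acc rs) I bounded wide = κ·ω^≼ ♯[ e ] fibre λ {d} d≺ k → multiple k (≺♯[]⁻ d≺)
      where
      start≺end : ∀ i → proj₁ (I i) ≺ proj₁ (I i) + proj₂ (I i)
      start≺end i = ≼-≺-trans (x≼x+y _ 𝟎) (+-monoʳ-≺ _ (≺-≼-trans (𝟎≺ω^ {a = e i}) (wide i)))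
      fibre : κ ≼ height wR (Box I)
      fibre = ≼-trans (κ≼Fibre-R {proj₁ ∘ I} λ i → ≺-≼-trans (start≺end i) (bounded i))
        (height-⊆ wR λ x∈F i → proj₂ (x∈F i) , ≼-≺-trans (proj₁ (x∈F i)) (start≺end i))
      module _ (i : Fin (suc m)) {c : Ord ℓ} (c≺ : c ≺ e i) where
        e′ = e [ i ↦ c ]
        row : ∀ k (J : Fin (suc m) → Ord ℓ × Ord ℓ) → Bounded J → (∀ j → j ≢ i → ω^ e j ≼ proj₂ (J j)) →
              ω^ c ·ℕ k ≼ proj₂ (J i) → (κ · ω^ ♯[ e′ ]) ·ℕ k ≼ height wR (Box J)
        row zero    J J-bounded J-wide J-wide-i = 𝟎≼
        row (suc k) J J-bounded J-wide J-wide-i = ≼-trans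
          (+-mono-≼
            (box-height e′ (rs (updated-≺ i c≺)) D D-bounded
              (updated (λ j d → ω^ d ≼ proj₂ (D j)) i (≡⇒≼ (cong proj₂ (sym D-at)))
                λ j j≢i → ≼-trans (J-wide j j≢i) (≡⇒≼ (cong proj₂ (sym (updateAt-minimal j i J j≢i))))))
            (row k U U-bounded
              (λ j j≢i → ≼-trans (J-wide j j≢i) (≡⇒≼ (cong proj₂ (sym (updateAt-minimal j i J j≢i)))))
              (≡⇒≼ (cong proj₂ (sym U-at)))))
          (height-+ wR
            (Box-⊆ i λ (p , q) → p , ≺-≼-trans q (+-monoʳ-≼ a first≼))
            (Box-⊆ i λ (p , q) → ≼-trans (x≼x+y a (ω^ c)) p , ≺-≼-trans q end≼)
            λ {x} {y} x∈D y∈U Ryx → ≼⇒⊁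
              (≼-trans (≼-trans (≡⇒≼ (cong proj₁ (sym U-at))) (proj₁ (y∈U i))) (S⇒coordinate-≼ i {y} {x} (Ryx i)))
              (≺-≼-trans (proj₂ (x∈D i)) (≡⇒≼ (cong (λ I → proj₁ I + proj₂ I) D-at))))
          where
          ≡⇒≼ : ∀ {a b : Ord ℓ} → a ≡ b → a ≼ b
          ≡⇒≼ refl = ≼-refl
          a = proj₁ (J i)
          D = J [ i ↦ (a , ω^ c) ]
          U = J [ i ↦ (a + ω^ c , ω^ c ·ℕ k) ]
          D-at : D i ≡ (a , ω^ c)
          D-at = updateAt-updates i J
          U-at : U i ≡ (a + ω^ c , ω^ c ·ℕ k)
          U-at = updateAt-updates i J
          first≼ : ω^ c ≼ proj₂ (J i)
          first≼ = ≼-trans (x≼x+y (ω^ c) (ω^ c ·ℕ k)) J-wide-i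
          end≼ : (a + ω^ c) + ω^ c ·ℕ k ≼ a + proj₂ (J i)
          end≼ = ≼-trans (proj₁ (+-assoc a (ω^ c) (ω^ c ·ℕ k))) (+-monoʳ-≼ a J-wide-i)
          D-bounded : Bounded D
          D-bounded = updated (λ j I → proj₁ I + proj₂ I ≼ q j) i
            (≼-trans (+-monoʳ-≼ a first≼) (J-bounded i)) (λ j _ → J-bounded j)
          U-bounded : Bounded U
          U-bounded = updated (λ j I → proj₁ I + proj₂ I ≼ q j) i
            (≼-trans end≼ (J-bounded i)) (λ j _ → J-bounded j)
      multiple : ∀ {d} k → Σ[ i ∈ Fin (suc m) ] Σ[ c ∈ Ord ℓ ] (c ≺ e i × d ≼ ♯[ e [ i ↦ c ] ]) →
                 (κ · ω^ d) ·ℕ k ≼ height wR (Box I)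
      multiple k (i , c , c≺ , d≼) = ≼-trans (·ℕ-mono-≼ k (·-monoʳ-≼ κ (ω^-mono-≼ d≼)))
        (row i c≺ k I bounded (λ j _ → wide j) (≼-trans (≺⇒≼ (ω^-multiple-≺ k c≺)) (wide i)))

    PieceBox : (Fin (suc m) → Ord ℓ × Ord ℓ) → Pred X ℓ
    PieceBox v = Box λ i → proj₁ (v i) , ω^ proj₂ (v i)

    PieceBoxes : List (Fin (suc m) → Ord ℓ × Ord ℓ) → Pred X ℓ
    PieceBoxes []       x = Polymorphic.⊥
    PieceBoxes (v ∷ vs) x = PieceBox v x ⊎ PieceBoxes vs x

    PieceBoxes-height : ∀ {vs} → AllPairs BoxBefore vs →
      All (λ v → ∀ i → proj₁ (v i) + ω^ proj₂ (v i) ≼ q i) vs →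
      ∑ (λ v → κ · ω^ degree v) vs ≼ height wR (PieceBoxes vs)
    PieceBoxes-height []            []       = 𝟎≼
    PieceBoxes-height {v ∷ vs} (before ∷ ps) (b ∷ bs) = ≼-trans
      (+-mono-≼ (box-height (proj₂ ∘ v) (≺-wellFounded _) _ b (λ _ → ≼-refl)) (PieceBoxes-height ps bs))
      (height-+ wR inj₁ inj₂ λ {x} {y} → apart {x} {y} before)
      where
      apart : ∀ {x y us} → All (BoxBefore v) us → PieceBox v x → PieceBoxes us y → ¬ R y x
      apart {x} {y} ((i , end≼) ∷ _) x∈v (inj₁ y∈u) Ryx = ≼⇒⊁
        (≼-trans end≼ (≼-trans (proj₁ (y∈u i)) (S⇒coordinate-≼ i {y} {x} (Ryx i)))) (proj₂ (x∈v i))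
      apart (_ ∷ before) x∈v (inj₂ y∈us) = apart before x∈v y∈us

    private
      boxes : List (Fin (suc m) → Ord ℓ × Ord ℓ)
      boxes = choices λ i → pieces 𝟎 (cnf (q i))

      boxes-bounded : All (λ v → ∀ i → proj₁ (v i) + ω^ proj₂ (v i) ≼ q i) boxes
      boxes-bounded = All-choices λ i →
        pieces-bound 𝟎 (cnf (q i)) (≼-trans (proj₁ (+-identityˡ _)) (proj₁ (cnf-denotes (q i))))

      boxes-sortable : AllPairs (Sortable degree BoxBefore) boxes
      boxes-sortable = choices-sortable λ i → pieces-sorted 𝟎 (cnf-descending (q i))

      ⨁boxes≼height : ∀ {vs} → boxes ↭ vs → AllPairs (Sorted degree BoxBefore) vs →
                      ⨁ (λ v → κ · ω^ degree v) boxes ≼ height wR Full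
      ⨁boxes≼height {vs} ↭vs sorted = begin
        ⨁ (λ v → κ · ω^ degree v) boxes    ≈⟨ ⨁-↭ _ ↭vs ⟩
        ⨁ (λ v → κ · ω^ degree v) vs       ≈⟨ ⨁κω^≋∑κω^ isInfiniteCardinal degree (AllPairs.map proj₁ sorted) ⟩
        ∑ (λ v → κ · ω^ degree v) vs       ≤⟨ PieceBoxes-height (AllPairs.map proj₂ sorted) (All-resp-↭ ↭vs boxes-bounded) ⟩
        height wR (PieceBoxes vs)          ≤⟨ height-⊆ wR _ ⟩
        height wR Full                     ∎
        where open ≼-Reasoning

    κ·⨂≼height : κ · ⨂ em q ≼ height wR Full
    κ·⨂≼height = ≼-trans
      (proj₁ (κ·⨂ isInfiniteCardinal q proj₂ _ λ i → pieces-exponents 𝟎 (cnf (q i))))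
      (let _ , ↭vs , sorted = sort degree BoxBefore boxes-sortable in ⨁boxes≼height ↭vs sorted)

    S-isWellOrder : ∀ i → IsWellOrderOfType (S i) (κ · q i)
    S-isWellOrder i = record
      { isTotalOrder = S-isTotal i
      ; wellFounded  = wf
      ; type         = ≋⇒≈ (≋-trans (orderType≋height (S-isTotal i) (wS i) wf) (S-height i))
      }
      where wf = IsWPO.wellFounded (Wqo⇒IsWPO (IsTotalOrder.isPartialOrder (S-isTotal i)) (wS i))

    S-lengthAtMost : ∀ i → IsWPOOfLengthAtMost (S i) (κ · q i)
    S-lengthAtMost i = record
      { isWPO = Wqo⇒IsWPO (IsTotalOrder.isPartialOrder (S-isTotal i)) (wS i)
      ; bound = λ L a (isTotal , S⇒L) L-type →
          let open IsWellOrderOfType L-type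
              wL : Wqo L
              wL Y = Bar-mono id (λ _ _ → S⇒L) (wS i Y)
          in unwrap≼ (≼-trans (wrap (proj₂ type)) (≼-trans (proj₁ (orderType≋height isTotal wL wellFounded))
               (≼-trans (height-mono (wS i) wL id λ _ _ → S⇒L) (proj₁ (S-height i)))))
      }

    R-length : IsWPOOfLength R (κ · ⨂ em q)
    R-length = attainedLength ⟦ κ ⟧ enum-injective wR
      (intersection-length isInfiniteCardinal ⟦ κ ⟧ enum-injective q R-isPartialOrder (id , id) S-lengthAtMost)
      κ·⨂≼height
      where
      enum-injective : ∀ {x y} → ⟦ κ ⟧ x ≋ ⟦ κ ⟧ y → x ≡ y
      enum-injective {x} {y} = ⟦⟧-injective κ {x} {y}

proposition1p1 : (em : ∀ {a} → ExcludedMiddle a) →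
    (ext : ∀ {a b} → Extensionality a b) →
    ∀ {ℓ} (κ : Ord ℓ) → IsInfiniteCardinal κ →
    (n : ℕ) → .{{NonZero n}} → (q : Fin n → Ord ℓ) →
    ((X : Set ℓ) → HasCardinality X κ →
    (R : Rel X ℓ) → IsPartialOrder _≡_ R →
    (S : Fin n → Rel X ℓ) → R ⇔ ⋂ S →
    (∀ i → IsWPOOfLengthAtMost (S i) (κ · q i)) →
    IsWPOOfLengthAtMost R (κ · ⨂ em q))
    ×
    ((∀ i → 𝟎 < q i) → (∀ i → CardinalityAtMost (q i) κ) →
    Σ[ X ∈ Set ℓ ] (HasCardinality X κ ×
    (Σ[ S ∈ (Fin n → Rel X ℓ) ]
    ((∀ i → IsWellOrderOfType (S i) (κ · q i)) ×
    IsWPOOfLength (⋂ S) (κ · ⨂ em q)))))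
proposition1p1 em ext κ isInfiniteCardinal (suc _) q =
    (λ X X≅κ R R-po S R⇔⋂S →
      let open Inverse X≅κ in
      intersection-length isInfiniteCardinal (λ x → proj₁ (to x))
        (λ {x} {y} p → trans (sym (inverseʳ {x} {to x} (≤-refl _ , ≤-refl _))) (inverseʳ {y} {to x} (≋⇒≈ p)))
        q R-po R⇔⋂S)
  , λ 𝟎<q q≤κ →
      let open Extremal isInfiniteCardinal (λ i → wrap (𝟎<q i)) q≤κ in
      Canonical κ , Canonical-hasCardinality κ , S , S-isWellOrder , R-length
  where
  open Cardinals em ext
  open UpperBounds em ext
  open ExtremalFamilies em ext
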